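{- Let $\mathscr{M}=(X,\mathcal{I})$ be a matroid, let $1\le k<\mathrm{rk}(\mathscr{M})$, and let $\omega:X\to\mathbb{R}_{>0}$ be a weight function. Then $$\mathrm{I}_\omega(k)^2\ =\ \Bigl(1+\frac1k\Bigr)\Bigl(1+\frac{1}{p(k-1)-1}\Bigr)\,\mathrm{I}_\omega(k-1)\,\mathrm{I}_\omega(k+1)$$ if and only if there exists a constant $s>0$ (depending only on $\mathscr M,\omega,k$) such that for every $S\in\mathcal I_{k-1}$ we have $$|\mathrm{Par}(S)|=p(k-1)\qquad\text{and}\qquad \sum_{x\in\mathcal C}\omega(x)=s\ \text{ for every }\mathcal C\in\mathrm{Par}(S).$$
   Context: A matroid $\mathscr{M}=(X,\mathcal{I})$ is given by its finite ground set $X$ and its collection $\mathcal I\subseteq 2^X$ of independent sets; $\mathrm{rk}(\mathscr M)$ is the maximal size of an independent set; $\mathcal I_j=\{S\in\mathcal I: |S|=j\}$. For $\omega:X\to\mathbb R_{>0}$ put $\omega(S)=\prod_{x\in S}\omega(x)$ and $\mathrm I_\omega(j)=\sum_{S\in\mathcal I_j}\omega(S)$. For $S\in\mathcal I$, the set of continuations is $\mathrm{Cont}(S)=\{x\in X\setminus S: S\cup\{x\}\in\mathcal I\}$. For $x,y\in\mathrm{Cont}(S)$ write $x\sim_S y$ if $x=y$ or $S\cup\{x,y\}\notin\mathcal I$; this is an equivalence relation on $\mathrm{Cont}(S)$. Its equivalence classes are called parallel classes of $S$, and $\mathrm{Par}(S)$ is the set of parallel classes. For $0\le j<\mathrm{rk}(\mathscr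 M)$, $p(j)=\max\{|\mathrm{Par}(S)|: S\in\mathcal I_j\}$. -}

module Defs where

open import Algebra.Bundles using (CommutativeRing; module Semiring)
import Algebra.Definitions.RawSemiring as RawSemiringDefs
open import Data.Fin.Base using (Fin)
import Data.Fin.Properties as Fin
open import Data.Fin.Subset using (Subset; inside; outside; ⊥; ⁅_⁆; _∪_; _∈_; _∉_; _⊆_; ∣_∣)
open import Data.Fin.Subset.Properties using (_∈?_)
open import Data.List.Base using (List; []; _∷_; [_]; _++_; map; filter; foldr; length; allFin)
open import Data.List.Extrema.Nat using (max)
open import Data.Nat.Base using (ℕ; zero; suc) renaming (_<_ to _<ℕ_)
import Data.Nat.Properties as ℕ
open import Data.Product.Base using (∃; _×_; _,_)
open import Data.Sum.Base using (_⊎_)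
open import Data.Vec.Base using () renaming ([] to []ᵥ; _∷_ to _∷ᵥ_)
open import Function.Bundles using (_⇔_; mk⇔; module Equivalence)
open import Level using (0ℓ) renaming (suc to lsuc)
open import Relation.Binary.Core using (Rel)
open import Relation.Binary.PropositionalEquality.Core using (_≡_)
open import Relation.Binary.Structures using (IsStrictTotalOrder)
open import Relation.Nullary using (Dec; ¬_; ¬?; map′; _×-dec_; _⊎-dec_; _→-dec_)
open import Relation.Unary using (Decidable)

-- The real numbers, axiomatised classically as a Dedekind-complete ordered
-- field; these axioms determine ℝ up to isomorphism.

record CompleteOrderedField : Set (lsuc 0ℓ) where
  infix  4 _<_ _≤_
  infix  8 _⁻¹
  field
    commutativeRing : CommutativeRing 0ℓ 0ℓ

  open CommutativeRing commutativeRing public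

  field
    _<_                : Rel Carrier 0ℓ
    isStrictTotalOrder : IsStrictTotalOrder _≈_ _<_
    0<1                : 0# < 1#
    +-monoˡ-<          : ∀ {x y} z → x < y → x + z < y + z
    *-pos              : ∀ {x y} → 0# < x → 0# < y → 0# < x * y
    -- The inverse is total, with an unspecified value at 0#.
    _⁻¹                : Carrier → Carrier
    ⁻¹-cong            : ∀ {x y} → x ≈ y → x ⁻¹ ≈ y ⁻¹
    *-inverseʳ         : ∀ x → ¬ (x ≈ 0#) → x * x ⁻¹ ≈ 1#

  _≤_ : Rel Carrier 0ℓ
  x ≤ y = x < y ⊎ x ≈ y

  IsUpperBound : (Carrier → Set) → Carrier → Set
  IsUpperBound P b = ∀ x → P x → x ≤ b

  field
    supremum : (P : Carrier → Set) → ∃ P → ∃ (IsUpperBound P) →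
               ∃ λ s → IsUpperBound P s × (∀ b → IsUpperBound P b → s ≤ b)

  open RawSemiringDefs (Semiring.rawSemiring semiring) public using (_^_) renaming (_×_ to _⋆_)

  fromℕ : ℕ → Carrier
  fromℕ m = m ⋆ 1#

  ∑ ∏ : {A : Set} → List A → (A → Carrier) → Carrier
  ∑ xs f = foldr (λ x acc → f x + acc) 0# xs
  ∏ xs f = foldr (λ x acc → f x * acc) 1# xs

-- Every subset of Fin n occurs exactly once.
subsets : ∀ n → List (Subset n)
subsets zero    = [ []ᵥ ]
subsets (suc n) = map (outside ∷ᵥ_) (subsets n) ++ map (inside ∷ᵥ_) (subsets n)

elements : ∀ {n} → Subset n → List (Fin n)
elements {n} S = filter (_∈? S) (allFin n)

-- The ground set is Fin n.
record Matroid (n : ℕ) : Set₁ where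
  field
    Indep      : Subset n → Set
    indep?     : Decidable Indep
    ⊥-indep    : Indep ⊥
    hereditary : ∀ {S T} → S ⊆ T → Indep T → Indep S
    exchange   : ∀ {S T} → Indep S → Indep T → ∣ S ∣ <ℕ ∣ T ∣ →
                 ∃ λ x → x ∈ T × x ∉ S × Indep (S ∪ ⁅ x ⁆)

  rk : ℕ
  rk = max 0 (map ∣_∣ (filter indep? (subsets n)))

  IndepOfSize : ℕ → Subset n → Set
  IndepOfSize j S = Indep S × ∣ S ∣ ≡ j

  indepOfSize? : ∀ j → Decidable (IndepOfSize j)
  indepOfSize? j S = indep? S ×-dec (∣ S ∣ ℕ.≟ j)

  ℐ : ℕ → List (Subset n)
  ℐ j = filter (indepOfSize? j) (subsets n)

  Cont : Subset n → Fin n → Set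
  Cont S x = x ∉ S × Indep (S ∪ ⁅ x ⁆)

  cont? : ∀ S → Decidable (Cont S)
  cont? S x = ¬? (x ∈? S) ×-dec indep? (S ∪ ⁅ x ⁆)

  infix 4 _∼[_]_
  _∼[_]_ : Fin n → Subset n → Fin n → Set
  x ∼[ S ] y = x ≡ y ⊎ ¬ Indep (S ∪ (⁅ x ⁆ ∪ ⁅ y ⁆))

  _∼[_]?_ : ∀ x S y → Dec (x ∼[ S ] y)
  x ∼[ S ]? y = (x Fin.≟ y) ⊎-dec ¬? (indep? (S ∪ (⁅ x ⁆ ∪ ⁅ y ⁆)))

  IsParallelClass : Subset n → Subset n → Set
  IsParallelClass S C =
    ∃ λ x → Cont S x × (∀ y → y ∈ C ⇔ (Cont S y × x ∼[ S ] y))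

  isParallelClass? : ∀ S → Decidable (IsParallelClass S)
  isParallelClass? S C = Fin.any? λ x → cont? S x ×-dec Fin.all? λ y →
    let inClass? = cont? S y ×-dec (x ∼[ S ]? y) in
    map′ (λ (f , g) → mk⇔ f g) (λ e → Equivalence.to e , Equivalence.from e)
         (((y ∈? C) →-dec inClass?) ×-dec (inClass? →-dec (y ∈? C)))

  Par : Subset n → List (Subset n)
  Par S = filter (isParallelClass? S) (subsets n)

  -- Meaningful for j < rk, where ℐ j is nonempty.
  p : ℕ → ℕ
  p j = max 0 (map (λ S → length (Par S)) (ℐ j))

module Weighted (ℝ : CompleteOrderedField) {n : ℕ} (M : Matroid n)
                (ω : Fin n → CompleteOrderedField.Carrier ℝ) where

  open CompleteOrderedField ℝ
  open Matroid M

  weight : Subset n → Carrier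
  weight S = ∏ (elements S) ω

  I : ℕ → Carrier
  I j = ∑ (ℐ j) weight

{-# OPTIONS --safe #-}
module Submission where

open import Defs
open import Data.Fin.Base using (Fin)
open import Data.Fin.Subset using (Subset)
open import Data.List.Base using (length)
open import Data.List.Membership.Propositional using (_∈_)
open import Data.Nat.Base using (ℕ; _∸_) renaming (_≤_ to _≤ℕ_; _<_ to _<ℕ_; _+_ to _+ℕ_)
open import Data.Product.Base using (∃; _×_)
open import Function.Bundles using (_⇔_)
open import Relation.Binary.PropositionalEquality.Core using (_≡_)

open import Algebra.Bundles using (RawRing)
import Algebra.Properties.AbelianGroup as AbelianGroupProperties
import Algebra.Properties.CommutativeSemigroup as CommutativeSemigroupProperties
import Algebra.Properties.Ring as RingProperties
import Algebra.Properties.Semiring.Mult as SemiringMult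
import Algebra.Properties.Semiring.Mult.TCOptimised as SemiringMult′
import Algebra.Solver.Ring as RingSolver
open import Algebra.Solver.Ring.AlmostCommutativeRing using (_-Raw-AlmostCommutative⟶_; fromCommutativeRing)
open import Data.Bool.Base using (true; false; if_then_else_)
import Data.Bool.Properties as Bool
open import Data.Empty using (⊥-elim)
open import Data.Fin.Base using (zero; suc)
import Data.Fin.Properties as Fin
open import Data.Fin.Subset using (inside; outside; ⊥; ⁅_⁆; _∪_; _⊆_; ∣_∣) renaming (_∈_ to _∈ₛ_; _∉_ to _∉ₛ_)
open import Data.Fin.Subset.Properties using (_∈?_; ∪-identityʳ; ∪-assoc; ∪-comm; x∈⁅y⁆⇒x≡y; x∈⁅x⁆; x∈p∪q⁺; x∈p∪q⁻; ⊆-antisym; p⊂q⇒∣p∣<∣q∣; ∣⊥∣≡0; ⊥⊆)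
open import Data.List.Base using (List; []; _∷_; _++_; map; filter; allFin; tabulate)
open import Data.List.Extrema.Nat using (xs≤max; argmax-sel)
open import Data.List.Membership.Propositional.Properties using (∈-++⁺ˡ; ∈-++⁺ʳ; ∈-map⁺; ∈-map⁻; ∈-filter⁺; ∈-filter⁻; ∈-allFin)
import Data.List.Relation.Unary.All as All
open import Data.List.Relation.Unary.Any using (here; there)
open import Data.Maybe.Base as Maybe using (Maybe)
open import Data.Nat.Base as ℕ using (zero; suc; z≤n; s≤s)
import Data.Nat.Properties as ℕ
open import Data.Product.Base using (_,_; proj₁; proj₂)
open import Data.Sum.Base using (_⊎_; inj₁; inj₂)
open import Data.Vec.Base as Vec using () renaming ([] to []ᵥ; _∷_ to _∷ᵥ_)
open import Data.Vec.Functional using () renaming (_∷_ to _◂_)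
open import Data.Vec.Properties using (≡-dec; lookup∘tabulate; lookup⇒[]=; []=⇒lookup)
open import Function.Bundles using (mk⇔; module Equivalence)
open import Relation.Binary.Bundles using (StrictTotalOrder)
import Relation.Binary.Construct.StrictToNonStrict as StrictToNonStrict
open import Relation.Binary.Definitions using (tri<; tri≈; tri>)
open import Relation.Binary.PropositionalEquality as ≡ using (_≢_)
import Relation.Binary.Reasoning.StrictPartialOrder as StrictPartialOrderReasoning
open import Relation.Binary.Structures using (IsStrictTotalOrder; IsTotalOrder)
open import Relation.Nullary using (Dec; does; yes; no; ¬_; ¬?; _×-dec_)
open import Relation.Nullary.Decidable.Core using (dec⇒maybe; decidable-stable)

-- Contracting an independent set S of size k - 1, let a_C be the weight of the class C
-- and consider the quadratic form
--   H_S(u) = (A + P u₀)² - Σ_C (a_C(u) + u₀)² - (P - |Par S|) u₀²,   A = Σ_C a_C(u),   P = p(k - 1).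
-- The form Σ_S ω(S) H_S, summed over these S, takes at the points ω and u₀ = 1 and their
-- pairing the values k (k + 1) I(k + 1), P (P - 1) I(k - 1) and (P - 1) k I(k), so that the
-- equality in question says that its restriction to the plane of these points is degenerate.
-- Up to a factor it is the form attached to S = ∅ when forms are defined for all smaller
-- independent sets by H_S = Σ_x ω(x) H_{S + x}.
--
-- Each form is negative semidefinite on the orthogonal complement of ω.  For |S| = k - 1 this
-- is read off the display; it passes from the H_{S + x} to H_S because the rows of H_S
-- are H_{S + x}(ω, ·): given u orthogonal to ω, solving a Poisson equation on the connected
-- graph of nonparallel pairs gives u′ = u + ω φ with H_{S + x}(ω, u′ - φ(x) ω) = 0 for all x,
-- and summing H_{S + x}(u′ - φ(x) ω) ≤ 0 yields H_S(u) ≤ 0.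
--
-- Hence degeneracy produces a vector z = α ω - β u₀ in the kernel of H_∅, the kernel descends
-- from H_S to every H_{S + x}, and for |S| = k - 1 it forces α a_C(ω) = β and |Par S| = P.

-- `H_S` is twice the second elementary symmetric polynomial of `P` numbers: `a_C + u₀` for each
-- parallel class of `S`, and `u₀` for each of `P - |Par S|` empty classes added as padding. Thanks
-- to the padding the coefficient of `u₀²` is `P (P - 1)` for every `S`, so that the sum over all
-- `S` sees only `I(k - 1)`, `I(k)` and `I(k + 1)`; and in the case of equality the padding squares
-- must vanish too, which is where `|Par S| = P` comes from.
--
-- The obstacle is that equality is known only for the sum, while the conclusion concerns each `S`.
-- Having a single positive direction does not localise; a kernel vector does. A null vector
-- orthogonal to `ω` lies in the kernel, since the form has one sign there and is positive at `ω`;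
-- and a vanishing sum of nonpositive terms forces each term to vanish.
--
-- The converse is a computation: if every `S` has `P` classes, all of weight `s`, then `ω - s u₀`
-- annihilates the restriction of every `H_S` to the plane of `ω` and `u₀ = 1`, hence also that of
-- their sum.

module OrderedField (ℝ : CompleteOrderedField) where

  open CompleteOrderedField ℝ hiding (zero)
  open SemiringMult semiring using (×-homo-+; ×1-homo-*)
  open SemiringMult′ semiring using (×ᵤ≈×) renaming (_×_ to _×′_)
  open RingProperties ring using (x[y-z]≈xy-xz; [y-z]x≈yx-zx; -0#≈0#)
  open AbelianGroupProperties +-abelianGroup using (⁻¹-∙-comm; ⁻¹-involutive)
  open CommutativeSemigroupProperties +-commutativeSemigroup using (interchange)

  -- Integer coefficients for the ring solver

  reduce : ℕ → ℕ → ℕ × ℕ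
  reduce (suc a) (suc b) = reduce a b
  reduce a       b       = a , b

  -- The integers, a − b being represented by the reduced pair (a , b).
  differences : RawRing _ _
  differences = record
    { Carrier = ℕ × ℕ
    ; _≈_ = _≡_
    ; _+_ = λ (a , b) (c , d) → reduce (a ℕ.+ c) (b ℕ.+ d)
    ; _*_ = λ (a , b) (c , d) → reduce (a ℕ.* c ℕ.+ b ℕ.* d) (a ℕ.* d ℕ.+ b ℕ.* c)
    ; -_ = λ (a , b) → b , a
    ; 0# = 0 , 0
    ; 1# = 1 , 0
    }

  private module D = RawRing differences

  -- The case split makes constants of the solver evaluate to 0# and 1# on the nose.
  ⟦_⟧ᵈ : ℕ × ℕ → Carrier
  ⟦ a , zero ⟧ᵈ = a ×′ 1#
  ⟦ a , suc b ⟧ᵈ = fromℕ a - fromℕ (suc b)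

  ⟦⟧ᵈ≈ : ∀ a b → ⟦ a , b ⟧ᵈ ≈ fromℕ a - fromℕ b
  ⟦⟧ᵈ≈ a zero = trans (sym (×ᵤ≈× a 1#)) (trans (sym (+-identityʳ _)) (+-congˡ (sym -0#≈0#)))
  ⟦⟧ᵈ≈ a (suc b) = refl

  strictTotalOrder : StrictTotalOrder _ _ _
  strictTotalOrder = record { isStrictTotalOrder = isStrictTotalOrder }

  module ≈-Reasoning = StrictPartialOrderReasoning (StrictTotalOrder.strictPartialOrder strictTotalOrder)
  open ≈-Reasoning

  ⟦⟧ᵈ-sound : ∀ p q → proj₁ p ℕ.+ proj₂ q ≡ proj₁ q ℕ.+ proj₂ p → ⟦ p ⟧ᵈ ≈ ⟦ q ⟧ᵈ
  ⟦⟧ᵈ-sound (a , b) (c , d) eq = begin-equality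
    ⟦ a , b ⟧ᵈ                          ≈⟨ ⟦⟧ᵈ≈ a b ⟩
    A - B                               ≈⟨ +-congˡ (trans (sym (+-identityʳ _)) (+-congˡ (sym (-‿inverseʳ D′)))) ⟩
    A + (- B + (D′ - D′))               ≈⟨ +-congˡ (+-comm _ _) ⟩
    A + ((D′ - D′) - B)                 ≈⟨ trans (+-congˡ (+-assoc _ _ _)) (sym (+-assoc _ _ _)) ⟩
    (A + D′) + (- D′ - B)               ≈⟨ +-cong (trans (sym (×-homo-+ 1# a d)) (trans (reflexive (≡.cong fromℕ eq)) (×-homo-+ 1# c b))) (+-comm _ _) ⟩
    (C + B) + (- B - D′)                ≈⟨ trans (+-assoc _ _ _) (+-congˡ (sym (+-assoc _ _ _))) ⟩
    C + ((B - B) - D′)                  ≈⟨ +-congˡ (trans (+-congʳ (-‿inverseʳ B)) (+-identityˡ _)) ⟩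
    C - D′                              ≈⟨ ⟦⟧ᵈ≈ c d ⟨
    ⟦ c , d ⟧ᵈ                          ∎
    where
    A = fromℕ a
    B = fromℕ b
    C = fromℕ c
    D′ = fromℕ d

  reduce-difference : ∀ a b → proj₁ (reduce a b) ℕ.+ b ≡ a ℕ.+ proj₂ (reduce a b)
  reduce-difference zero    b       = ≡.refl
  reduce-difference (suc a) zero    = ≡.refl
  reduce-difference (suc a) (suc b) = ≡.trans (ℕ.+-suc _ b) (≡.cong suc (reduce-difference a b))

  ⟦⟧ᵈ-reduce : ∀ a b → ⟦ reduce a b ⟧ᵈ ≈ fromℕ a - fromℕ b
  ⟦⟧ᵈ-reduce a b = trans (⟦⟧ᵈ-sound (reduce a b) (a , b) (reduce-difference a b)) (⟦⟧ᵈ≈ a b)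

  ⟦⟧ᵈ-+ : ∀ p q → ⟦ p D.+ q ⟧ᵈ ≈ ⟦ p ⟧ᵈ + ⟦ q ⟧ᵈ
  ⟦⟧ᵈ-+ (a , b) (c , d) = begin-equality
    ⟦ reduce (a ℕ.+ c) (b ℕ.+ d) ⟧ᵈ                 ≈⟨ ⟦⟧ᵈ-reduce (a ℕ.+ c) (b ℕ.+ d) ⟩
    fromℕ (a ℕ.+ c) - fromℕ (b ℕ.+ d)               ≈⟨ +-cong (×-homo-+ 1# a c) (-‿cong (×-homo-+ 1# b d)) ⟩
    (fromℕ a + fromℕ c) - (fromℕ b + fromℕ d)       ≈⟨ +-congˡ (sym (⁻¹-∙-comm _ _)) ⟩
    (fromℕ a + fromℕ c) + (- fromℕ b - fromℕ d)     ≈⟨ interchange _ _ _ _ ⟩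
    (fromℕ a - fromℕ b) + (fromℕ c - fromℕ d)       ≈⟨ +-cong (⟦⟧ᵈ≈ a b) (⟦⟧ᵈ≈ c d) ⟨
    ⟦ a , b ⟧ᵈ + ⟦ c , d ⟧ᵈ                         ∎

  ⟦⟧ᵈ-* : ∀ p q → ⟦ p D.* q ⟧ᵈ ≈ ⟦ p ⟧ᵈ * ⟦ q ⟧ᵈ
  ⟦⟧ᵈ-* (a , b) (c , d) = begin-equality
    ⟦ reduce (a ℕ.* c ℕ.+ b ℕ.* d) (a ℕ.* d ℕ.+ b ℕ.* c) ⟧ᵈ  ≈⟨ ⟦⟧ᵈ-reduce (a ℕ.* c ℕ.+ b ℕ.* d) (a ℕ.* d ℕ.+ b ℕ.* c) ⟩
    fromℕ (a ℕ.* c ℕ.+ b ℕ.* d) - fromℕ (a ℕ.* d ℕ.+ b ℕ.* c)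
      ≈⟨ +-cong (homo a c b d) (-‿cong (homo a d b c)) ⟩
    (A * C + B * D′) - (A * D′ + B * C)              ≈⟨ +-congˡ (sym (⁻¹-∙-comm _ _)) ⟩
    (A * C + B * D′) + (- (A * D′) - B * C)          ≈⟨ interchange _ _ _ _ ⟩
    (A * C - A * D′) + (B * D′ - B * C)              ≈⟨ +-congˡ (+-comm _ _) ⟩
    (A * C - A * D′) + (- (B * C) + B * D′)          ≈⟨ +-congˡ (+-congˡ (sym (⁻¹-involutive _))) ⟩
    (A * C - A * D′) + (- (B * C) - - (B * D′))      ≈⟨ +-congˡ (⁻¹-∙-comm _ _) ⟩
    (A * C - A * D′) - (B * C - B * D′)              ≈⟨ +-cong (x[y-z]≈xy-xz A C D′) (-‿cong (x[y-z]≈xy-xz B C D′)) ⟨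
    A * (C - D′) - B * (C - D′)                      ≈⟨ [y-z]x≈yx-zx (C - D′) A B ⟨
    (A - B) * (C - D′)                               ≈⟨ *-cong (⟦⟧ᵈ≈ a b) (⟦⟧ᵈ≈ c d) ⟨
    ⟦ a , b ⟧ᵈ * ⟦ c , d ⟧ᵈ                          ∎
    where
    A = fromℕ a
    B = fromℕ b
    C = fromℕ c
    D′ = fromℕ d
    homo : ∀ i j k l → fromℕ (i ℕ.* j ℕ.+ k ℕ.* l) ≈ fromℕ i * fromℕ j + fromℕ k * fromℕ l
    homo i j k l = trans (×-homo-+ 1# (i ℕ.* j) (k ℕ.* l)) (+-cong (×1-homo-* i j) (×1-homo-* k l))

  ⟦⟧ᵈ-neg : ∀ p → ⟦ D.- p ⟧ᵈ ≈ - ⟦ p ⟧ᵈ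
  ⟦⟧ᵈ-neg (a , b) = begin-equality
    ⟦ b , a ⟧ᵈ                 ≈⟨ ⟦⟧ᵈ≈ b a ⟩
    fromℕ b - fromℕ a          ≈⟨ +-comm _ _ ⟩
    - fromℕ a + fromℕ b        ≈⟨ +-congˡ (sym (⁻¹-involutive _)) ⟩
    - fromℕ a - - fromℕ b      ≈⟨ ⁻¹-∙-comm _ _ ⟩
    - (fromℕ a - fromℕ b)      ≈⟨ -‿cong (⟦⟧ᵈ≈ a b) ⟨
    - ⟦ a , b ⟧ᵈ               ∎

  ⟦⟧ᵈ-homomorphism : differences -Raw-AlmostCommutative⟶ fromCommutativeRing commutativeRing
  ⟦⟧ᵈ-homomorphism = record
    { ⟦_⟧ = ⟦_⟧ᵈ ; +-homo = ⟦⟧ᵈ-+ ; *-homo = ⟦⟧ᵈ-* ; -‿homo = ⟦⟧ᵈ-neg ; 0-homo = refl ; 1-homo = refl }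

  ⟦⟧ᵈ-≟ : ∀ p q → Maybe (⟦ p ⟧ᵈ ≈ ⟦ q ⟧ᵈ)
  ⟦⟧ᵈ-≟ p q = Maybe.map (⟦⟧ᵈ-sound p q) (dec⇒maybe (proj₁ p ℕ.+ proj₂ q ℕ.≟ proj₁ q ℕ.+ proj₂ p))

  open RingSolver differences (fromCommutativeRing commutativeRing) ⟦⟧ᵈ-homomorphism ⟦⟧ᵈ-≟
    public using (solve; _:=_; _:+_; _:*_; _:-_; :-_; con; Polynomial)

  -- Order and inequalities in the field

  private module ≤-Order = StrictToNonStrict _≈_ _<_

  open IsTotalOrder (≤-Order.isTotalOrder isStrictTotalOrder) public
    using () renaming (refl to ≤-refl; trans to ≤-trans; antisym to ≤-antisym; reflexive to ≤-reflexive; total to ≤-total)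
  open IsStrictTotalOrder isStrictTotalOrder public
    using (compare) renaming (irrefl to <-irrefl; trans to <-trans)

  <⇒≤ : ∀ {x y} → x < y → x ≤ y
  <⇒≤ = inj₁

  <⇒≱ : ∀ {x y} → x < y → ¬ (y ≤ x)
  <⇒≱ x<y y≤x = <-irrefl refl (begin-strict _ <⟨ x<y ⟩ _ ≤⟨ y≤x ⟩ _ ∎)

  pos⇒≉0 : ∀ {x} → 0# < x → ¬ (x ≈ 0#)
  pos⇒≉0 0<x x≈0 = <-irrefl (sym x≈0) 0<x

  0≤1 : 0# ≤ 1#
  0≤1 = <⇒≤ 0<1

  +-monoˡ-≤ : ∀ {x y} z → x ≤ y → x + z ≤ y + z
  +-monoˡ-≤ z (inj₁ x<y) = inj₁ (+-monoˡ-< z x<y)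
  +-monoˡ-≤ z (inj₂ x≈y) = inj₂ (+-congʳ x≈y)

  +-mono-≤ : ∀ {x y u v} → x ≤ y → u ≤ v → x + u ≤ y + v
  +-mono-≤ {x} {y} {u} {v} x≤y u≤v = begin
    x + u ≤⟨ +-monoˡ-≤ u x≤y ⟩
    y + u ≈⟨ +-comm y u ⟩
    u + y ≤⟨ +-monoˡ-≤ y u≤v ⟩
    v + y ≈⟨ +-comm v y ⟩
    y + v ∎

  +-nonneg : ∀ {x y} → 0# ≤ x → 0# ≤ y → 0# ≤ x + y
  +-nonneg 0≤x 0≤y = ≤-trans (≤-reflexive (sym (+-identityˡ 0#))) (+-mono-≤ 0≤x 0≤y)

  +-pos-nonneg : ∀ {x y} → 0# < x → 0# ≤ y → 0# < x + y
  +-pos-nonneg {x} {y} 0<x 0≤y = begin-strict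
    0#     <⟨ 0<x ⟩
    x      ≈⟨ +-identityʳ x ⟨
    x + 0# ≤⟨ +-mono-≤ ≤-refl 0≤y ⟩
    x + y  ∎

  -- An inequality witnessed by the identity y ≈ x + d with d ≥ 0.
  ≤-by : ∀ {x y d} → 0# ≤ d → y ≈ x + d → x ≤ y
  ≤-by {x} {y} {d} 0≤d y≈x+d = begin
    x      ≈⟨ +-identityʳ x ⟨
    x + 0# ≤⟨ +-mono-≤ ≤-refl 0≤d ⟩
    x + d  ≈⟨ y≈x+d ⟨
    y      ∎

  x≤y⇒0≤y-x : ∀ {x y} → x ≤ y → 0# ≤ y - x
  x≤y⇒0≤y-x {x} {y} x≤y = begin
    0#    ≈⟨ -‿inverseʳ x ⟨
    x - x ≤⟨ +-monoˡ-≤ (- x) x≤y ⟩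
    y - x ∎

  x<y⇒0<y-x : ∀ {x y} → x < y → 0# < y - x
  x<y⇒0<y-x {x} {y} x<y = begin-strict
    0#    ≈⟨ -‿inverseʳ x ⟨
    x - x <⟨ +-monoˡ-< (- x) x<y ⟩
    y - x ∎

  x≤0⇒0≤-x : ∀ {x} → x ≤ 0# → 0# ≤ - x
  x≤0⇒0≤-x {x} x≤0 = ≤-trans (x≤y⇒0≤y-x x≤0) (≤-reflexive (+-identityˡ (- x)))

  *-nonneg : ∀ {x y} → 0# ≤ x → 0# ≤ y → 0# ≤ x * y
  *-nonneg (inj₁ 0<x) (inj₁ 0<y) = inj₁ (*-pos 0<x 0<y)
  *-nonneg {x} {y} (inj₂ 0≈x) _  = inj₂ (trans (sym (zeroˡ y)) (*-congʳ 0≈x))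
  *-nonneg {x} {y} (inj₁ _) (inj₂ 0≈y) = inj₂ (trans (sym (zeroʳ x)) (*-congˡ 0≈y))

  *-monoˡ-≤ : ∀ {x y z} → 0# ≤ z → x ≤ y → z * x ≤ z * y
  *-monoˡ-≤ {x} {y} {z} 0≤z x≤y = ≤-by (*-nonneg 0≤z (x≤y⇒0≤y-x x≤y))
    (solve 3 (λ x y z → z :* y := z :* x :+ z :* (y :- x)) refl x y z)

  square-nonneg : ∀ x → 0# ≤ x * x
  square-nonneg x with ≤-total 0# x
  ... | inj₁ 0≤x = *-nonneg 0≤x 0≤x
  ... | inj₂ x≤0 = ≤-trans (*-nonneg (x≤0⇒0≤-x x≤0) (x≤0⇒0≤-x x≤0))
    (≤-reflexive (solve 1 (λ x → (:- x) :* (:- x) := x :* x) refl x))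

  *-cancelˡ : ∀ {x} y z → ¬ (x ≈ 0#) → x * y ≈ x * z → y ≈ z
  *-cancelˡ {x} y z x≉0 xy≈xz = trans (sym (divide y)) (trans (*-congˡ xy≈xz) (divide z))
    where
    divide : ∀ w → x ⁻¹ * (x * w) ≈ w
    divide w = begin-equality
      x ⁻¹ * (x * w)  ≈⟨ solve 3 (λ x i w → i :* (x :* w) := (x :* i) :* w) refl x (x ⁻¹) w ⟩
      x * x ⁻¹ * w    ≈⟨ *-congʳ (*-inverseʳ x x≉0) ⟩
      1# * w          ≈⟨ *-identityˡ w ⟩
      w               ∎

  x*y≈0⇒y≈0 : ∀ {x} y → ¬ (x ≈ 0#) → x * y ≈ 0# → y ≈ 0#
  x*y≈0⇒y≈0 {x} y x≉0 xy≈0 = *-cancelˡ y 0# x≉0 (trans xy≈0 (sym (zeroʳ x)))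

  *-≉0 : ∀ {x y} → ¬ (x ≈ 0#) → ¬ (y ≈ 0#) → ¬ (x * y ≈ 0#)
  *-≉0 x≉0 y≉0 xy≈0 = y≉0 (x*y≈0⇒y≈0 _ x≉0 xy≈0)

  square-pos : ∀ {x} → ¬ (x ≈ 0#) → 0# < x * x
  square-pos {x} x≉0 with square-nonneg x
  ... | inj₁ 0<x² = 0<x²
  ... | inj₂ 0≈x² = ⊥-elim (*-≉0 x≉0 x≉0 (sym 0≈x²))

  square≈0⇒≈0 : ∀ {x} → x * x ≈ 0# → x ≈ 0#
  square≈0⇒≈0 {x} x²≈0 with compare x 0#
  ... | tri≈ _ x≈0 _ = x≈0
  ... | tri< _ x≉0 _ = x*y≈0⇒y≈0 x x≉0 x²≈0
  ... | tri> _ x≉0 _ = x*y≈0⇒y≈0 x x≉0 x²≈0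

  *-cancelˡ-≤0 : ∀ {x y} → 0# < x → x * y ≤ 0# → y ≤ 0#
  *-cancelˡ-≤0 {x} {y} 0<x xy≤0 with compare y 0#
  ... | tri< y<0 _ _ = inj₁ y<0
  ... | tri≈ _ y≈0 _ = inj₂ y≈0
  ... | tri> _ _ 0<y = ⊥-elim (<⇒≱ (*-pos 0<x 0<y) xy≤0)

  *-cancelˡ-pos : ∀ {x y} → 0# < x → 0# < x * y → 0# < y
  *-cancelˡ-pos {x} {y} 0<x 0<xy with compare 0# y
  ... | tri< 0<y _ _ = 0<y
  ... | tri≈ _ 0≈y _ = ⊥-elim (<-irrefl (sym (trans (*-congˡ (sym 0≈y)) (zeroʳ x))) 0<xy)
  ... | tri> _ _ y<0 = ⊥-elim (<⇒≱ 0<xy (≤-trans (*-monoˡ-≤ (<⇒≤ 0<x) (<⇒≤ y<0)) (≤-reflexive (zeroʳ x))))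

  +≈0⇒≈0 : ∀ {x y} → 0# ≤ x → 0# ≤ y → x + y ≈ 0# → x ≈ 0#
  +≈0⇒≈0 0≤x 0≤y x+y≈0 = ≤-antisym (≤-by 0≤y (sym x+y≈0)) 0≤x

  fromℕ-nonneg : ∀ m → 0# ≤ fromℕ m
  fromℕ-nonneg zero    = ≤-refl
  fromℕ-nonneg (suc m) = +-nonneg 0≤1 (fromℕ-nonneg m)

  fromℕ-pos : ∀ m → 0# < fromℕ (suc m)
  fromℕ-pos m = +-pos-nonneg 0<1 (fromℕ-nonneg m)

  fromℕ-mono-≤ : ∀ {i j} → i ℕ.≤ j → fromℕ i ≤ fromℕ j
  fromℕ-mono-≤ {j = j} z≤n = fromℕ-nonneg j
  fromℕ-mono-≤ (s≤s i≤j) = +-mono-≤ ≤-refl (fromℕ-mono-≤ i≤j)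

  fromℕ-mono-< : ∀ {i j} → i ℕ.< j → fromℕ i < fromℕ j
  fromℕ-mono-< {i} {j} i<j = begin-strict
    fromℕ i       ≈⟨ +-identityˡ _ ⟨
    0# + fromℕ i  <⟨ +-monoˡ-< (fromℕ i) 0<1 ⟩
    1# + fromℕ i  ≤⟨ fromℕ-mono-≤ {suc i} {j} i<j ⟩
    fromℕ j       ∎

  fromℕ-injective : ∀ {i j} → fromℕ i ≈ fromℕ j → i ≡ j
  fromℕ-injective {i} {j} eq with ℕ.<-cmp i j
  ... | tri< i<j _ _ = ⊥-elim (<-irrefl eq (fromℕ-mono-< i<j))
  ... | tri≈ _ i≡j _ = i≡j
  ... | tri> _ _ j<i = ⊥-elim (<-irrefl (sym eq) (fromℕ-mono-< j<i))

  -- Finite sums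

  private variable
    A B : Set

  ∑-cong : ∀ (xs : List A) {f g} → (∀ x → f x ≈ g x) → ∑ xs f ≈ ∑ xs g
  ∑-cong []       f≈g = refl
  ∑-cong (x ∷ xs) f≈g = +-cong (f≈g x) (∑-cong xs f≈g)

  ∑-cong-∈ : ∀ (xs : List A) {f g} → (∀ {x} → x ∈ xs → f x ≈ g x) → ∑ xs f ≈ ∑ xs g
  ∑-cong-∈ []       f≈g = refl
  ∑-cong-∈ (x ∷ xs) f≈g = +-cong (f≈g (here ≡.refl)) (∑-cong-∈ xs (λ x∈xs → f≈g (there x∈xs)))

  ∑-0 : ∀ (xs : List A) {f} → (∀ x → f x ≈ 0#) → ∑ xs f ≈ 0#
  ∑-0 []       f≈0 = refl
  ∑-0 (x ∷ xs) f≈0 = trans (+-cong (f≈0 x) (∑-0 xs f≈0)) (+-identityˡ 0#)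

  ∑-+ : ∀ (xs : List A) f g → ∑ xs (λ x → f x + g x) ≈ ∑ xs f + ∑ xs g
  ∑-+ []       f g = sym (+-identityˡ 0#)
  ∑-+ (x ∷ xs) f g = trans (+-congˡ (∑-+ xs f g)) (interchange _ _ _ _)

  ∑-*ˡ : ∀ (xs : List A) c f → ∑ xs (λ x → c * f x) ≈ c * ∑ xs f
  ∑-*ˡ []       c f = sym (zeroʳ c)
  ∑-*ˡ (x ∷ xs) c f = trans (+-congˡ (∑-*ˡ xs c f)) (sym (distribˡ c _ _))

  ∑-*ʳ : ∀ (xs : List A) c f → ∑ xs (λ x → f x * c) ≈ ∑ xs f * c
  ∑-*ʳ xs c f = trans (∑-cong xs (λ x → *-comm (f x) c)) (trans (∑-*ˡ xs c f) (*-comm c _))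

  ∑-linear : ∀ (xs : List A) a b f g → ∑ xs (λ x → a * f x + b * g x) ≈ a * ∑ xs f + b * ∑ xs g
  ∑-linear xs a b f g = trans (∑-+ xs _ _) (+-cong (∑-*ˡ xs a f) (∑-*ˡ xs b g))

  ∑-swap : ∀ (xs : List A) (ys : List B) (f : A → B → Carrier) → ∑ xs (λ x → ∑ ys (f x)) ≈ ∑ ys (λ y → ∑ xs (λ x → f x y))
  ∑-swap []       ys f = sym (∑-0 ys (λ _ → refl))
  ∑-swap (x ∷ xs) ys f = trans (+-congˡ (∑-swap xs ys f)) (sym (∑-+ ys (f x) _))

  ∑-++ : ∀ (xs ys : List A) f → ∑ (xs ++ ys) f ≈ ∑ xs f + ∑ ys f
  ∑-++ []       ys f = sym (+-identityˡ _)
  ∑-++ (x ∷ xs) ys f = trans (+-congˡ (∑-++ xs ys f)) (sym (+-assoc _ _ _))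

  ∑-map : ∀ (h : A → B) xs f → ∑ (map h xs) f ≈ ∑ xs (λ x → f (h x))
  ∑-map h []       f = refl
  ∑-map h (x ∷ xs) f = +-congˡ (∑-map h xs f)

  ∑-length : ∀ (xs : List A) → ∑ xs (λ _ → 1#) ≈ fromℕ (length xs)
  ∑-length []       = refl
  ∑-length (x ∷ xs) = +-congˡ (∑-length xs)

  ∑-nonneg : ∀ (xs : List A) {f} → (∀ x → 0# ≤ f x) → 0# ≤ ∑ xs f
  ∑-nonneg []       0≤f = ≤-refl
  ∑-nonneg (x ∷ xs) 0≤f = +-nonneg (0≤f x) (∑-nonneg xs 0≤f)

  ∑-mono : ∀ (xs : List A) {f g} → (∀ x → f x ≤ g x) → ∑ xs f ≤ ∑ xs g
  ∑-mono []       f≤g = ≤-refl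
  ∑-mono (x ∷ xs) f≤g = +-mono-≤ (f≤g x) (∑-mono xs f≤g)

  term≤∑ : ∀ {xs : List A} {x} f → (∀ y → 0# ≤ f y) → x ∈ xs → f x ≤ ∑ xs f
  term≤∑ {xs = _ ∷ xs} f 0≤f (here ≡.refl) = ≤-by (∑-nonneg xs 0≤f) refl
  term≤∑ {xs = y ∷ _}  f 0≤f (there x∈xs)  = ≤-trans (term≤∑ f 0≤f x∈xs) (≤-by (0≤f y) (+-comm _ _))

  ∑-pos : ∀ {xs : List A} {x} f → (∀ y → 0# ≤ f y) → x ∈ xs → 0# < f x → 0# < ∑ xs f
  ∑-pos {xs = xs} {x} f 0≤f x∈xs 0<fx = begin-strict
    0#     <⟨ 0<fx ⟩
    f x    ≤⟨ term≤∑ f 0≤f x∈xs ⟩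
    ∑ xs f ∎

  ∑≈0⇒term≈0 : ∀ {xs : List A} {x} f → (∀ y → 0# ≤ f y) → ∑ xs f ≈ 0# → x ∈ xs → f x ≈ 0#
  ∑≈0⇒term≈0 f 0≤f ∑≈0 x∈xs = ≤-antisym (≤-trans (term≤∑ f 0≤f x∈xs) (≤-reflexive ∑≈0)) (0≤f _)

  -- Indicators of decidable propositions

  [_] : ∀ {P : Set} → Dec P → Carrier
  [ P? ] = if does P? then 1# else 0#

  [_]-true : ∀ {P} (P? : Dec P) → P → [ P? ] ≈ 1#
  [ yes _ ]-true p = refl
  [ no ¬p ]-true p = ⊥-elim (¬p p)

  [_]-false : ∀ {P} (P? : Dec P) → ¬ P → [ P? ] ≈ 0#
  [ yes p ]-false ¬p = ⊥-elim (¬p p)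
  [ no _ ]-false  ¬p = refl

  [_]-nonneg : ∀ {P} (P? : Dec P) → 0# ≤ [ P? ]
  [ yes _ ]-nonneg = 0≤1
  [ no _ ]-nonneg  = ≤-refl

  0<[_] : ∀ {Q} (Q? : Dec Q) → Q → 0# < [ Q? ]
  0<[ Q? ] q = begin-strict
    0#     <⟨ 0<1 ⟩
    1#     ≈⟨ [ Q? ]-true q ⟨
    [ Q? ] ∎

  []-cong : ∀ {P Q} (P? : Dec P) (Q? : Dec Q) → (P → Q) → (Q → P) → [ P? ] ≈ [ Q? ]
  []-cong (yes p) Q? to from = sym ([ Q? ]-true (to p))
  []-cong (no ¬p) Q? to from = sym ([ Q? ]-false (λ q → ¬p (from q)))

  []-* : ∀ {P Q} (P? : Dec P) (Q? : Dec Q) → [ P? ] * [ Q? ] ≈ [ P? ×-dec Q? ]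
  []-* (yes _) (yes _) = *-identityˡ 1#
  []-* (yes _) (no _)  = *-identityˡ 0#
  []-* (no _)  Q?      = zeroˡ [ Q? ]

  []-when : ∀ {P} (P? : Dec P) {x y} → (P → x ≈ y) → [ P? ] * x ≈ [ P? ] * y
  []-when (yes p) x≈y = *-congˡ (x≈y p)
  []-when (no _)  x≈y = trans (zeroˡ _) (sym (zeroˡ _))

  ∑-filter : ∀ {P : A → Set} (P? : ∀ x → Dec (P x)) xs f → ∑ (filter P? xs) f ≈ ∑ xs (λ x → [ P? x ] * f x)
  ∑-filter P? []       f = refl
  ∑-filter P? (x ∷ xs) f with P? x
  ... | yes _ = +-cong (sym (*-identityˡ (f x))) (∑-filter P? xs f)
  ... | no _  = trans (∑-filter P? xs f) (trans (sym (+-identityˡ _)) (+-congʳ (sym (zeroˡ (f x)))))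

  ∑-tabulate : ∀ {n} (h : Fin n → A) f → ∑ (tabulate h) f ≈ ∑ (allFin n) (λ i → f (h i))
  ∑-tabulate {n = zero}  h f = refl
  ∑-tabulate {n = suc n} h f = +-congˡ (trans (∑-tabulate {n = n} (λ i → h (suc i)) f)
    (sym (∑-tabulate {n = n} suc (λ i → f (h i)))))

  ∑-allFin-suc : ∀ {n} (f : Fin (suc n) → Carrier) → ∑ (allFin (suc n)) f ≈ f zero + ∑ (allFin n) (λ i → f (suc i))
  ∑-allFin-suc {n} f = +-congˡ (∑-tabulate {n = n} suc f)

  ∑-δ : ∀ {n} (i : Fin n) f → ∑ (allFin n) (λ j → [ i Fin.≟ j ] * f j) ≈ f i
  ∑-δ {suc n} zero f = begin-equality
    ∑ (allFin (suc n)) (λ j → [ zero Fin.≟ j ] * f j)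
      ≈⟨ ∑-allFin-suc {n} (λ j → [ zero Fin.≟ j ] * f j) ⟩
    1# * f zero + ∑ (allFin n) (λ j → 0# * f (suc j))
      ≈⟨ +-cong (*-identityˡ _) (∑-0 (allFin n) (λ j → zeroˡ (f (suc j)))) ⟩
    f zero + 0#
      ≈⟨ +-identityʳ _ ⟩
    f zero ∎
  ∑-δ {suc n} (suc i) f = begin-equality
    ∑ (allFin (suc n)) (λ j → [ suc i Fin.≟ j ] * f j)
      ≈⟨ ∑-allFin-suc {n} (λ j → [ suc i Fin.≟ j ] * f j) ⟩
    0# * f zero + ∑ (allFin n) (λ j → [ suc i Fin.≟ suc j ] * f (suc j))
      ≈⟨ +-cong (zeroˡ _) (∑-cong (allFin n) (λ j →
           *-congʳ ([]-cong (suc i Fin.≟ suc j) (i Fin.≟ j) Fin.suc-injective (≡.cong suc)))) ⟩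
    0# + ∑ (allFin n) (λ j → [ i Fin.≟ j ] * f (suc j))
      ≈⟨ +-identityˡ _ ⟩
    ∑ (allFin n) (λ j → [ i Fin.≟ j ] * f (suc j))
      ≈⟨ ∑-δ i (λ j → f (suc j)) ⟩
    f (suc i) ∎

-- Finite subsets and the adjunction of an element

module SubsetProperties where

  infixl 6 _⊕_
  _⊕_ : ∀ {n} → Subset n → Fin n → Subset n
  S ⊕ x = S ∪ ⁅ x ⁆

  private variable
    n : ℕ
    S T : Subset n
    x y : Fin n

  ⊕-comm : ∀ (S : Subset n) x y → S ⊕ x ⊕ y ≡ S ⊕ y ⊕ x
  ⊕-comm S x y = ≡.trans (∪-assoc S ⁅ x ⁆ ⁅ y ⁆) (≡.trans (≡.cong (S ∪_) (∪-comm ⁅ x ⁆ ⁅ y ⁆)) (≡.sym (∪-assoc S ⁅ y ⁆ ⁅ x ⁆)))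

  ⊆⊕ : ∀ (S : Subset n) x → S ⊆ S ⊕ x
  ⊆⊕ S x y∈S = x∈p∪q⁺ (inj₁ y∈S)

  ∈⊕ : ∀ (S : Subset n) x → x ∈ₛ S ⊕ x
  ∈⊕ S x = x∈p∪q⁺ (inj₂ (x∈⁅x⁆ x))

  ∈⊕⁻ : ∀ (S : Subset n) {x y} → y ∈ₛ S ⊕ x → y ∈ₛ S ⊎ y ≡ x
  ∈⊕⁻ S {x} y∈S⊕x with x∈p∪q⁻ S ⁅ x ⁆ y∈S⊕x
  ... | inj₁ y∈S   = inj₁ y∈S
  ... | inj₂ y∈⁅x⁆ = inj₂ (x∈⁅y⁆⇒x≡y x y∈⁅x⁆)

  ⊕⊆ : S ⊆ T → x ∈ₛ T → S ⊕ x ⊆ T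
  ⊕⊆ {S = S} S⊆T x∈T y∈S⊕x with ∈⊕⁻ S y∈S⊕x
  ... | inj₁ y∈S    = S⊆T y∈S
  ... | inj₂ ≡.refl = x∈T

  ∣⊕∣ : ∀ (S : Subset n) x → x ∉ₛ S → ∣ S ⊕ x ∣ ≡ suc ∣ S ∣
  ∣⊕∣ (outside ∷ᵥ S) zero    x∉S = ≡.cong (λ S → suc ∣ S ∣) (∪-identityʳ S)
  ∣⊕∣ (inside  ∷ᵥ S) zero    x∉S = ⊥-elim (x∉S Vec.here)
  ∣⊕∣ (outside ∷ᵥ S) (suc x) x∉S = ∣⊕∣ S x (λ x∈S → x∉S (Vec.there x∈S))
  ∣⊕∣ (inside  ∷ᵥ S) (suc x) x∉S = ≡.cong suc (∣⊕∣ S x (λ x∈S → x∉S (Vec.there x∈S)))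

  ∣S∣≡0⇒S≡⊥ : ∀ (S : Subset n) → ∣ S ∣ ≡ 0 → S ≡ ⊥
  ∣S∣≡0⇒S≡⊥ []ᵥ            _  = ≡.refl
  ∣S∣≡0⇒S≡⊥ (outside ∷ᵥ S) eq = ≡.cong (outside ∷ᵥ_) (∣S∣≡0⇒S≡⊥ S eq)

  ⊆∧∣∣≡⇒≡ : S ⊆ T → ∣ S ∣ ≡ ∣ T ∣ → S ≡ T
  ⊆∧∣∣≡⇒≡ {S = S} {T = T} S⊆T eq = ⊆-antisym S⊆T T⊆S
    where
    T⊆S : T ⊆ S
    T⊆S {y} y∈T with y ∈? S
    ... | yes y∈S = y∈S
    ... | no  y∉S = ⊥-elim (ℕ.<-irrefl eq (p⊂q⇒∣p∣<∣q∣ (S⊆T , y , y∈T , y∉S)))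

  ∈-subsets : ∀ (S : Subset n) → S ∈ subsets n
  ∈-subsets []ᵥ            = here ≡.refl
  ∈-subsets (outside ∷ᵥ S) = ∈-++⁺ˡ (∈-map⁺ (outside ∷ᵥ_) (∈-subsets S))
  ∈-subsets {suc n} (inside ∷ᵥ S) = ∈-++⁺ʳ (map (outside ∷ᵥ_) (subsets n)) (∈-map⁺ (inside ∷ᵥ_) (∈-subsets S))

  comprehension : {P : Fin n → Set} → (∀ x → Dec (P x)) → Subset n
  comprehension P? = Vec.tabulate (λ x → does (P? x))

  ∈-comprehension⁺ : {P : Fin n → Set} (P? : ∀ x → Dec (P x)) → P x → x ∈ₛ comprehension P?
  ∈-comprehension⁺ {x = x} P? px = lookup⇒[]= x (comprehension P?) (≡.trans (lookup∘tabulate _ x) (does≡true (P? x)))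
    where
    does≡true : (d : Dec _) → does d ≡ true
    does≡true (yes _)  = ≡.refl
    does≡true (no ¬px) = ⊥-elim (¬px px)

  ∈-comprehension⁻ : {P : Fin n → Set} (P? : ∀ x → Dec (P x)) → x ∈ₛ comprehension P? → P x
  ∈-comprehension⁻ {x = x} P? x∈ = holds (P? x) (≡.trans (≡.sym (lookup∘tabulate _ x)) ([]=⇒lookup x∈))
    where
    holds : {P : Set} (d : Dec P) → does d ≡ true → P
    holds (yes p) _ = p

  _≟ₛ_ : (S T : Subset n) → Dec (S ≡ T)
  _≟ₛ_ = ≡-dec Bool._≟_

  2≤length : ∀ {A : Set} {a b : A} {xs} → a ∈ xs → b ∈ xs → a ≢ b → 2 ℕ.≤ length xs
  2≤length (here ≡.refl) (here ≡.refl) a≢b = ⊥-elim (a≢b ≡.refl)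
  2≤length {xs = _ ∷ _ ∷ _} (there _) _ a≢b = ℕ.s≤s (ℕ.s≤s ℕ.z≤n)
  2≤length {xs = _ ∷ _ ∷ _} (here _) (there _) a≢b = ℕ.s≤s (ℕ.s≤s ℕ.z≤n)

-- Vectors and the solvability of linear systems

module QuadraticForms (ℝ : CompleteOrderedField) where

  open CompleteOrderedField ℝ hiding (zero)
  open OrderedField ℝ
  open ≈-Reasoning

  Vector : ℕ → Set
  Vector n = Fin n → Carrier

  infixl 7 _∙_
  _∙_ : ∀ {n} → Vector n → Vector n → Carrier
  _∙_ {n} u v = ∑ (allFin n) (λ i → u i * v i)

  combine : ∀ {n} → Carrier → Vector n → Carrier → Vector n → Vector n
  combine a u b v i = a * u i + b * v i

  ∙-combine : ∀ {n} (w : Vector n) a u b v → w ∙ combine a u b v ≈ a * (w ∙ u) + b * (w ∙ v)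
  ∙-combine {n} w a u b v = begin-equality
    w ∙ combine a u b v
      ≈⟨ ∑-cong (allFin n) (λ i → solve 5 (λ w a u b v → w :* (a :* u :+ b :* v) := a :* (w :* u) :+ b :* (w :* v))
           refl (w i) a (u i) b (v i)) ⟩
    ∑ (allFin n) (λ i → a * (w i * u i) + b * (w i * v i))
      ≈⟨ ∑-linear (allFin n) a b (λ i → w i * u i) (λ i → w i * v i) ⟩
    a * (w ∙ u) + b * (w ∙ v) ∎

  ∙-comm : ∀ {n} (u v : Vector n) → u ∙ v ≈ v ∙ u
  ∙-comm {n} u v = ∑-cong (allFin n) (λ i → *-comm (u i) (v i))

  combine-∙ : ∀ {n} (w : Vector n) a u b v → combine a u b v ∙ w ≈ a * (u ∙ w) + b * (v ∙ w)
  combine-∙ w a u b v = trans (∙-comm (combine a u b v) w) (trans (∙-combine w a u b v)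
    (+-cong (*-congˡ (∙-comm w u)) (*-congˡ (∙-comm w v))))

  ∙-congˡ : ∀ {n} (w : Vector n) {u v : Vector n} → (∀ i → u i ≈ v i) → w ∙ u ≈ w ∙ v
  ∙-congˡ {n} w u≈v = ∑-cong (allFin n) (λ i → *-congˡ (u≈v i))

  -- Induction on the number of columns; in the last case the first column is
  -- eliminated by means of a functional z₀ that annihilates all the others.
  fredholm : ∀ m n (A : Fin m → Vector n) (r : Vector m) →
    (∃ λ φ → ∀ i → A i ∙ φ ≈ r i) ⊎
    (∃ λ z → (∀ j → z ∙ (λ i → A i j) ≈ 0#) × ¬ (z ∙ r ≈ 0#))
  fredholm m zero A r with Fin.any? (λ i → ¬? (IsStrictTotalOrder._≟_ isStrictTotalOrder (r i) 0#))
  ... | yes (i , rᵢ≉0) = inj₂ ((λ j → [ i Fin.≟ j ]) , (λ ()) , λ eq → rᵢ≉0 (trans (sym (∑-δ i r)) eq))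
  ... | no  all≈0      = inj₁ ((λ ()) , λ i → sym (decidable-stable (IsStrictTotalOrder._≟_ isStrictTotalOrder (r i) 0#)
                           (λ rᵢ≉0 → all≈0 (i , rᵢ≉0))))
  fredholm m (suc n) A r = case₁ (fredholm m n A⁻ c)
    where
    c = λ i → A i zero
    A⁻ = λ i j → A i (suc j)
    Goal = (∃ λ φ → ∀ i → A i ∙ φ ≈ r i) ⊎ (∃ λ z → (∀ j → z ∙ (λ i → A i j) ≈ 0#) × ¬ (z ∙ r ≈ 0#))

    case₁ : _ → Goal
    case₁ (inj₁ (ψ , ψ-sol)) with fredholm m n A⁻ r
    ... | inj₁ (φ , φ-sol) = inj₁ (0# ◂ φ , λ i → begin-equality
          A i ∙ (0# ◂ φ)              ≈⟨ ∑-allFin-suc (λ j → A i j * (0# ◂ φ) j) ⟩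
          A i zero * 0# + A⁻ i ∙ φ    ≈⟨ trans (+-congʳ (zeroʳ _)) (+-identityˡ _) ⟩
          A⁻ i ∙ φ                    ≈⟨ φ-sol i ⟩
          r i                         ∎)
    ... | inj₂ (z , z⊥ , z∙r≉0) = inj₂ (z , (λ { zero → z⊥c ; (suc j) → z⊥ j }) , z∙r≉0)
      where
      z⊥c : z ∙ c ≈ 0#
      z⊥c = begin-equality
        z ∙ c                                       ≈⟨ ∙-congˡ z (λ i → sym (ψ-sol i)) ⟩
        ∑ (allFin m) (λ i → z i * (A⁻ i ∙ ψ))
          ≈⟨ ∑-cong (allFin m) (λ i → sym (∑-*ˡ (allFin n) (z i) (λ j → A⁻ i j * ψ j))) ⟩
        ∑ (allFin m) (λ i → ∑ (allFin n) (λ j → z i * (A⁻ i j * ψ j)))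
          ≈⟨ ∑-swap (allFin m) (allFin n) (λ i j → z i * (A⁻ i j * ψ j)) ⟩
        ∑ (allFin n) (λ j → ∑ (allFin m) (λ i → z i * (A⁻ i j * ψ j)))
          ≈⟨ ∑-cong (allFin n) (λ j → ∑-cong (allFin m) (λ i → sym (*-assoc (z i) (A⁻ i j) (ψ j)))) ⟩
        ∑ (allFin n) (λ j → ∑ (allFin m) (λ i → z i * A⁻ i j * ψ j))
          ≈⟨ ∑-cong (allFin n) (λ j → ∑-*ʳ (allFin m) (ψ j) (λ i → z i * A⁻ i j)) ⟩
        ∑ (allFin n) (λ j → (z ∙ (λ i → A⁻ i j)) * ψ j)
          ≈⟨ ∑-0 (allFin n) (λ j → trans (*-congʳ (z⊥ j)) (zeroˡ (ψ j))) ⟩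
        0# ∎
    case₁ (inj₂ (z₀ , z₀⊥ , z₀∙c≉0)) = case₂ (fredholm m n A⁻ r′)
      where
      i₀ = (z₀ ∙ c) ⁻¹
      i₀-inv : (z₀ ∙ c) * i₀ ≈ 1#
      i₀-inv = *-inverseʳ (z₀ ∙ c) z₀∙c≉0
      -- The coefficient of the first column in any solution: pairing with `z₀` kills all the other
      -- columns.
      t = (z₀ ∙ r) * i₀
      r′ = combine 1# r (- t) c
      case₂ : _ → Goal
      case₂ (inj₁ (φ , φ-sol)) = inj₁ (t ◂ φ , λ i → begin-equality
        A i ∙ (t ◂ φ)                       ≈⟨ ∑-allFin-suc (λ j → A i j * (t ◂ φ) j) ⟩
        c i * t + A⁻ i ∙ φ                  ≈⟨ +-congˡ (φ-sol i) ⟩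
        c i * t + (1# * r i + (- t) * c i)  ≈⟨ solve 3 (λ c t r → c :* t :+ (con (1 , 0) :* r :+ (:- t) :* c) := r) refl (c i) t (r i) ⟩
        r i                                 ∎)
      case₂ (inj₂ (z , z⊥ , z∙r′≉0)) = inj₂ (z′ , (λ { zero → z′⊥c ; (suc j) → z′⊥ j }) , λ eq → z∙r′≉0 (trans z∙r′≈ eq))
        where
        -- Chosen so that `z - s z₀` annihilates the first column `c`; on the other columns both `z`
        -- and `z₀` vanish already.
        s = (z ∙ c) * i₀
        z′ = combine 1# z (- s) z₀
        z′⊥c : z′ ∙ c ≈ 0#
        z′⊥c = begin-equality
          z′ ∙ c                                        ≈⟨ combine-∙ c 1# z (- s) z₀ ⟩
          1# * (z ∙ c) + (- ((z ∙ c) * i₀)) * (z₀ ∙ c)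
            ≈⟨ solve 3 (λ a i b → con (1 , 0) :* a :+ (:- (a :* i)) :* b := a :* (con (1 , 0) :- b :* i)) refl (z ∙ c) i₀ (z₀ ∙ c) ⟩
          (z ∙ c) * (1# - (z₀ ∙ c) * i₀)                ≈⟨ *-congˡ (trans (+-congˡ (-‿cong i₀-inv)) (-‿inverseʳ 1#)) ⟩
          (z ∙ c) * 0#                                  ≈⟨ zeroʳ _ ⟩
          0#                                            ∎
        z′⊥ : ∀ j → z′ ∙ (λ i → A⁻ i j) ≈ 0#
        z′⊥ j = begin-equality
          z′ ∙ (λ i → A⁻ i j)                           ≈⟨ combine-∙ (λ i → A⁻ i j) 1# z (- s) z₀ ⟩
          1# * (z ∙ (λ i → A⁻ i j)) + (- s) * (z₀ ∙ (λ i → A⁻ i j))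
            ≈⟨ +-cong (*-congˡ (z⊥ j)) (*-congˡ (z₀⊥ j)) ⟩
          1# * 0# + (- s) * 0#
            ≈⟨ solve 1 (λ s → con (1 , 0) :* con (0 , 0) :+ (:- s) :* con (0 , 0) := con (0 , 0)) refl s ⟩
          0#                                            ∎
        z∙r′≈ : z ∙ r′ ≈ z′ ∙ r
        z∙r′≈ = begin-equality
          z ∙ r′                                        ≈⟨ ∙-combine z 1# r (- t) c ⟩
          1# * (z ∙ r) + (- ((z₀ ∙ r) * i₀)) * (z ∙ c)
            ≈⟨ solve 4 (λ a b i d → con (1 , 0) :* a :+ (:- (b :* i)) :* d := con (1 , 0) :* a :+ (:- (d :* i)) :* b)
                 refl (z ∙ r) (z₀ ∙ r) i₀ (z ∙ c) ⟩
          1# * (z ∙ r) + (- s) * (z₀ ∙ r)               ≈⟨ combine-∙ r 1# z (- s) z₀ ⟨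
          z′ ∙ r                                        ∎

  ∙-- : ∀ {N} (u v w : Vector N) → u ∙ (λ i → v i - w i) ≈ u ∙ v - u ∙ w
  ∙-- {N} u v w = begin-equality
    u ∙ (λ i → v i - w i)
      ≈⟨ ∑-cong (allFin N) (λ i → solve 3 (λ u v w → u :* (v :- w) := con (1 , 0) :* (u :* v) :+ (:- con (1 , 0)) :* (u :* w)) refl (u i) (v i) (w i)) ⟩
    ∑ (allFin N) (λ i → 1# * (u i * v i) + (- 1#) * (u i * w i))
      ≈⟨ ∑-linear (allFin N) 1# (- 1#) (λ i → u i * v i) (λ i → u i * w i) ⟩
    1# * (u ∙ v) + (- 1#) * (u ∙ w)
      ≈⟨ solve 2 (λ a b → con (1 , 0) :* a :+ (:- con (1 , 0)) :* b := a :- b) refl (u ∙ v) (u ∙ w) ⟩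
    u ∙ v - u ∙ w ∎

  -- Bilinear forms

  Matrix : ℕ → Set
  Matrix n = Fin n → Vector n

  Symmetric : ∀ {n} → Matrix n → Set
  Symmetric M = ∀ i j → M i j ≈ M j i

  form : ∀ {n} → Matrix n → Vector n → Vector n → Carrier
  form M u v = u ∙ (λ i → M i ∙ v)

  form-combineˡ : ∀ {n} (M : Matrix n) a u b v w → form M (combine a u b v) w ≈ a * form M u w + b * form M v w
  form-combineˡ M a u b v w = combine-∙ (λ i → M i ∙ w) a u b v

  form-combineʳ : ∀ {n} (M : Matrix n) a u b v w → form M w (combine a u b v) ≈ a * form M w u + b * form M w v
  form-combineʳ M a u b v w = trans (∙-congˡ w (λ i → ∙-combine (M i) a u b v))
    (∙-combine w a (λ i → M i ∙ u) b (λ i → M i ∙ v))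

  form-sym : ∀ {n} {M : Matrix n} → Symmetric M → ∀ u v → form M u v ≈ form M v u
  form-sym {n} {M} M-sym u v = begin-equality
    ∑ (allFin n) (λ i → u i * ∑ (allFin n) (λ j → M i j * v j))
      ≈⟨ ∑-cong (allFin n) (λ i → sym (∑-*ˡ (allFin n) (u i) (λ j → M i j * v j))) ⟩
    ∑ (allFin n) (λ i → ∑ (allFin n) (λ j → u i * (M i j * v j)))
      ≈⟨ ∑-swap (allFin n) (allFin n) (λ i j → u i * (M i j * v j)) ⟩
    ∑ (allFin n) (λ j → ∑ (allFin n) (λ i → u i * (M i j * v j)))
      ≈⟨ ∑-cong (allFin n) (λ j → ∑-cong (allFin n) (λ i →
           trans (*-congˡ (*-congʳ (M-sym i j)))
                 (solve 3 (λ u m v → u :* (m :* v) := v :* (m :* u)) refl (u i) (M j i) (v j)))) ⟩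
    ∑ (allFin n) (λ j → ∑ (allFin n) (λ i → v j * (M j i * u i)))
      ≈⟨ ∑-cong (allFin n) (λ j → ∑-*ˡ (allFin n) (v j) (λ i → M j i * u i)) ⟩
    ∑ (allFin n) (λ j → v j * ∑ (allFin n) (λ i → M j i * u i)) ∎

  form-square : ∀ {n} {M : Matrix n} → Symmetric M → ∀ a u b v →
    form M (combine a u b v) (combine a u b v) ≈ a * a * form M u u + (a * b + a * b) * form M u v + b * b * form M v v
  form-square {M = M} M-sym a u b v = begin-equality
    form M (combine a u b v) (combine a u b v)
      ≈⟨ form-combineˡ M a u b v (combine a u b v) ⟩
    a * form M u (combine a u b v) + b * form M v (combine a u b v)
      ≈⟨ +-cong (*-congˡ (form-combineʳ M a u b v u)) (*-congˡ (form-combineʳ M a u b v v)) ⟩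
    a * (a * form M u u + b * form M u v) + b * (a * form M v u + b * form M v v)
      ≈⟨ +-congˡ (*-congˡ (+-congʳ (*-congˡ (form-sym M-sym v u)))) ⟩
    a * (a * form M u u + b * form M u v) + b * (a * form M u v + b * form M v v)
      ≈⟨ solve 5 (λ a b x y z → a :* (a :* x :+ b :* y) :+ b :* (a :* y :+ b :* z)
                              := a :* a :* x :+ (a :* b :+ a :* b) :* y :+ b :* b :* z)
           refl a b (form M u u) (form M u v) (form M v v) ⟩
    a * a * form M u u + (a * b + a * b) * form M u v + b * b * form M v v ∎

  form-cong : ∀ {n} {M N : Matrix n} → (∀ i j → M i j ≈ N i j) → ∀ u v → form M u v ≈ form N u v
  form-cong {n} M≈N u v = ∙-congˡ u (λ i → ∑-cong (allFin n) (λ j → *-congʳ (M≈N i j)))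

  form-scale : ∀ {n} (c : Carrier) (M : Matrix n) u v → form (λ i j → c * M i j) u v ≈ c * form M u v
  form-scale {n} c M u v = begin-equality
    u ∙ (λ i → ∑ (allFin n) (λ j → c * M i j * v j))
      ≈⟨ ∙-congˡ u (λ i → trans (∑-cong (allFin n) (λ j → *-assoc c (M i j) (v j))) (∑-*ˡ (allFin n) c (λ j → M i j * v j))) ⟩
    ∑ (allFin n) (λ i → u i * (c * (M i ∙ v)))
      ≈⟨ ∑-cong (allFin n) (λ i → solve 3 (λ u c m → u :* (c :* m) := c :* (u :* m)) refl (u i) c (M i ∙ v)) ⟩
    ∑ (allFin n) (λ i → c * (u i * (M i ∙ v)))
      ≈⟨ ∑-*ˡ (allFin n) c (λ i → u i * (M i ∙ v)) ⟩
    c * form M u v ∎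

  ∙-∑ : ∀ {A : Set} {n} (xs : List A) (c : A → Carrier) (u : Vector n) (v : A → Vector n) →
    u ∙ (λ i → ∑ xs (λ x → c x * v x i)) ≈ ∑ xs (λ x → c x * (u ∙ v x))
  ∙-∑ {n = n} xs c u v = begin-equality
    ∑ (allFin n) (λ i → u i * ∑ xs (λ x → c x * v x i))
      ≈⟨ ∑-cong (allFin n) (λ i → sym (∑-*ˡ xs (u i) (λ x → c x * v x i))) ⟩
    ∑ (allFin n) (λ i → ∑ xs (λ x → u i * (c x * v x i)))
      ≈⟨ ∑-swap (allFin n) xs (λ i x → u i * (c x * v x i)) ⟩
    ∑ xs (λ x → ∑ (allFin n) (λ i → u i * (c x * v x i)))
      ≈⟨ ∑-cong xs (λ x → trans
           (∑-cong (allFin n) (λ i → solve 3 (λ u c v → u :* (c :* v) := c :* (u :* v)) refl (u i) (c x) (v x i)))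
           (∑-*ˡ (allFin n) (c x) (λ i → u i * v x i))) ⟩
    ∑ xs (λ x → c x * (u ∙ v x)) ∎

  ∑-∙ : ∀ {A : Set} {n} (xs : List A) (c : A → Carrier) (u : A → Vector n) (v : Vector n) →
    (λ i → ∑ xs (λ x → c x * u x i)) ∙ v ≈ ∑ xs (λ x → c x * (u x ∙ v))
  ∑-∙ xs c u v = trans (∙-comm (λ i → ∑ xs (λ x → c x * u x i)) v)
    (trans (∙-∑ xs c v u) (∑-cong xs (λ x → *-congˡ (∙-comm v (u x)))))

  form-∑ : ∀ {A : Set} {n} (xs : List A) (c : A → Carrier) (M : A → Matrix n) u v →
    form (λ i j → ∑ xs (λ x → c x * M x i j)) u v ≈ ∑ xs (λ x → c x * form (M x) u v)
  form-∑ xs c M u v = trans (∙-congˡ u (λ i → ∑-∙ xs c (λ x → M x i) v))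
    (∙-∑ xs c u (λ x i → M x i ∙ v))

  ◂-∙ : ∀ {n} a (u : Vector n) (v : Vector (suc n)) → (a ◂ u) ∙ v ≈ a * v zero + u ∙ (λ i → v (suc i))
  ◂-∙ a u v = ∑-allFin-suc (λ i → (a ◂ u) i * v i)

  0◂-∙ : ∀ {n} (u : Vector n) (v : Vector (suc n)) → (0# ◂ u) ∙ v ≈ u ∙ (λ i → v (suc i))
  0◂-∙ u v = trans (◂-∙ 0# u v) (trans (+-congʳ (zeroˡ (v zero))) (+-identityˡ _))

  ∙-0◂ : ∀ {n} (u : Vector (suc n)) (v : Vector n) → u ∙ (0# ◂ v) ≈ (λ i → u (suc i)) ∙ v
  ∙-0◂ u v = trans (∙-comm u (0# ◂ v)) (trans (0◂-∙ v u) (∙-comm v (λ i → u (suc i))))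

  -- Forms with one positive direction

  Hyperbolic : ∀ {n} → Matrix n → Vector n → Set
  Hyperbolic M w = ∀ u → form M u w ≈ 0# → form M u u ≤ 0#

  -- For `u` orthogonal to `w`, the combination `(l ∙ w) u - (l ∙ u) w` lies on the hyperplane. Its
  -- square has no cross term, so the value at `u`, times a positive square, is at most the value at
  -- this vector.
  hyperbolic-from-hyperplane : ∀ {n} {M : Matrix n} → Symmetric M → ∀ l w → ¬ (l ∙ w ≈ 0#) → 0# ≤ form M w w →
    (∀ v → l ∙ v ≈ 0# → form M v v ≤ 0#) → Hyperbolic M w
  hyperbolic-from-hyperplane {M = M} M-sym l w lw≉0 0≤ww neg u uw≈0 = *-cancelˡ-≤0 (square-pos lw≉0) (begin
    a * a * form M u u                      ≤⟨ ≤-by (*-nonneg (square-nonneg b) 0≤ww) refl ⟩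
    a * a * form M u u + b * b * form M w w ≈⟨ square≈ ⟨
    form M v v                              ≤⟨ neg v lv≈0 ⟩
    0#                                      ∎)
    where
    a = l ∙ w
    b = - (l ∙ u)
    v = combine a u b w
    lv≈0 : l ∙ v ≈ 0#
    lv≈0 = trans (∙-combine l a u b w)
      (solve 2 (λ x y → x :* y :+ (:- y) :* x := con (0 , 0)) refl (l ∙ w) (l ∙ u))
    square≈ : form M v v ≈ a * a * form M u u + b * b * form M w w
    square≈ = begin-equality
      form M v v ≈⟨ form-square M-sym a u b w ⟩
      a * a * form M u u + (a * b + a * b) * form M u w + b * b * form M w w
        ≈⟨ +-congʳ (+-congˡ (trans (*-congˡ uw≈0) (zeroʳ _))) ⟩
      a * a * form M u u + 0# + b * b * form M w w ≈⟨ +-congʳ (+-identityʳ _) ⟩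
      a * a * form M u u + b * b * form M w w ∎

  form-indicator : ∀ {n} {Q : Set} (Q? : Dec Q) (N : Matrix n) → Q → ∀ u v →
    form (λ i j → [ Q? ] * N i j) u v ≈ form N u v
  form-indicator Q? N q u v = trans (form-scale [ Q? ] N u v) (trans (*-congʳ ([ Q? ]-true q)) (*-identityˡ _))

  -- Off `Q` the form is zero, so hyperbolicity of `N` is asked only where `Q` holds.
  hyperbolic-indicator : ∀ {n} {Q : Set} (Q? : Dec Q) (N : Matrix n) w → (Q → Hyperbolic N w) →
    Hyperbolic (λ i j → [ Q? ] * N i j) w
  hyperbolic-indicator (yes q) N w hyp u uw≈0 = ≤-trans (≤-reflexive (form-indicator (yes q) N q u u))
    (hyp q u (trans (sym (form-indicator (yes q) N q u w)) uw≈0))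
  hyperbolic-indicator (no _)  N w hyp u uw≈0 = ≤-reflexive (trans (form-scale 0# N u u) (zeroˡ _))

  -- A null vector of a negative semidefinite form lies in its kernel.
  hyperbolic-kernel : ∀ {n} {M : Matrix n} {w} → Symmetric M → Hyperbolic M w → 0# < form M w w →
    ∀ z → form M z w ≈ 0# → form M z z ≈ 0# → ∀ v → form M z v ≈ 0#
  hyperbolic-kernel {M = M} {w} M-sym hyp 0<ww z zw≈0 zz≈0 v = x*y≈0⇒y≈0 (form M z v) (pos⇒≉0 0<ww) (trans (sym zv′≈) h≈0)
    where
    -- The component of `v` orthogonal to `w`, multiplied by `form M w w` to avoid a division.
    v′ = combine (form M w w) v (- form M v w) w
    h = form M z v′
    c = form M v′ v′
    -- With the coefficient `1 - c` the value at `y` is `(2 - c) h²`. Since `c ≤ 0` the factor is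
    -- positive, while `y` is orthogonal to `w`; so `h` vanishes.
    y = combine h v′ (1# - c) z

    zv′≈ : h ≈ form M w w * form M z v
    zv′≈ = begin-equality
      h                                                        ≈⟨ form-combineʳ M (form M w w) v (- form M v w) w z ⟩
      form M w w * form M z v + (- form M v w) * form M z w    ≈⟨ +-congˡ (trans (*-congˡ zw≈0) (zeroʳ _)) ⟩
      form M w w * form M z v + 0#                             ≈⟨ +-identityʳ _ ⟩
      form M w w * form M z v                                  ∎

    v′w≈0 : form M v′ w ≈ 0#
    v′w≈0 = trans (form-combineˡ M (form M w w) v (- form M v w) w w)
      (solve 2 (λ x y → x :* y :+ (:- y) :* x := con (0 , 0)) refl (form M w w) (form M v w))

    yw≈0 : form M y w ≈ 0#
    yw≈0 = begin-equality
      form M y w                                ≈⟨ form-combineˡ M h v′ (1# - c) z w ⟩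
      h * form M v′ w + (1# - c) * form M z w   ≈⟨ +-cong (*-congˡ v′w≈0) (*-congˡ zw≈0) ⟩
      h * 0# + (1# - c) * 0#                    ≈⟨ +-cong (zeroʳ h) (zeroʳ (1# - c)) ⟩
      0# + 0#                                   ≈⟨ +-identityˡ 0# ⟩
      0#                                        ∎

    yy≈ : form M y y ≈ (1# + 1# - c) * (h * h)
    yy≈ = begin-equality
      form M y y
        ≈⟨ form-square M-sym h v′ (1# - c) z ⟩
      h * h * c + (h * (1# - c) + h * (1# - c)) * form M v′ z + (1# - c) * (1# - c) * form M z z
        ≈⟨ +-cong (+-congˡ (*-congˡ (form-sym M-sym v′ z))) (*-congˡ zz≈0) ⟩
      h * h * c + (h * (1# - c) + h * (1# - c)) * h + (1# - c) * (1# - c) * 0#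
        ≈⟨ solve 2 (λ h c → let one = con (1 , 0) in
             h :* h :* c :+ (h :* (one :- c) :+ h :* (one :- c)) :* h :+ (one :- c) :* (one :- c) :* con (0 , 0)
             := (one :+ one :- c) :* (h :* h)) refl h c ⟩
      (1# + 1# - c) * (h * h) ∎

    2-c-pos : 0# < 1# + 1# - c
    2-c-pos = +-pos-nonneg (+-pos-nonneg 0<1 0≤1) (x≤0⇒0≤-x (hyp v′ v′w≈0))

    h≈0 : h ≈ 0#
    h≈0 = square≈0⇒≈0 (≤-antisym
      (*-cancelˡ-≤0 2-c-pos (≤-trans (≤-reflexive (sym yy≈)) (hyp y yw≈0)))
      (square-nonneg h))

  δ-form : ∀ {n} (M : Matrix n) i v → form M (λ j → [ i Fin.≟ j ]) v ≈ M i ∙ v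
  δ-form M i v = ∑-δ i (λ j → M j ∙ v)

  -- A form as the weighted sum of its derivatives

  module Derivatives {n} {ω : Vector n} (0<ω : ∀ x → 0# < ω x)
    {M : Matrix (suc n)} {K : Fin n → Matrix (suc n)}
    (M-sym : Symmetric M) (K-sym : ∀ x → Symmetric (K x))
    (M≈∑K : ∀ i j → M i j ≈ ω ∙ (λ x → K x i j))
    (row≈ : ∀ x j → M (suc x) j ≈ ω ∙ (λ y → K x (suc y) j))
    (K-hyp : ∀ x → Hyperbolic (K x) (0# ◂ ω)) where

    0≤ω : ∀ x → 0# ≤ ω x
    0≤ω x = <⇒≤ (0<ω x)

    ω̂ : Vector (suc n)
    ω̂ = 0# ◂ ω

    form-M : ∀ u v → form M u v ≈ ω ∙ (λ x → form (K x) u v)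
    form-M u v = trans (form-cong M≈∑K u v) (form-∑ (allFin n) ω K u v)

    form-K-ω̂ : ∀ x v → form (K x) ω̂ v ≈ M (suc x) ∙ v
    form-K-ω̂ x v = begin-equality
      form (K x) ω̂ v                           ≈⟨ 0◂-∙ ω (λ i → K x i ∙ v) ⟩
      ω ∙ (λ y → K x (suc y) ∙ v)              ≈⟨ ∑-∙ (allFin n) ω (λ y → K x (suc y)) v ⟨
      (λ j → ω ∙ (λ y → K x (suc y) j)) ∙ v    ≈⟨ ∑-cong (allFin (suc n)) (λ j → *-congʳ (row≈ x j)) ⟨
      M (suc x) ∙ v                            ∎

    -- Pairing `z` with `ω̂` under `K x` reads off entry `suc x` of `M z`, which is zero.
    -- Hyperbolicity then makes every `form (K y) z z` nonpositive, and their sum with positive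
    -- weights is `form M z z ≈ 0#`, so each of them vanishes.
    kernel-descends : ∀ z → (∀ v → form M z v ≈ 0#) → ∀ x → form (K x) z ω̂ ≈ 0# × form (K x) z z ≈ 0#
    kernel-descends z z-ker x = zω̂≈0 x , zz≈0
      where
      zω̂≈0 : ∀ x → form (K x) z ω̂ ≈ 0#
      zω̂≈0 x = begin-equality
        form (K x) z ω̂                       ≈⟨ form-sym (K-sym x) z ω̂ ⟩
        form (K x) ω̂ z                       ≈⟨ form-K-ω̂ x z ⟩
        M (suc x) ∙ z                        ≈⟨ δ-form M (suc x) z ⟨
        form M (λ j → [ suc x Fin.≟ j ]) z   ≈⟨ form-sym M-sym (λ j → [ suc x Fin.≟ j ]) z ⟩
        form M z (λ j → [ suc x Fin.≟ j ])   ≈⟨ z-ker _ ⟩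
        0#                                   ∎
      q : Fin n → Carrier
      q y = ω y * - form (K y) z z
      0≤q : ∀ y → 0# ≤ q y
      0≤q y = *-nonneg (0≤ω y) (x≤0⇒0≤-x (K-hyp y z (zω̂≈0 y)))
      ∑q≈0 : ∑ (allFin n) q ≈ 0#
      ∑q≈0 = begin-equality
        ∑ (allFin n) q
          ≈⟨ ∑-cong (allFin n) (λ y → solve 2 (λ w k → w :* (:- k) := (:- con (1 , 0)) :* (w :* k)) refl (ω y) (form (K y) z z)) ⟩
        ∑ (allFin n) (λ y → (- 1#) * (ω y * form (K y) z z))
          ≈⟨ ∑-*ˡ (allFin n) (- 1#) (λ y → ω y * form (K y) z z) ⟩
        (- 1#) * (ω ∙ (λ y → form (K y) z z))  ≈⟨ *-congˡ (form-M z z) ⟨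
        (- 1#) * form M z z                    ≈⟨ *-congˡ (z-ker z) ⟩
        (- 1#) * 0#                            ≈⟨ zeroʳ _ ⟩
        0#                                     ∎
      zz≈0 : form (K x) z z ≈ 0#
      zz≈0 = begin-equality
        form (K x) z z        ≈⟨ solve 1 (λ k → k := :- (:- k)) refl (form (K x) z z) ⟩
        - (- form (K x) z z)  ≈⟨ -‿cong (x*y≈0⇒y≈0 (- form (K x) z z) (pos⇒≉0 (0<ω x))
                                   (∑≈0⇒term≈0 q 0≤q ∑q≈0 (∈-allFin x))) ⟩
        - 0#                  ≈⟨ solve 0 (:- con (0 , 0) := con (0 , 0)) refl ⟩
        0#                    ∎

    -- The block of nonzero indices as an electrical network on the ground set. With the weight `ω`
    -- at both ends, the vector `ω φ` for a constant potential `φ` is a multiple of `ω̂`, and the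
    -- row sums are the entries of `M ω̂` weighted by `ω`.
    conductance : Matrix n
    conductance x y = ω x * (M (suc x) (suc y) * ω y)

    conductance-sym : Symmetric conductance
    conductance-sym x y = trans (*-congˡ (*-congʳ (M-sym (suc x) (suc y))))
      (solve 3 (λ a m b → a :* (m :* b) := b :* (m :* a)) refl (ω x) (M (suc y) (suc x)) (ω y))

    degree : Vector n
    degree x = ∑ (allFin n) (conductance x)

    degree≈ : ∀ x → degree x ≈ ω x * (M (suc x) ∙ ω̂)
    degree≈ x = trans (∑-*ˡ (allFin n) (ω x) (λ y → M (suc x) (suc y) * ω y))
      (*-congˡ (sym (∙-0◂ (M (suc x)) ω)))

    energy : Vector n → Carrier
    energy φ = ∑ (allFin n) (λ x → ∑ (allFin n) (λ y → conductance x y * ((φ x - φ y) * (φ x - φ y))))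

    -- Expanding the squares gives two sums of the form `degree x * (φ x * φ x)`, equal by symmetry,
    -- and twice the mixed term. The energy counts each pair in both orders, hence `D + D`.
    energy≈ : ∀ φ → let D = ∑ (allFin n) (λ x → degree x * (φ x * φ x)) - form conductance φ φ in energy φ ≈ D + D
    energy≈ φ = begin-equality
      energy φ
        ≈⟨ ∑-cong (allFin n) (λ x → ∑-cong (allFin n) (λ y →
             solve 3 (λ c a b → c :* ((a :- b) :* (a :- b))
                             := con (1 , 0) :* ((a :* a) :* c :+ (:- con (2 , 0)) :* (a :* (c :* b))) :+ con (1 , 0) :* (c :* (b :* b)))
               refl (conductance x y) (φ x) (φ y))) ⟩
      ∑ (allFin n) (λ x → ∑ (allFin n) (λ y → 1# * ((φ x * φ x) * conductance x y + (- two) * (φ x * (conductance x y * φ y))) + 1# * (conductance x y * (φ y * φ y))))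
        ≈⟨ ∑-cong (allFin n) (λ x → trans
             (∑-linear (allFin n) 1# 1# (λ y → (φ x * φ x) * conductance x y + (- two) * (φ x * (conductance x y * φ y))) (λ y → conductance x y * (φ y * φ y)))
             (+-congʳ (*-congˡ (trans
               (∑-linear (allFin n) (φ x * φ x) (- two) (conductance x) (λ y → φ x * (conductance x y * φ y)))
               (+-congˡ (*-congˡ (∑-*ˡ (allFin n) (φ x) (λ y → conductance x y * φ y)))))))) ⟩
      ∑ (allFin n) (λ x → 1# * ((φ x * φ x) * degree x + (- two) * (φ x * (conductance x ∙ φ))) + 1# * (conductance x ∙ φ²))
        ≈⟨ ∑-linear (allFin n) 1# 1# (λ x → (φ x * φ x) * degree x + (- two) * (φ x * (conductance x ∙ φ))) (λ x → conductance x ∙ φ²) ⟩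
      1# * ∑ (allFin n) (λ x → (φ x * φ x) * degree x + (- two) * (φ x * (conductance x ∙ φ))) + 1# * ∑ (allFin n) (λ x → conductance x ∙ φ²)
        ≈⟨ +-cong (*-congˡ (trans (∑-+ (allFin n) (λ x → (φ x * φ x) * degree x) (λ x → (- two) * (φ x * (conductance x ∙ φ))))
             (+-cong (∑-cong (allFin n) (λ x → *-comm (φ x * φ x) (degree x))) (∑-*ˡ (allFin n) (- two) (λ x → φ x * (conductance x ∙ φ))))))
             (*-congˡ columns) ⟩
      1# * (E + (- two) * form conductance φ φ) + 1# * E
        ≈⟨ solve 2 (λ e f → con (1 , 0) :* (e :+ (:- con (2 , 0)) :* f) :+ con (1 , 0) :* e := (e :- f) :+ (e :- f)) refl E (form conductance φ φ) ⟩
      (E - form conductance φ φ) + (E - form conductance φ φ) ∎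
      where
      two = ⟦ 2 , 0 ⟧ᵈ
      φ² : Vector n
      φ² x = φ x * φ x
      E = ∑ (allFin n) (λ x → degree x * (φ x * φ x))
      columns : ∑ (allFin n) (λ x → conductance x ∙ φ²) ≈ E
      columns = begin-equality
        ∑ (allFin n) (λ x → ∑ (allFin n) (λ y → conductance x y * φ² y))
          ≈⟨ ∑-swap (allFin n) (allFin n) (λ x y → conductance x y * φ² y) ⟩
        ∑ (allFin n) (λ y → ∑ (allFin n) (λ x → conductance x y * φ² y))
          ≈⟨ ∑-cong (allFin n) (λ y → trans (∑-*ʳ (allFin n) (φ² y) (λ x → conductance x y))
               (*-congʳ (∑-cong (allFin n) (λ x → conductance-sym x y)))) ⟩
        E ∎

    -- Passage of hyperbolicity from the derivatives to their sum

    module TrickleDown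
      (M-nonneg : ∀ x y → 0# ≤ M (suc x) (suc y))
      -- An index with a zero row belongs to no edge, so `φ` is left unconstrained there.
      (connected : ∀ (φ : Vector n) → (∀ x y → 0# < M (suc x) (suc y) → φ x ≈ φ y) →
                   ∃ λ c → ∀ x → φ x ≈ c ⊎ (∀ j → M (suc x) j ≈ 0#)) where

      conductance-nonneg : ∀ x y → 0# ≤ conductance x y
      conductance-nonneg x y = *-nonneg (0≤ω x) (*-nonneg (M-nonneg x y) (0≤ω y))

      energy-term-nonneg : ∀ (φ : Vector n) x y → 0# ≤ conductance x y * ((φ x - φ y) * (φ x - φ y))
      energy-term-nonneg φ x y = *-nonneg (conductance-nonneg x y) (square-nonneg (φ x - φ y))

      energy-nonneg : ∀ φ → 0# ≤ energy φ
      energy-nonneg φ = ∑-nonneg (allFin n) (λ x → ∑-nonneg (allFin n) (energy-term-nonneg φ x))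

      energy≈0⇒≈ : ∀ φ → energy φ ≈ 0# → ∀ x y → 0# < M (suc x) (suc y) → φ x ≈ φ y
      energy≈0⇒≈ φ e≈0 x y 0<m = begin-equality
        φ x               ≈⟨ solve 2 (λ a b → a := b :+ (a :- b)) refl (φ x) (φ y) ⟩
        φ y + (φ x - φ y) ≈⟨ +-congˡ (square≈0⇒≈0 (x*y≈0⇒y≈0 ((φ x - φ y) * (φ x - φ y)) 0≉c term≈0)) ⟩
        φ y + 0#          ≈⟨ +-identityʳ (φ y) ⟩
        φ y               ∎
        where
        0≉c : ¬ (conductance x y ≈ 0#)
        0≉c = pos⇒≉0 (*-pos (0<ω x) (*-pos 0<m (0<ω y)))
        term : Fin n → Fin n → Carrier
        term x y = conductance x y * ((φ x - φ y) * (φ x - φ y))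
        term≈0 : term x y ≈ 0#
        term≈0 = ∑≈0⇒term≈0 (term x) (energy-term-nonneg φ x)
          (∑≈0⇒term≈0 (λ x → ∑ (allFin n) (term x)) (λ x → ∑-nonneg (allFin n) (energy-term-nonneg φ x)) e≈0 (∈-allFin x))
          (∈-allFin y)

      laplacian : Matrix n
      laplacian x y = degree x * [ x Fin.≟ y ] - conductance x y

      laplacian-∙ : ∀ x φ → laplacian x ∙ φ ≈ degree x * φ x - conductance x ∙ φ
      laplacian-∙ x φ = begin-equality
        laplacian x ∙ φ
          ≈⟨ ∑-cong (allFin n) (λ y → solve 4 (λ d e c f → (d :* e :- c) :* f := d :* (e :* f) :+ (:- con (1 , 0)) :* (c :* f))
               refl (degree x) [ x Fin.≟ y ] (conductance x y) (φ y)) ⟩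
        ∑ (allFin n) (λ y → degree x * ([ x Fin.≟ y ] * φ y) + (- 1#) * (conductance x y * φ y))
          ≈⟨ ∑-linear (allFin n) (degree x) (- 1#) (λ y → [ x Fin.≟ y ] * φ y) (λ y → conductance x y * φ y) ⟩
        degree x * ∑ (allFin n) (λ y → [ x Fin.≟ y ] * φ y) + (- 1#) * (conductance x ∙ φ)
          ≈⟨ +-cong (*-congˡ (∑-δ x φ)) (solve 1 (λ c → (:- con (1 , 0)) :* c := :- c) refl (conductance x ∙ φ)) ⟩
        degree x * φ x - conductance x ∙ φ ∎

      form-laplacian : ∀ φ → form laplacian φ φ ≈ ∑ (allFin n) (λ x → degree x * (φ x * φ x)) - form conductance φ φ
      form-laplacian φ = begin-equality
        form laplacian φ φ
          ≈⟨ ∙-congˡ φ (λ x → laplacian-∙ x φ) ⟩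
        ∑ (allFin n) (λ x → φ x * (degree x * φ x - conductance x ∙ φ))
          ≈⟨ ∑-cong (allFin n) (λ x → solve 3 (λ f d c → f :* (d :* f :- c) := con (1 , 0) :* (d :* (f :* f)) :+ (:- con (1 , 0)) :* (f :* c))
               refl (φ x) (degree x) (conductance x ∙ φ)) ⟩
        ∑ (allFin n) (λ x → 1# * (degree x * (φ x * φ x)) + (- 1#) * (φ x * (conductance x ∙ φ)))
          ≈⟨ ∑-linear (allFin n) 1# (- 1#) (λ x → degree x * (φ x * φ x)) (λ x → φ x * (conductance x ∙ φ)) ⟩
        1# * E + (- 1#) * form conductance φ φ
          ≈⟨ solve 2 (λ e c → con (1 , 0) :* e :+ (:- con (1 , 0)) :* c := e :- c) refl E (form conductance φ φ) ⟩
        E - form conductance φ φ ∎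
        where E = ∑ (allFin n) (λ x → degree x * (φ x * φ x))

      -- By the Fredholm alternative an obstruction `z` would be annihilated by the Laplacian, so it
      -- would have energy zero and be constant off the isolated indices. As `ρ` vanishes at the
      -- isolated ones, `z ∙ ρ` would be a multiple of the sum of `ρ`, which is zero.
      poisson : ∀ ρ → ∑ (allFin n) ρ ≈ 0# → (∀ x → (∀ j → M (suc x) j ≈ 0#) → ρ x ≈ 0#) →
        ∃ λ φ → ∀ x → laplacian x ∙ φ ≈ ρ x
      poisson ρ ∑ρ≈0 ρ-isolated with fredholm n n laplacian ρ
      ... | inj₁ solution = solution
      ... | inj₂ (z , z⊥ , zρ≉0) = ⊥-elim (zρ≉0 zρ≈0)
        where
        form≈0 : form laplacian z z ≈ 0#
        form≈0 = begin-equality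
          form laplacian z z
            ≈⟨ ∙-congˡ z (λ x → ∙-comm (laplacian x) z) ⟩
          z ∙ (λ x → ∑ (allFin n) (λ y → z y * laplacian x y))
            ≈⟨ ∙-∑ (allFin n) z z (λ y x → laplacian x y) ⟩
          ∑ (allFin n) (λ y → z y * (z ∙ (λ x → laplacian x y)))
            ≈⟨ ∑-0 (allFin n) (λ y → trans (*-congˡ (z⊥ y)) (zeroʳ (z y))) ⟩
          0# ∎
        energy≈0 : energy z ≈ 0#
        energy≈0 = begin-equality
          energy z                                   ≈⟨ energy≈ z ⟩
          _                                          ≈⟨ +-cong (form-laplacian z) (form-laplacian z) ⟨
          form laplacian z z + form laplacian z z    ≈⟨ +-cong form≈0 form≈0 ⟩
          0# + 0#                                    ≈⟨ +-identityˡ 0# ⟩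
          0#                                         ∎
        constant : ∃ λ c → ∀ x → z x ≈ c ⊎ (∀ j → M (suc x) j ≈ 0#)
        constant = connected z (energy≈0⇒≈ z energy≈0)
        c = proj₁ constant
        term : ∀ x → z x ≈ c ⊎ (∀ j → M (suc x) j ≈ 0#) → z x * ρ x ≈ c * ρ x
        term x (inj₁ zx≈c)     = *-congʳ zx≈c
        term x (inj₂ isolated) = begin-equality
          z x * ρ x ≈⟨ *-congˡ (ρ-isolated x isolated) ⟩
          z x * 0#  ≈⟨ zeroʳ (z x) ⟩
          0#        ≈⟨ zeroʳ c ⟨
          c * 0#    ≈⟨ *-congˡ (ρ-isolated x isolated) ⟨
          c * ρ x   ∎
        zρ≈0 : z ∙ ρ ≈ 0#
        zρ≈0 = begin-equality
          z ∙ ρ                         ≈⟨ ∑-cong (allFin n) (λ x → term x (proj₂ constant x)) ⟩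
          ∑ (allFin n) (λ x → c * ρ x)  ≈⟨ ∑-*ˡ (allFin n) c ρ ⟩
          c * ∑ (allFin n) ρ            ≈⟨ *-congˡ ∑ρ≈0 ⟩
          c * 0#                        ≈⟨ zeroʳ c ⟩
          0#                            ∎

      -- Adding to u the solution φ of a Poisson equation makes row x of M u′
      -- equal to φ x times row x of M ω̂, so that u′ - φ x ω̂ is orthogonal to ω̂ for K x.
      M-hyperbolic : Hyperbolic M ω̂
      M-hyperbolic u uω̂≈0 = ≤-trans (≤-reflexive uu≈) (≤-trans (+-mono-≤ u′u′≤E ≤-refl) (≤-trans (≤-reflexive
          (solve 2 (λ e f → e :+ ((:- (e :+ (e :- f))) :+ con (0 , 0)) := con (0 , 0) :- (e :- f)) refl E F))
          (≤-by 0≤E-F (solve 1 (λ d → con (0 , 0) := con (0 , 0) :- d :+ d) refl (E - F)))))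
        where
        ρ : Vector n
        ρ x = ω x * (M (suc x) ∙ u)

        -- The solvability condition of the Poisson equation is the orthogonality of `u` to `ω̂`.
        ∑ρ≈0 : ∑ (allFin n) ρ ≈ 0#
        ∑ρ≈0 = begin-equality
          ∑ (allFin n) ρ  ≈⟨ 0◂-∙ ω (λ i → M i ∙ u) ⟨
          form M ω̂ u      ≈⟨ form-sym M-sym ω̂ u ⟩
          form M u ω̂      ≈⟨ uω̂≈0 ⟩
          0#              ∎

        solution : ∃ λ φ → ∀ x → laplacian x ∙ φ ≈ ρ x
        solution = poisson ρ ∑ρ≈0 (λ x isolated → begin-equality
          ω x * (M (suc x) ∙ u)  ≈⟨ *-congˡ (∑-0 (allFin (suc n)) (λ j → trans (*-congʳ (isolated j)) (zeroˡ (u j)))) ⟩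
          ω x * 0#               ≈⟨ zeroʳ (ω x) ⟩
          0#                     ∎)

        φ = proj₁ solution
        ψ u′ : Vector (suc n)
        ψ = 0# ◂ (λ x → ω x * φ x)
        u′ = combine 1# u 1# ψ
        h : Vector n
        h x = M (suc x) ∙ ω̂
        E = ∑ (allFin n) (λ x → degree x * (φ x * φ x))
        F = form conductance φ φ

        row-ψ : ∀ x → ω x * (M (suc x) ∙ ψ) ≈ conductance x ∙ φ
        row-ψ x = begin-equality
          ω x * (M (suc x) ∙ ψ)
            ≈⟨ *-congˡ (∙-0◂ (M (suc x)) (λ y → ω y * φ y)) ⟩
          ω x * ∑ (allFin n) (λ y → M (suc x) (suc y) * (ω y * φ y))
            ≈⟨ ∑-*ˡ (allFin n) (ω x) (λ y → M (suc x) (suc y) * (ω y * φ y)) ⟨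
          ∑ (allFin n) (λ y → ω x * (M (suc x) (suc y) * (ω y * φ y)))
            ≈⟨ ∑-cong (allFin n) (λ y → solve 4 (λ a m b f → a :* (m :* (b :* f)) := a :* (m :* b) :* f)
                 refl (ω x) (M (suc x) (suc y)) (ω y) (φ y)) ⟩
          conductance x ∙ φ ∎

        row-u′ : ∀ x → M (suc x) ∙ u′ ≈ φ x * h x
        row-u′ x = *-cancelˡ (M (suc x) ∙ u′) (φ x * h x) (pos⇒≉0 (0<ω x)) (begin-equality
          ω x * (M (suc x) ∙ u′)
            ≈⟨ *-congˡ (∙-combine (M (suc x)) 1# u 1# ψ) ⟩
          ω x * (1# * (M (suc x) ∙ u) + 1# * (M (suc x) ∙ ψ))
            ≈⟨ solve 3 (λ w a b → w :* (con (1 , 0) :* a :+ con (1 , 0) :* b) := w :* a :+ w :* b) refl (ω x) (M (suc x) ∙ u) (M (suc x) ∙ ψ) ⟩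
          ρ x + ω x * (M (suc x) ∙ ψ)
            ≈⟨ +-cong (trans (sym (proj₂ solution x)) (laplacian-∙ x φ)) (row-ψ x) ⟩
          degree x * φ x - conductance x ∙ φ + conductance x ∙ φ
            ≈⟨ solve 2 (λ a b → a :- b :+ b := a) refl (degree x * φ x) (conductance x ∙ φ) ⟩
          degree x * φ x
            ≈⟨ *-congʳ (degree≈ x) ⟩
          ω x * h x * φ x
            ≈⟨ solve 3 (λ w h f → w :* h :* f := w :* (f :* h)) refl (ω x) (h x) (φ x) ⟩
          ω x * (φ x * h x) ∎)

        form-K-u′ω̂ : ∀ x → form (K x) u′ ω̂ ≈ φ x * h x
        form-K-u′ω̂ x = trans (form-sym (K-sym x) u′ ω̂) (trans (form-K-ω̂ x u′) (row-u′ x))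

        -- Hyperbolicity of `K x` at `v = u′ - φ x ω̂`. Both the cross term and the `ω̂` term are
        -- multiples of `h x`, and together they leave `- φ x * φ x * h x`.
        K-bound : ∀ x → form (K x) u′ u′ ≤ φ x * φ x * h x
        K-bound x = ≤-by (x≤0⇒0≤-x (K-hyp x v vω̂≈0)) (begin-equality
          φ x * φ x * h x
            ≈⟨ solve 3 (λ k f h → f :* f :* h
                 := k :+ (:- (con (1 , 0) :* con (1 , 0) :* k :+ (con (1 , 0) :* (:- f) :+ con (1 , 0) :* (:- f)) :* (f :* h) :+ (:- f) :* (:- f) :* h)))
                 refl (form (K x) u′ u′) (φ x) (h x) ⟩
          form (K x) u′ u′ + - (1# * 1# * form (K x) u′ u′ + (1# * (- φ x) + 1# * (- φ x)) * (φ x * h x) + (- φ x) * (- φ x) * h x)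
            ≈⟨ +-congˡ (-‿cong (trans (form-square (K-sym x) 1# u′ (- φ x) ω̂)
                 (+-cong (+-congˡ (*-congˡ (form-K-u′ω̂ x))) (*-congˡ (form-K-ω̂ x ω̂))))) ⟨
          form (K x) u′ u′ + - form (K x) v v ∎)
          where
          v : Vector (suc n)
          v = combine 1# u′ (- φ x) ω̂
          vω̂≈0 : form (K x) v ω̂ ≈ 0#
          vω̂≈0 = begin-equality
            form (K x) v ω̂
              ≈⟨ form-combineˡ (K x) 1# u′ (- φ x) ω̂ ω̂ ⟩
            1# * form (K x) u′ ω̂ + (- φ x) * form (K x) ω̂ ω̂
              ≈⟨ +-cong (*-congˡ (form-K-u′ω̂ x)) (*-congˡ (form-K-ω̂ x ω̂)) ⟩
            1# * (φ x * h x) + (- φ x) * h x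
              ≈⟨ solve 2 (λ f h → con (1 , 0) :* (f :* h) :+ (:- f) :* h := con (0 , 0)) refl (φ x) (h x) ⟩
            0# ∎

        weighted : ∀ x → ω x * (φ x * φ x * h x) ≈ degree x * (φ x * φ x)
        weighted x = trans (solve 3 (λ w f h → w :* (f :* h) := w :* h :* f) refl (ω x) (φ x * φ x) (h x))
          (*-congʳ (sym (degree≈ x)))

        u′u′≤E : form M u′ u′ ≤ E
        u′u′≤E = begin
          form M u′ u′                                   ≈⟨ form-M u′ u′ ⟩
          ∑ (allFin n) (λ x → ω x * form (K x) u′ u′)    ≤⟨ ∑-mono (allFin n) (λ x → *-monoˡ-≤ (0≤ω x) (K-bound x)) ⟩
          ∑ (allFin n) (λ x → ω x * (φ x * φ x * h x))   ≈⟨ ∑-cong (allFin n) weighted ⟩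
          E                                              ∎

        ψu′≈E : form M ψ u′ ≈ E
        ψu′≈E = begin-equality
          form M ψ u′                                           ≈⟨ 0◂-∙ (λ x → ω x * φ x) (λ i → M i ∙ u′) ⟩
          ∑ (allFin n) (λ x → ω x * φ x * (M (suc x) ∙ u′))     ≈⟨ ∑-cong (allFin n) (λ x → trans (*-congˡ (row-u′ x))
            (trans (solve 3 (λ w f h → w :* f :* (f :* h) := w :* (f :* f :* h)) refl (ω x) (φ x) (h x)) (weighted x))) ⟩
          E                                                     ∎

        ψψ≈F : form M ψ ψ ≈ F
        ψψ≈F = begin-equality
          form M ψ ψ                                            ≈⟨ 0◂-∙ (λ x → ω x * φ x) (λ i → M i ∙ ψ) ⟩
          ∑ (allFin n) (λ x → ω x * φ x * (M (suc x) ∙ ψ))      ≈⟨ ∑-cong (allFin n) (λ x → trans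
            (solve 3 (λ w f m → w :* f :* m := f :* (w :* m)) refl (ω x) (φ x) (M (suc x) ∙ ψ)) (*-congˡ (row-ψ x))) ⟩
          F                                                     ∎

        uψ≈ : form M u ψ ≈ E - F
        uψ≈ = begin-equality
          form M u ψ
            ≈⟨ form-sym M-sym u ψ ⟩
          form M ψ u
            ≈⟨ solve 2 (λ a b → a := con (1 , 0) :* a :+ con (1 , 0) :* b :- b) refl (form M ψ u) (form M ψ ψ) ⟩
          1# * form M ψ u + 1# * form M ψ ψ - form M ψ ψ
            ≈⟨ +-cong (sym (form-combineʳ M 1# u 1# ψ ψ)) (-‿cong ψψ≈F) ⟩
          form M ψ u′ - F
            ≈⟨ +-congʳ ψu′≈E ⟩
          E - F ∎

        -- Expansion of `u = u′ - ψ`. With `form M u′ u′ ≤ E` it bounds the value at `u` by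
        -- `- (E - F)`, which is minus half the energy of `φ`.
        uu≈ : form M u u ≈ form M u′ u′ + (- (E + (E - F)) + 0#)
        uu≈ = begin-equality
          form M u u
            ≈⟨ solve 3 (λ a e f → let one = con (1 , 0) in
                 a := one :* one :* a :+ (one :* one :+ one :* one) :* (e :- f) :+ one :* one :* f :+ ((:- (e :+ (e :- f))) :+ con (0 , 0)))
                 refl (form M u u) E F ⟩
          1# * 1# * form M u u + (1# * 1# + 1# * 1#) * (E - F) + 1# * 1# * F + (- (E + (E - F)) + 0#)
            ≈⟨ +-congʳ (trans (form-square M-sym 1# u 1# ψ) (+-cong (+-congˡ (*-congˡ uψ≈)) (*-congˡ ψψ≈F))) ⟨
          form M u′ u′ + (- (E + (E - F)) + 0#) ∎

        0≤E-F : 0# ≤ E - F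
        0≤E-F = ≤-trans (x≤0⇒0≤-x (*-cancelˡ-≤0 {1# + 1#} { - (E - F)} (+-pos-nonneg 0<1 0≤1) (≤-by (energy-nonneg φ) (begin-equality
            0#
              ≈⟨ solve 1 (λ d → con (0 , 0) := (con (1 , 0) :+ con (1 , 0)) :* (:- d) :+ (d :+ d)) refl (E - F) ⟩
            (1# + 1#) * - (E - F) + ((E - F) + (E - F))
              ≈⟨ +-congˡ (energy≈ φ) ⟨
            (1# + 1#) * - (E - F) + energy φ ∎))))
          (≤-reflexive (solve 1 (λ d → :- (:- d) := d) refl (E - F)))

-- Sums over all subsets and products over one subset

module SubsetSums (ℝ : CompleteOrderedField) where

  open CompleteOrderedField ℝ hiding (zero)
  open OrderedField ℝ
  open SubsetProperties
  private variable
    n : ℕ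
  open ≈-Reasoning

  ∑-subsets-suc : ∀ (f : Subset (suc n) → Carrier) →
    ∑ (subsets (suc n)) f ≈ ∑ (subsets n) (λ S → f (outside ∷ᵥ S)) + ∑ (subsets n) (λ S → f (inside ∷ᵥ S))
  ∑-subsets-suc {n} f = trans (∑-++ (map (outside ∷ᵥ_) (subsets n)) (map (inside ∷ᵥ_) (subsets n)) f)
    (+-cong (∑-map (outside ∷ᵥ_) (subsets n) f) (∑-map (inside ∷ᵥ_) (subsets n) f))

  ∑-subsets-δ : ∀ (D : Subset n) f → ∑ (subsets n) (λ C → [ D ≟ₛ C ] * f C) ≈ f D
  ∑-subsets-δ []ᵥ f = trans (+-identityʳ _) (*-identityˡ (f []ᵥ))
  ∑-subsets-δ {suc n} (s ∷ᵥ D) f = trans (∑-subsets-suc (λ C → [ (s ∷ᵥ D) ≟ₛ C ] * f C)) (select s)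
    where
    same : ∀ s → ∑ (subsets n) (λ C → [ (s ∷ᵥ D) ≟ₛ (s ∷ᵥ C) ] * f (s ∷ᵥ C)) ≈ f (s ∷ᵥ D)
    same s = trans (∑-cong (subsets n) (λ C → *-congʳ ([]-cong ((s ∷ᵥ D) ≟ₛ (s ∷ᵥ C)) (D ≟ₛ C)
        (λ { ≡.refl → ≡.refl }) (≡.cong (s ∷ᵥ_)))))
      (∑-subsets-δ D (λ C → f (s ∷ᵥ C)))
    different : ∀ s t → s ≢ t → ∑ (subsets n) (λ C → [ (s ∷ᵥ D) ≟ₛ (t ∷ᵥ C) ] * f (t ∷ᵥ C)) ≈ 0#
    different s t s≢t = ∑-0 (subsets n) (λ C → trans (*-congʳ ([ (s ∷ᵥ D) ≟ₛ (t ∷ᵥ C) ]-false (λ { ≡.refl → s≢t ≡.refl })))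
      (zeroˡ (f (t ∷ᵥ C))))
    select : ∀ s → ∑ (subsets n) (λ C → [ (s ∷ᵥ D) ≟ₛ (outside ∷ᵥ C) ] * f (outside ∷ᵥ C))
                 + ∑ (subsets n) (λ C → [ (s ∷ᵥ D) ≟ₛ (inside ∷ᵥ C) ] * f (inside ∷ᵥ C)) ≈ f (s ∷ᵥ D)
    select false = trans (+-cong (same false) (different false true (λ ()))) (+-identityʳ _)
    select true  = trans (+-cong (different true false (λ ())) (same true)) (+-identityˡ _)

  -- S ↦ S ⊕ x is a bijection from the subsets avoiding x to those containing x.
  ∑-⊕ : ∀ (x : Fin n) (G : Subset n → Carrier) →
    ∑ (subsets n) (λ S → [ ¬? (x ∈? S) ] * G (S ⊕ x)) ≈ ∑ (subsets n) (λ T → [ x ∈? T ] * G T)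
  ∑-⊕ {suc n} zero G = begin-equality
    ∑ (subsets (suc n)) (λ S → [ ¬? (zero ∈? S) ] * G (S ⊕ zero))
      ≈⟨ ∑-subsets-suc (λ S → [ ¬? (zero ∈? S) ] * G (S ⊕ zero)) ⟩
    ∑ (subsets n) (λ S → 1# * G (inside ∷ᵥ (S ∪ ⊥))) + ∑ (subsets n) (λ S → 0# * G (inside ∷ᵥ (S ∪ ⊥)))
      ≈⟨ +-cong (∑-cong (subsets n) (λ S → *-congˡ (reflexive (≡.cong (λ S → G (inside ∷ᵥ S)) (∪-identityʳ S)))))
                (∑-0 (subsets n) (λ S → zeroˡ _)) ⟩
    ∑ (subsets n) (λ S → 1# * G (inside ∷ᵥ S)) + 0#
      ≈⟨ +-comm _ _ ⟩
    0# + ∑ (subsets n) (λ S → 1# * G (inside ∷ᵥ S))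
      ≈⟨ +-congʳ (∑-0 (subsets n) (λ S → zeroˡ (G (outside ∷ᵥ S)))) ⟨
    ∑ (subsets n) (λ S → 0# * G (outside ∷ᵥ S)) + ∑ (subsets n) (λ S → 1# * G (inside ∷ᵥ S))
      ≈⟨ ∑-subsets-suc (λ T → [ zero ∈? T ] * G T) ⟨
    ∑ (subsets (suc n)) (λ T → [ zero ∈? T ] * G T) ∎
  ∑-⊕ {suc n} (suc x) G = begin-equality
    ∑ (subsets (suc n)) (λ S → [ ¬? (suc x ∈? S) ] * G (S ⊕ suc x))
      ≈⟨ ∑-subsets-suc (λ S → [ ¬? (suc x ∈? S) ] * G (S ⊕ suc x)) ⟩
    ∑ (subsets n) (λ S → [ ¬? (x ∈? S) ] * G (outside ∷ᵥ (S ⊕ x))) + ∑ (subsets n) (λ S → [ ¬? (x ∈? S) ] * G (inside ∷ᵥ (S ⊕ x)))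
      ≈⟨ +-cong (∑-⊕ x (λ S → G (outside ∷ᵥ S))) (∑-⊕ x (λ S → G (inside ∷ᵥ S))) ⟩
    ∑ (subsets n) (λ S → [ x ∈? S ] * G (outside ∷ᵥ S)) + ∑ (subsets n) (λ S → [ x ∈? S ] * G (inside ∷ᵥ S))
      ≈⟨ ∑-subsets-suc (λ T → [ suc x ∈? T ] * G T) ⟨
    ∑ (subsets (suc n)) (λ T → [ suc x ∈? T ] * G T) ∎

  ∑-∈ : ∀ (S : Subset n) → ∑ (allFin n) (λ x → [ x ∈? S ]) ≈ fromℕ ∣ S ∣
  ∑-∈ []ᵥ = refl
  ∑-∈ {suc n} (outside ∷ᵥ S) = trans (∑-allFin-suc (λ x → [ x ∈? (outside ∷ᵥ S) ])) (trans (+-identityˡ _) (∑-∈ S))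
  ∑-∈ {suc n} (inside ∷ᵥ S)  = trans (∑-allFin-suc (λ x → [ x ∈? (inside ∷ᵥ S) ])) (+-congˡ (∑-∈ S))

  -- A general `h` makes the induction go through: it shortens the tabulated list while the subset
  -- stays fixed.
  ∏-filter-suc : ∀ {m} s (S : Subset n) (ω : Fin (suc n) → Carrier) (h : Fin m → Fin n) →
    ∏ (filter (_∈? (s ∷ᵥ S)) (tabulate (λ i → suc (h i)))) ω ≈ ∏ (filter (_∈? S) (tabulate h)) (λ x → ω (suc x))
  ∏-filter-suc {m = zero}  s S ω h = refl
  ∏-filter-suc {m = suc m} s S ω h with does (h zero ∈? S)
  ... | true  = *-congˡ (∏-filter-suc s S ω (λ i → h (suc i)))
  ... | false = ∏-filter-suc s S ω (λ i → h (suc i))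

  ∏-elements-⊕ : ∀ (S : Subset n) (ω : Fin n → Carrier) x → x ∉ₛ S → ∏ (elements (S ⊕ x)) ω ≈ ω x * ∏ (elements S) ω
  ∏-elements-⊕ (inside ∷ᵥ S) ω zero x∉S = ⊥-elim (x∉S Vec.here)
  ∏-elements-⊕ (outside ∷ᵥ S) ω zero x∉S = *-congˡ (begin-equality
    ∏ (filter (_∈? (inside ∷ᵥ (S ∪ ⊥))) (tabulate suc)) ω
      ≈⟨ reflexive (≡.cong (λ S → ∏ (filter (_∈? (inside ∷ᵥ S)) (tabulate suc)) ω) (∪-identityʳ S)) ⟩
    ∏ (filter (_∈? (inside ∷ᵥ S)) (tabulate suc)) ω
      ≈⟨ ∏-filter-suc inside S ω (λ i → i) ⟩
    ∏ (elements S) (λ x → ω (suc x))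
      ≈⟨ ∏-filter-suc outside S ω (λ i → i) ⟨
    ∏ (filter (_∈? (outside ∷ᵥ S)) (tabulate suc)) ω ∎)
  ∏-elements-⊕ (outside ∷ᵥ S) ω (suc x) x∉S = begin-equality
    ∏ (filter (_∈? (outside ∷ᵥ (S ⊕ x))) (tabulate suc)) ω
      ≈⟨ ∏-filter-suc outside (S ⊕ x) ω (λ i → i) ⟩
    ∏ (elements (S ⊕ x)) (λ x → ω (suc x))
      ≈⟨ ∏-elements-⊕ S (λ x → ω (suc x)) x (λ x∈S → x∉S (Vec.there x∈S)) ⟩
    ω (suc x) * ∏ (elements S) (λ x → ω (suc x))
      ≈⟨ *-congˡ (∏-filter-suc outside S ω (λ i → i)) ⟨
    ω (suc x) * ∏ (filter (_∈? (outside ∷ᵥ S)) (tabulate suc)) ω ∎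
  ∏-elements-⊕ (inside ∷ᵥ S) ω (suc x) x∉S = begin-equality
    ω zero * ∏ (filter (_∈? (inside ∷ᵥ (S ⊕ x))) (tabulate suc)) ω
      ≈⟨ *-congˡ (∏-filter-suc inside (S ⊕ x) ω (λ i → i)) ⟩
    ω zero * ∏ (elements (S ⊕ x)) (λ x → ω (suc x))
      ≈⟨ *-congˡ (∏-elements-⊕ S (λ x → ω (suc x)) x (λ x∈S → x∉S (Vec.there x∈S))) ⟩
    ω zero * (ω (suc x) * ∏ (elements S) (λ x → ω (suc x)))
      ≈⟨ solve 3 (λ a b c → a :* (b :* c) := b :* (a :* c)) refl (ω zero) (ω (suc x)) (∏ (elements S) (λ x → ω (suc x))) ⟩
    ω (suc x) * (ω zero * ∏ (elements S) (λ x → ω (suc x)))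
      ≈⟨ *-congˡ (*-congˡ (∏-filter-suc inside S ω (λ i → i))) ⟨
    ω (suc x) * (ω zero * ∏ (filter (_∈? (inside ∷ᵥ S)) (tabulate suc)) ω) ∎

  ∏-elements-⊥ : ∀ (ω : Fin n → Carrier) → ∏ (elements ⊥) ω ≈ 1#
  ∏-elements-⊥ {zero}  ω = refl
  ∏-elements-⊥ {suc n} ω = trans (∏-filter-suc outside ⊥ ω (λ i → i)) (∏-elements-⊥ (λ x → ω (suc x)))

  ∏-pos : ∀ {A : Set} (xs : List A) {f} → (∀ x → 0# < f x) → 0# < ∏ xs f
  ∏-pos []       0<f = 0<1
  ∏-pos (x ∷ xs) 0<f = *-pos (0<f x) (∏-pos xs 0<f)

-- Continuations and parallel classes in a matroid

module MatroidProperties {n : ℕ} (M : Matroid n) where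
  open Matroid M
  open SubsetProperties

  basis : ∃ λ T → Indep T × ∣ T ∣ ≡ rk
  basis with argmax-sel (λ j → j) 0 (map ∣_∣ (filter indep? (subsets n)))
  -- The maximum is its default value 0, attained by the empty set.
  ... | inj₁ rk≡0 = ⊥ , ⊥-indep , ≡.trans (∣⊥∣≡0 n) (≡.sym rk≡0)
  ... | inj₂ rk∈ with ∈-map⁻ ∣_∣ rk∈
  ...   | T , T∈ , rk≡∣T∣ = T , proj₂ (∈-filter⁻ indep? {xs = subsets n} T∈) , ≡.sym rk≡∣T∣

  augment : ∀ {S} → Indep S → ∣ S ∣ ℕ.< rk → ∃ (Cont S)
  augment {S} S-indep ∣S∣<rk with basis
  ... | T , T-indep , ∣T∣≡rk with exchange S-indep T-indep (≡.subst (∣ S ∣ ℕ.<_) (≡.sym ∣T∣≡rk) ∣S∣<rk)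
  ...   | x , _ , x∉S , S⊕x-indep = x , x∉S , S⊕x-indep

  ∣cont∣ : ∀ {S x} → Cont S x → ∣ S ⊕ x ∣ ≡ suc ∣ S ∣
  ∣cont∣ {S} {x} (x∉S , _) = ∣⊕∣ S x x∉S

  cont-indep : ∀ {S x} → Cont S x → Indep S
  cont-indep {S} {x} (_ , S⊕x-indep) = hereditary (⊆⊕ S x) S⊕x-indep

  cont-weaken : ∀ {S x y} → Cont (S ⊕ x) y → Cont S y
  cont-weaken {S} {x} {y} (y∉ , indep) = (λ y∈S → y∉ (⊆⊕ S x y∈S)) ,
    hereditary (⊕⊆ (λ z∈S → ⊆⊕ (S ⊕ x) y (⊆⊕ S x z∈S)) (∈⊕ (S ⊕ x) y)) indep

  cont-swap : ∀ {S x y} → Cont S x → Cont (S ⊕ x) y → Cont (S ⊕ y) x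
  cont-swap {S} {x} {y} (x∉S , _) (y∉S⊕x , indep) = x∉S⊕y , ≡.subst Indep (⊕-comm S x y) indep
    where
    x∉S⊕y : x ∉ₛ S ⊕ y
    x∉S⊕y x∈ with ∈⊕⁻ S x∈
    ... | inj₁ x∈S    = x∉S x∈S
    ... | inj₂ ≡.refl = y∉S⊕x (∈⊕ S x)

  -- The transitivity of parallelism, in contrapositive form.
  cont-transfer : ∀ {S x y w} → Cont S x → Cont S y → ¬ Cont (S ⊕ x) y → Cont (S ⊕ x) w → Cont (S ⊕ y) w
  cont-transfer {S} {x} {y} {w} cx cy x∦y cw
    -- `S ⊕ x ⊕ w` has one element more than `S ⊕ y`. The element gained can only be `w`: gaining
    -- `x` would make `x` and `y` nonparallel.
    with exchange (proj₂ cy) (proj₂ cw) (≡.subst₂ ℕ._<_ (≡.sym (∣cont∣ cy)) (≡.sym (≡.trans (∣cont∣ cw) (≡.cong suc (∣cont∣ cx)))) (ℕ.n<1+n _))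
  ... | e , e∈ , e∉ , indep with ∈⊕⁻ (S ⊕ x) e∈
  ...   | inj₂ ≡.refl = e∉ , indep
  ...   | inj₁ e∈S⊕x with ∈⊕⁻ S e∈S⊕x
  ...     | inj₁ e∈S    = ⊥-elim (e∉ (⊆⊕ S y e∈S))
  ...     | inj₂ ≡.refl = ⊥-elim (x∦y (cont-swap cy (e∉ , indep)))

  ∈-ℐ : ∀ {j S} → IndepOfSize j S → S ∈ ℐ j
  ∈-ℐ {j} {S} S-indep = ∈-filter⁺ (indepOfSize? j) (∈-subsets S) S-indep

  ∣Par∣≤p : ∀ {j S} → IndepOfSize j S → length (Par S) ℕ.≤ p j
  ∣Par∣≤p {j} S-indep = All.lookup (xs≤max 0 (map (λ S → length (Par S)) (ℐ j)))
    (∈-map⁺ (λ S → length (Par S)) (∈-ℐ S-indep))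

  ∼? : ∀ S x y → Dec (Cont S y × x ∼[ S ] y)
  ∼? S x y = cont? S y ×-dec (x ∼[ S ]? y)

  parallelClass : Subset n → Fin n → Subset n
  parallelClass S x = comprehension (∼? S x)

  -- Together with `¬cont⇒∼` this identifies the nonparallel pairs with the two-step extensions of
  -- `S`, the form in which exchange applies to them and in which they enter the matrices.
  cont⇒≁ : ∀ {S x y} → Cont (S ⊕ x) y → ¬ (x ∼[ S ] y)
  cont⇒≁ {S} {x} (y∉ , _) (inj₁ ≡.refl) = y∉ (∈⊕ S x)
  cont⇒≁ {S} {x} {y} (_ , indep) (inj₂ dep) = dep (≡.subst Indep (∪-assoc S ⁅ x ⁆ ⁅ y ⁆) indep)

  ¬cont⇒∼ : ∀ {S x y} → Cont S y → ¬ Cont (S ⊕ x) y → x ∼[ S ] y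
  ¬cont⇒∼ {S} {x} {y} (y∉S , _) ¬cont with x Fin.≟ y
  ... | yes x≡y = inj₁ x≡y
  ... | no  x≢y = inj₂ (λ indep → ¬cont (y∉S⊕x , ≡.subst Indep (≡.sym (∪-assoc S ⁅ x ⁆ ⁅ y ⁆)) indep))
    where
    y∉S⊕x : y ∉ₛ S ⊕ x
    y∉S⊕x y∈ with ∈⊕⁻ S y∈
    ... | inj₁ y∈S = y∉S y∈S
    ... | inj₂ y≡x = x≢y (≡.sym y≡x)

  ∼⇒¬cont : ∀ {S x y} → x ∼[ S ] y → ¬ Cont (S ⊕ x) y
  ∼⇒¬cont x∼y c = cont⇒≁ c x∼y

  ∼-refl : ∀ {S x} → x ∼[ S ] x
  ∼-refl = inj₁ ≡.refl

  ∼-trans : ∀ {S x y z} → Cont S x → Cont S y → Cont S z → x ∼[ S ] y → y ∼[ S ] z → x ∼[ S ] z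
  ∼-trans cx cy cz x∼y y∼z = ¬cont⇒∼ cz (λ c → ∼⇒¬cont y∼z (cont-transfer cx cy (∼⇒¬cont x∼y) c))

  ∼-sym : ∀ {S x y} → Cont S x → Cont S y → x ∼[ S ] y → y ∼[ S ] x
  ∼-sym cx cy x∼y = ¬cont⇒∼ cx (λ c → ∼⇒¬cont x∼y (cont-swap cy c))

  parallelClass-isParallelClass : ∀ {S x} → Cont S x → IsParallelClass S (parallelClass S x)
  parallelClass-isParallelClass {S} {x} cx = x , cx , λ y → mk⇔ (∈-comprehension⁻ (∼? S x)) (∈-comprehension⁺ (∼? S x))

  class⊆Cont : ∀ {S C y} → IsParallelClass S C → y ∈ₛ C → Cont S y
  class⊆Cont (_ , _ , mem) y∈C = proj₁ (Equivalence.to (mem _) y∈C)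

  -- By symmetry and transitivity any member can replace the representative hidden in
  -- `IsParallelClass`. Hence no continuation lies in two classes.
  class≡parallelClass : ∀ {S C y} → IsParallelClass S C → y ∈ₛ C → parallelClass S y ≡ C
  class≡parallelClass {S} {C} {y} (x , cx , mem) y∈C = ⊆-antisym to from
    where
    cy = proj₁ (Equivalence.to (mem y) y∈C)
    x∼y = proj₂ (Equivalence.to (mem y) y∈C)
    to : parallelClass S y ⊆ C
    to {z} z∈ with ∈-comprehension⁻ (∼? S y) z∈
    ... | cz , y∼z = Equivalence.from (mem z) (cz , ∼-trans cx cy cz x∼y y∼z)
    from : C ⊆ parallelClass S y
    from {z} z∈C with Equivalence.to (mem z) z∈C
    ... | cz , x∼z = ∈-comprehension⁺ (∼? S y) (cz , ∼-trans cy cx cz (∼-sym cx cy x∼y) x∼z)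

  ∈parallelClass : ∀ {S x} → Cont S x → x ∈ₛ parallelClass S x
  ∈parallelClass {S} {x} cx = ∈-comprehension⁺ (∼? S x) (cx , ∼-refl)

  ∈-parallelClass⁺ : ∀ {S x y} → Cont S y → x ∼[ S ] y → y ∈ₛ parallelClass S x
  ∈-parallelClass⁺ {S} {x} cy x∼y = ∈-comprehension⁺ (∼? S x) (cy , x∼y)

  ∈-parallelClass⁻ : ∀ {S x y} → y ∈ₛ parallelClass S x → Cont S y × x ∼[ S ] y
  ∈-parallelClass⁻ {S} {x} = ∈-comprehension⁻ (∼? S x)

  ∈-Par : ∀ {S C} → IsParallelClass S C → C ∈ Par S
  ∈-Par {S} {C} isClass = ∈-filter⁺ (isParallelClass? S) (∈-subsets C) isClass

  Par-∈ : ∀ {S C} → C ∈ Par S → IsParallelClass S C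
  Par-∈ {S} C∈ = proj₂ (∈-filter⁻ (isParallelClass? S) {xs = subsets n} C∈)

  indepOfSize : ∀ j → j ℕ.≤ rk → ∃ (IndepOfSize j)
  indepOfSize zero    _    = ⊥ , ⊥-indep , ∣⊥∣≡0 n
  indepOfSize (suc j) j<rk with indepOfSize j (ℕ.<⇒≤ j<rk)
  ... | S , S-indep , ∣S∣≡j with augment S-indep (≡.subst (ℕ._< rk) (≡.sym ∣S∣≡j) j<rk)
  ...   | x , cx = S ⊕ x , proj₂ cx , ≡.trans (∣cont∣ cx) (≡.cong suc ∣S∣≡j)

-- The parameter k is the k - 1 of the theorem.
module IndependenceForms (ℝ : CompleteOrderedField) {n : ℕ} (M : Matroid n)
  (ω : Fin n → CompleteOrderedField.Carrier ℝ)
  (0<ω : ∀ x → CompleteOrderedField._<_ ℝ (CompleteOrderedField.0# ℝ) (ω x))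
  (k : ℕ) (1+k<rk : suc k ℕ.< Matroid.rk M) where

  open CompleteOrderedField ℝ hiding (zero)
  open OrderedField ℝ
  open SubsetProperties
  open QuadraticForms ℝ
  open SubsetSums ℝ
  open Matroid M
  open MatroidProperties M
  open Weighted ℝ M ω
  open ≈-Reasoning

  -- The forms attached to independent sets

  ω̂ : Vector (suc n)
  ω̂ = 0# ◂ ω

  0≤ω : ∀ x → 0# ≤ ω x
  0≤ω x = <⇒≤ (0<ω x)

  P : Carrier
  P = fromℕ (p k)

  𝟙 : Subset n → Vector n
  𝟙 S x = [ cont? S x ]

  -- Index zero stands for the homogenising variable, rescaled by P - 1 so that the
  -- corner coefficient P / (P - 1) of the quadratic form becomes P (P - 1).
  link : Subset n → Vector (suc n)
  link T zero    = P - 1#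
  link T (suc y) = 𝟙 T y

  -- The matrix of `H_S`: away from index zero it is the adjacency matrix of nonparallel
  -- continuations. The row of index `suc x` is written through `S ⊕ x`, which allows it to be
  -- followed through the recursion of `level`.
  base : Subset n → Matrix (suc n)
  base S zero    zero    = P * (P - 1#)
  base S zero    (suc y) = (P - 1#) * 𝟙 S y
  base S (suc x) j       = 𝟙 S x * link (S ⊕ x) j

  -- Meant for `m + ∣ S ∣ ≡ k`: the form of `S`, reached by `m` summations from the sets of size
  -- `k`. The indicator in `derivative` lets each summation run over the whole ground set.
  level : ℕ → Subset n → Matrix (suc n)
  derivative : ℕ → Subset n → Fin n → Matrix (suc n)
  level zero    S     = base S
  level (suc m) S i j = ω ∙ (λ x → derivative m S x i j)
  derivative m S x i j = 𝟙 S x * level m (S ⊕ x) i j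

  𝟙𝟙-sym : ∀ S x y → 𝟙 S x * 𝟙 (S ⊕ x) y ≈ 𝟙 S y * 𝟙 (S ⊕ y) x
  𝟙𝟙-sym S x y = begin-equality
    𝟙 S x * 𝟙 (S ⊕ x) y                  ≈⟨ []-* (cont? S x) (cont? (S ⊕ x) y) ⟩
    [ cont? S x ×-dec cont? (S ⊕ x) y ]  ≈⟨ []-cong (cont? S x ×-dec cont? (S ⊕ x) y) (cont? S y ×-dec cont? (S ⊕ y) x) swap swap ⟩
    [ cont? S y ×-dec cont? (S ⊕ y) x ]  ≈⟨ []-* (cont? S y) (cont? (S ⊕ y) x) ⟨
    𝟙 S y * 𝟙 (S ⊕ y) x                  ∎
    where
    swap : ∀ {x y} → Cont S x × Cont (S ⊕ x) y → Cont S y × Cont (S ⊕ y) x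
    swap (cx , cy) = cont-weaken cy , cont-swap cx cy

  level-sym : ∀ m S → Symmetric (level m S)
  level-sym zero S zero    zero    = refl
  level-sym zero S zero    (suc y) = *-comm (P - 1#) (𝟙 S y)
  level-sym zero S (suc x) zero    = *-comm (𝟙 S x) (P - 1#)
  level-sym zero S (suc x) (suc y) = 𝟙𝟙-sym S x y
  level-sym (suc m) S i j = ∙-congˡ ω (λ x → *-congˡ (level-sym m (S ⊕ x) i j))

  derivative-sym : ∀ m S x → Symmetric (derivative m S x)
  derivative-sym m S x i j = *-congˡ (level-sym m (S ⊕ x) i j)

  -- Row `x` of `level m S` depends, up to an indicator, only on `T = S ⊕ x`; this is that row as a
  -- function of `T`.
  iteratedLink : ℕ → Subset n → Vector (suc n)
  iteratedLink zero    T   = link T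
  iteratedLink (suc m) T j = ω ∙ (λ y → 𝟙 T y * iteratedLink m (T ⊕ y) j)

  -- Adjoining `y` and then `x` is the same as adjoining `x` and then `y`, so the indicator of `x`
  -- comes out of the sum over `y`.
  level-suc : ∀ m S x j → level m S (suc x) j ≈ 𝟙 S x * iteratedLink m (S ⊕ x) j
  level-suc zero    S x j = refl
  level-suc (suc m) S x j = begin-equality
    ω ∙ (λ y → 𝟙 S y * level m (S ⊕ y) (suc x) j)
      ≈⟨ ∙-congˡ ω (λ y → begin-equality
           𝟙 S y * level m (S ⊕ y) (suc x) j
             ≈⟨ *-congˡ (level-suc m (S ⊕ y) x j) ⟩
           𝟙 S y * (𝟙 (S ⊕ y) x * iteratedLink m (S ⊕ y ⊕ x) j)
             ≈⟨ sym (*-assoc (𝟙 S y) (𝟙 (S ⊕ y) x) (iteratedLink m (S ⊕ y ⊕ x) j)) ⟩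
           𝟙 S y * 𝟙 (S ⊕ y) x * iteratedLink m (S ⊕ y ⊕ x) j
             ≈⟨ *-cong (𝟙𝟙-sym S y x) (reflexive (≡.cong (λ T → iteratedLink m T j) (⊕-comm S y x))) ⟩
           𝟙 S x * 𝟙 (S ⊕ x) y * iteratedLink m (S ⊕ x ⊕ y) j
             ≈⟨ *-assoc (𝟙 S x) (𝟙 (S ⊕ x) y) (iteratedLink m (S ⊕ x ⊕ y) j) ⟩
           𝟙 S x * (𝟙 (S ⊕ x) y * iteratedLink m (S ⊕ x ⊕ y) j) ∎) ⟩
    ω ∙ (λ y → 𝟙 S x * (𝟙 (S ⊕ x) y * iteratedLink m (S ⊕ x ⊕ y) j))
      ≈⟨ ∙-scale (𝟙 S x) (λ y → 𝟙 (S ⊕ x) y * iteratedLink m (S ⊕ x ⊕ y) j) ⟩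
    𝟙 S x * iteratedLink (suc m) (S ⊕ x) j ∎
    where
    ∙-scale : ∀ c v → ω ∙ (λ y → c * v y) ≈ c * (ω ∙ v)
    ∙-scale c v = trans (∑-cong (allFin n) (λ y → solve 3 (λ w c v → w :* (c :* v) := c :* (w :* v)) refl (ω y) c (v y)))
      (∑-*ˡ (allFin n) c (λ y → ω y * v y))

  -- The hypothesis `row≈` of `Derivatives`. By `level-suc`, at `suc m` on the left and at `m` on
  -- the right, both sides are `𝟙 S x` times the same iterated link.
  level-row : ∀ m S x j → level (suc m) S (suc x) j ≈ ω ∙ (λ y → derivative m S x (suc y) j)
  level-row m S x j = begin-equality
    level (suc m) S (suc x) j
      ≈⟨ level-suc (suc m) S x j ⟩
    𝟙 S x * (ω ∙ (λ y → 𝟙 (S ⊕ x) y * iteratedLink m (S ⊕ x ⊕ y) j))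
      ≈⟨ *-congˡ (∙-congˡ ω (λ y → level-suc m (S ⊕ x) y j)) ⟨
    𝟙 S x * (ω ∙ (λ y → level m (S ⊕ x) (suc y) j))
      ≈⟨ ∑-*ˡ (allFin n) (𝟙 S x) (λ y → ω y * level m (S ⊕ x) (suc y) j) ⟨
    ∑ (allFin n) (λ y → 𝟙 S x * (ω y * level m (S ⊕ x) (suc y) j))
      ≈⟨ ∑-cong (allFin n) (λ y → solve 3 (λ c w l → c :* (w :* l) := w :* (c :* l)) refl (𝟙 S x) (ω y) (level m (S ⊕ x) (suc y) j)) ⟩
    ω ∙ (λ y → derivative m S x (suc y) j) ∎

  level-nonneg : ∀ m S x y → 0# ≤ level m S (suc x) (suc y)
  level-nonneg zero    S x y = *-nonneg ([ cont? S x ]-nonneg) ([ cont? (S ⊕ x) y ]-nonneg)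
  level-nonneg (suc m) S x y = ∑-nonneg (allFin n) (λ w → *-nonneg (0≤ω w) (*-nonneg ([ cont? S w ]-nonneg) (level-nonneg m (S ⊕ w) x y)))

  -- A nonparallel pair is an edge at every level: the rank bound leaves room for a further element
  -- `w`, and the summand of `w` contains the same edge one level down.
  level-pos : ∀ m {S x y} → Cont S x → Cont (S ⊕ x) y → m ℕ.+ ∣ S ∣ ≡ k → 0# < level m S (suc x) (suc y)
  level-pos zero    {S} {x} {y} cx cy _ = *-pos (0<[ cont? S x ] cx) (0<[ cont? (S ⊕ x) y ] cy)
  level-pos (suc m) {S} {x} {y} cx cy eq with augment (proj₂ cy) ∣S⊕x⊕y∣<rk
    where
    ∣S⊕x⊕y∣<rk : ∣ S ⊕ x ⊕ y ∣ ℕ.< rk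
    ∣S⊕x⊕y∣<rk = ℕ.≤-<-trans (ℕ.≤-trans (ℕ.≤-reflexive (≡.trans (∣cont∣ cy) (≡.cong suc (∣cont∣ cx))))
      (ℕ.s≤s (ℕ.≤-trans (ℕ.s≤s (ℕ.m≤n+m ∣ S ∣ m)) (ℕ.≤-reflexive eq)))) 1+k<rk
  ... | w , cw = ∑-pos term term-nonneg (∈-allFin w)
      (*-pos (0<ω w) (*-pos (0<[ cont? S w ] w∈) (level-pos m {S ⊕ w} {x} {y} x∈ y∈ (≡.trans (≡.cong (m ℕ.+_) (∣cont∣ w∈)) (≡.trans (ℕ.+-suc m ∣ S ∣) eq)))))
    where
    cw′ : Cont (S ⊕ x) w
    cw′ = cont-weaken cw
    w∈ : Cont S w
    w∈ = cont-weaken cw′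
    x∈ : Cont (S ⊕ w) x
    x∈ = cont-swap cx cw′
    y∈ : Cont (S ⊕ w ⊕ x) y
    y∈ = ≡.subst (λ T → Cont T y) (⊕-comm S x w) (cont-swap cy cw)
    term : Vector n
    term w = ω w * derivative m S w (suc x) (suc y)
    term-nonneg : ∀ w → 0# ≤ term w
    term-nonneg w = *-nonneg (0≤ω w) (*-nonneg ([ cont? S w ]-nonneg) (level-nonneg m (S ⊕ w) x y))

  two-steps : ∀ m S → Indep S → m ℕ.+ ∣ S ∣ ≡ k → ∃ λ x → ∃ λ y → Cont S x × Cont (S ⊕ x) y
  two-steps m S S-indep eq with augment S-indep (ℕ.≤-<-trans ∣S∣≤k (ℕ.<-trans (ℕ.n<1+n k) 1+k<rk))
    where
    ∣S∣≤k : ∣ S ∣ ℕ.≤ k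
    ∣S∣≤k = ℕ.≤-trans (ℕ.m≤n+m ∣ S ∣ m) (ℕ.≤-reflexive eq)
  ... | x , cx with augment (proj₂ cx) (ℕ.≤-<-trans (ℕ.≤-trans (ℕ.≤-reflexive (∣cont∣ cx)) (ℕ.s≤s (ℕ.≤-trans (ℕ.m≤n+m ∣ S ∣ m) (ℕ.≤-reflexive eq)))) 1+k<rk)
  ...   | y , cy = x , y , cx , cy

  form-ω̂ω̂-pos : ∀ m S → Indep S → m ℕ.+ ∣ S ∣ ≡ k → 0# < form (level m S) ω̂ ω̂
  form-ω̂ω̂-pos m S S-indep eq with two-steps m S S-indep eq
  ... | x , y , cx , cy = begin-strict
    0#                       <⟨ ∑-pos row row-nonneg (∈-allFin x) (*-pos (0<ω x)
                                  (∑-pos (entry x) (entry-nonneg x) (∈-allFin y) (*-pos (level-pos m cx cy eq) (0<ω y)))) ⟩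
    ∑ (allFin n) row         ≈⟨ ∙-congˡ ω (λ x → ∙-0◂ (level m S (suc x)) ω) ⟨
    ω ∙ (λ x → level m S (suc x) ∙ ω̂)  ≈⟨ 0◂-∙ ω (λ i → level m S i ∙ ω̂) ⟨
    form (level m S) ω̂ ω̂     ∎
    where
    entry : Fin n → Vector n
    entry x y = level m S (suc x) (suc y) * ω y
    row : Vector n
    row x = ω x * ∑ (allFin n) (entry x)
    entry-nonneg : ∀ x y → 0# ≤ entry x y
    entry-nonneg x y = *-nonneg (level-nonneg m S x y) (0≤ω y)
    row-nonneg : ∀ x → 0# ≤ row x
    row-nonneg x = *-nonneg (0≤ω x) (∑-nonneg (allFin n) (entry-nonneg x))

  -- Fix a continuation `x₀` and a `w` not parallel to it. Any continuation is adjacent to `x₀` or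
  -- parallel to it, and in the second case transitivity makes it adjacent to `w`. The remaining
  -- elements have zero rows.
  level-connected : ∀ m S → Indep S → m ℕ.+ ∣ S ∣ ≡ k → ∀ (φ : Vector n) →
    (∀ x y → 0# < level m S (suc x) (suc y) → φ x ≈ φ y) →
    ∃ λ c → ∀ x → φ x ≈ c ⊎ (∀ j → level m S (suc x) j ≈ 0#)
  level-connected m S S-indep eq φ φ-edge with two-steps m S S-indep eq
  ... | x₀ , w , cx₀ , cw = φ x₀ , λ x → compare-with x (cont? S x)
    where
    edge : ∀ {x y} → Cont S x → Cont (S ⊕ x) y → φ x ≈ φ y
    edge {x} {y} cx cy = φ-edge x y (level-pos m cx cy eq)
    compare-with : ∀ x → Dec (Cont S x) → φ x ≈ φ x₀ ⊎ (∀ j → level m S (suc x) j ≈ 0#)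
    compare-with x (no ¬cx) = inj₂ (λ j → trans (level-suc m S x j) (trans (*-congʳ ([ cont? S x ]-false ¬cx)) (zeroˡ _)))
    compare-with x (yes cx) with cont? (S ⊕ x₀) x
    ... | yes x₀x = inj₁ (sym (edge cx₀ x₀x))
    ... | no ¬x₀x = inj₁ (trans (edge cx (cont-transfer cx₀ cx ¬x₀x cw)) (sym (edge cx₀ cw)))

  -- The base form in terms of parallel classes

  total : Subset n → Vector n → Carrier
  total S u = u ∙ 𝟙 S

  classSum : Subset n → Vector n → Carrier
  classSum C u = u ∙ (λ x → [ x ∈? C ])

  -- A continuation lies in exactly one class, its own, and any other element in none, so the sum
  -- has at most one nonzero term.
  ∑-Par-∋ : ∀ S x (f : Subset n → Carrier) → ∑ (Par S) (λ C → [ x ∈? C ] * f C) ≈ 𝟙 S x * f (parallelClass S x)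
  ∑-Par-∋ S x f = begin-equality
    ∑ (Par S) (λ C → [ x ∈? C ] * f C)
      ≈⟨ ∑-filter (isParallelClass? S) (subsets n) (λ C → [ x ∈? C ] * f C) ⟩
    ∑ (subsets n) (λ C → [ isParallelClass? S C ] * ([ x ∈? C ] * f C))
      ≈⟨ ∑-cong (subsets n) (λ C → term C) ⟩
    ∑ (subsets n) (λ C → 𝟙 S x * ([ D ≟ₛ C ] * f C))
      ≈⟨ ∑-*ˡ (subsets n) (𝟙 S x) (λ C → [ D ≟ₛ C ] * f C) ⟩
    𝟙 S x * ∑ (subsets n) (λ C → [ D ≟ₛ C ] * f C)
      ≈⟨ *-congˡ (∑-subsets-δ D f) ⟩
    𝟙 S x * f D ∎
    where
    D = parallelClass S x
    term : ∀ C → [ isParallelClass? S C ] * ([ x ∈? C ] * f C) ≈ 𝟙 S x * ([ D ≟ₛ C ] * f C)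
    term C = begin-equality
      [ isParallelClass? S C ] * ([ x ∈? C ] * f C)  ≈⟨ *-assoc _ _ _ ⟨
      [ isParallelClass? S C ] * [ x ∈? C ] * f C    ≈⟨ *-congʳ ([]-* (isParallelClass? S C) (x ∈? C)) ⟩
      [ isParallelClass? S C ×-dec (x ∈? C) ] * f C  ≈⟨ *-congʳ ([]-cong (isParallelClass? S C ×-dec (x ∈? C)) (cont? S x ×-dec (D ≟ₛ C))
        (λ (isClass , x∈C) → class⊆Cont isClass x∈C , class≡parallelClass isClass x∈C)
        (λ { (cx , ≡.refl) → parallelClass-isParallelClass cx , ∈parallelClass cx })) ⟩
      [ cont? S x ×-dec (D ≟ₛ C) ] * f C             ≈⟨ *-congʳ ([]-* (cont? S x) (D ≟ₛ C)) ⟨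
      𝟙 S x * [ D ≟ₛ C ] * f C                       ≈⟨ *-assoc _ _ _ ⟩
      𝟙 S x * ([ D ≟ₛ C ] * f C)                     ∎

  ∑-Par-classSum : ∀ S u (f : Subset n → Carrier) →
    ∑ (Par S) (λ C → classSum C u * f C) ≈ u ∙ (λ x → 𝟙 S x * f (parallelClass S x))
  ∑-Par-classSum S u f = begin-equality
    ∑ (Par S) (λ C → classSum C u * f C)
      ≈⟨ ∑-cong (Par S) (λ C → trans (sym (∑-*ʳ (allFin n) (f C) (λ x → u x * [ x ∈? C ])))
           (∑-cong (allFin n) (λ x → *-assoc (u x) [ x ∈? C ] (f C)))) ⟩
    ∑ (Par S) (λ C → ∑ (allFin n) (λ x → u x * ([ x ∈? C ] * f C)))
      ≈⟨ ∑-swap (Par S) (allFin n) (λ C x → u x * ([ x ∈? C ] * f C)) ⟩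
    ∑ (allFin n) (λ x → ∑ (Par S) (λ C → u x * ([ x ∈? C ] * f C)))
      ≈⟨ ∑-cong (allFin n) (λ x → trans (∑-*ˡ (Par S) (u x) (λ C → [ x ∈? C ] * f C)) (*-congˡ (∑-Par-∋ S x f))) ⟩
    u ∙ (λ x → 𝟙 S x * f (parallelClass S x)) ∎

  ∑-Par-total : ∀ S u → ∑ (Par S) (λ C → classSum C u) ≈ total S u
  ∑-Par-total S u = begin-equality
    ∑ (Par S) (λ C → classSum C u)       ≈⟨ ∑-cong (Par S) (λ C → *-identityʳ (classSum C u)) ⟨
    ∑ (Par S) (λ C → classSum C u * 1#)  ≈⟨ ∑-Par-classSum S u (λ _ → 1#) ⟩
    u ∙ (λ x → 𝟙 S x * 1#)               ≈⟨ ∙-congˡ u (λ x → *-identityʳ (𝟙 S x)) ⟩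
    total S u                            ∎

  -- For a continuation `x`, the continuations of `S` are those of `S ⊕ x` together with the class
  -- of `x`. This presents the adjacency matrix as an all-ones block minus one block per class.
  𝟙-split : ∀ S x y → 𝟙 S x * 𝟙 (S ⊕ x) y ≈ 𝟙 S x * (𝟙 S y - [ y ∈? parallelClass S x ])
  𝟙-split S x y = []-when (cont? S x) (λ cx → split cx (cont? S y) (cont? (S ⊕ x) y) (y ∈? parallelClass S x))
    where
    split : Cont S x → (d₁ : Dec (Cont S y)) (d₂ : Dec (Cont (S ⊕ x) y)) (d₃ : Dec (y ∈ₛ parallelClass S x)) →
      [ d₂ ] ≈ [ d₁ ] - [ d₃ ]
    split cx (yes cy) (yes c) (yes y∈) = ⊥-elim (∼⇒¬cont (proj₂ (∈-parallelClass⁻ y∈)) c)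
    split cx (yes cy) (yes c) (no _)   = solve 0 (con (1 , 0) := con (1 , 0) :- con (0 , 0)) refl
    split cx (yes cy) (no ¬c) (yes _)  = sym (-‿inverseʳ 1#)
    split cx (yes cy) (no ¬c) (no y∉)  = ⊥-elim (y∉ (∈-parallelClass⁺ cy (¬cont⇒∼ cy ¬c)))
    split cx (no ¬cy) (yes c) _        = ⊥-elim (¬cy (cont-weaken c))
    split cx (no ¬cy) (no _) (yes y∈)  = ⊥-elim (¬cy (proj₁ (∈-parallelClass⁻ y∈)))
    split cx (no ¬cy) (no _) (no _)    = sym (-‿inverseʳ 0#)

  ℓ : Subset n → Carrier
  ℓ S = fromℕ (length (Par S))

  base-top : ∀ S v → base S zero ∙ v ≈ (P - 1#) * (total S (λ x → v (suc x)) + P * v zero)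
  base-top S v = begin-equality
    base S zero ∙ v
      ≈⟨ ∑-allFin-suc (λ j → base S zero j * v j) ⟩
    P * (P - 1#) * v zero + ∑ (allFin n) (λ y → (P - 1#) * 𝟙 S y * v (suc y))
      ≈⟨ +-congˡ (trans (∑-cong (allFin n) (λ y → solve 3 (λ c i u → c :* i :* u := c :* (u :* i)) refl (P - 1#) (𝟙 S y) (v (suc y))))
           (∑-*ˡ (allFin n) (P - 1#) (λ y → v (suc y) * 𝟙 S y))) ⟩
    P * (P - 1#) * v zero + (P - 1#) * total S (λ x → v (suc x))
      ≈⟨ solve 4 (λ P p a t → P :* p :* a :+ p :* t := p :* (t :+ P :* a)) refl P (P - 1#) (v zero) (total S (λ x → v (suc x))) ⟩
    (P - 1#) * (total S (λ x → v (suc x)) + P * v zero) ∎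

  -- The nonparallel pairs form a complete multipartite graph whose parts are the classes, so the
  -- nonzero indices contribute `A * A - Q`. The rest is completion of squares; `P - ℓ S` is the
  -- number of padding classes.
  base-form : ∀ S w → let a = w zero; u = λ x → w (suc x) in
    form (base S) w w ≈ (total S u + P * a) * (total S u + P * a)
      - ∑ (Par S) (λ C → (classSum C u + a) * (classSum C u + a)) - (P - ℓ S) * (a * a)
  base-form S w = begin-equality
    form (base S) w w
      ≈⟨ ∑-allFin-suc (λ i → w i * (base S i ∙ w)) ⟩
    a * (base S zero ∙ w) + u ∙ (λ x → base S (suc x) ∙ w)
      ≈⟨ +-cong (*-congˡ (base-top S w)) rows ⟩
    a * ((P - 1#) * (A + P * a)) + ((P - 1#) * a * A + (A * A - Q))
      ≈⟨ solve 5 (λ a P A Q l → let one = con (1 , 0) in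
           a :* ((P :- one) :* (A :+ P :* a)) :+ ((P :- one) :* a :* A :+ (A :* A :- Q))
           := (A :+ P :* a) :* (A :+ P :* a) :- (Q :+ (a :+ a) :* A :+ (a :* a) :* l) :- (P :- l) :* (a :* a))
           refl a P A Q (ℓ S) ⟩
    (A + P * a) * (A + P * a) - (Q + (a + a) * A + (a * a) * ℓ S) - (P - ℓ S) * (a * a)
      ≈⟨ +-congʳ (+-congˡ (-‿cong squares)) ⟨
    (A + P * a) * (A + P * a) - ∑ (Par S) (λ C → (classSum C u + a) * (classSum C u + a)) - (P - ℓ S) * (a * a) ∎
    where
    a = w zero
    u : Vector n
    u x = w (suc x)
    A = total S u
    Q = ∑ (Par S) (λ C → classSum C u * classSum C u)

    row : ∀ x → base S (suc x) ∙ w ≈ (P - 1#) * a * 𝟙 S x + (A * 𝟙 S x - 𝟙 S x * classSum (parallelClass S x) u)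
    row x = begin-equality
      base S (suc x) ∙ w
        ≈⟨ ∑-allFin-suc (λ j → base S (suc x) j * w j) ⟩
      𝟙 S x * (P - 1#) * a + ∑ (allFin n) (λ y → 𝟙 S x * 𝟙 (S ⊕ x) y * u y)
        ≈⟨ +-congˡ (∑-cong (allFin n) (λ y → trans (*-congʳ (𝟙-split S x y))
             (solve 3 (λ i d u → i :* d :* u := i :* (u :* d)) refl (𝟙 S x) (𝟙 S y - [ y ∈? parallelClass S x ]) (u y)))) ⟩
      𝟙 S x * (P - 1#) * a + ∑ (allFin n) (λ y → 𝟙 S x * (u y * (𝟙 S y - [ y ∈? parallelClass S x ])))
        ≈⟨ +-congˡ (trans (∑-*ˡ (allFin n) (𝟙 S x) (λ y → u y * (𝟙 S y - [ y ∈? parallelClass S x ])))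
             (*-congˡ (∙-- u (𝟙 S) (λ y → [ y ∈? parallelClass S x ])))) ⟩
      𝟙 S x * (P - 1#) * a + 𝟙 S x * (A - classSum (parallelClass S x) u)
        ≈⟨ solve 5 (λ i p a A c → i :* p :* a :+ i :* (A :- c) := p :* a :* i :+ (A :* i :- i :* c)) refl
             (𝟙 S x) (P - 1#) a A (classSum (parallelClass S x) u) ⟩
      (P - 1#) * a * 𝟙 S x + (A * 𝟙 S x - 𝟙 S x * classSum (parallelClass S x) u) ∎

    rows : u ∙ (λ x → base S (suc x) ∙ w) ≈ (P - 1#) * a * A + (A * A - Q)
    rows = begin-equality
      u ∙ (λ x → base S (suc x) ∙ w)
        ≈⟨ ∙-congˡ u row ⟩
      u ∙ (λ x → (P - 1#) * a * 𝟙 S x + (A * 𝟙 S x - 𝟙 S x * classSum (parallelClass S x) u))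
        ≈⟨ ∙-congˡ u (λ x → solve 3 (λ c i r → c :* i :+ r := c :* i :+ con (1 , 0) :* r) refl ((P - 1#) * a) (𝟙 S x)
             (A * 𝟙 S x - 𝟙 S x * classSum (parallelClass S x) u)) ⟩
      u ∙ combine ((P - 1#) * a) (𝟙 S) 1# (λ x → A * 𝟙 S x - 𝟙 S x * classSum (parallelClass S x) u)
        ≈⟨ ∙-combine u ((P - 1#) * a) (𝟙 S) 1# (λ x → A * 𝟙 S x - 𝟙 S x * classSum (parallelClass S x) u) ⟩
      (P - 1#) * a * A + 1# * (u ∙ (λ x → A * 𝟙 S x - 𝟙 S x * classSum (parallelClass S x) u))
        ≈⟨ +-congˡ (trans (*-identityˡ _) (∙-- u (λ x → A * 𝟙 S x) (λ x → 𝟙 S x * classSum (parallelClass S x) u))) ⟩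
      (P - 1#) * a * A + (u ∙ (λ x → A * 𝟙 S x) - u ∙ (λ x → 𝟙 S x * classSum (parallelClass S x) u))
        ≈⟨ +-congˡ (+-cong
             (trans (∑-cong (allFin n) (λ x → solve 3 (λ u a i → u :* (a :* i) := a :* (u :* i)) refl (u x) A (𝟙 S x)))
                    (∑-*ˡ (allFin n) A (λ x → u x * 𝟙 S x)))
             (-‿cong (sym (∑-Par-classSum S u (λ C → classSum C u))))) ⟩
      (P - 1#) * a * A + (A * A - Q) ∎

    squares : ∑ (Par S) (λ C → (classSum C u + a) * (classSum C u + a)) ≈ Q + (a + a) * A + (a * a) * ℓ S
    squares = begin-equality
      ∑ (Par S) (λ C → (classSum C u + a) * (classSum C u + a))
        ≈⟨ ∑-cong (Par S) (λ C → solve 2 (λ c a → (c :+ a) :* (c :+ a) := (c :* c :+ (a :+ a) :* c) :+ a :* a :* con (1 , 0)) refl (classSum C u) a) ⟩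
      ∑ (Par S) (λ C → (classSum C u * classSum C u + (a + a) * classSum C u) + a * a * 1#)
        ≈⟨ trans (∑-+ (Par S) (λ C → classSum C u * classSum C u + (a + a) * classSum C u) (λ _ → a * a * 1#))
             (+-cong (∑-+ (Par S) (λ C → classSum C u * classSum C u) (λ C → (a + a) * classSum C u)) (∑-*ˡ (Par S) (a * a) (λ _ → 1#))) ⟩
      Q + ∑ (Par S) (λ C → (a + a) * classSum C u) + (a * a) * ∑ (Par S) (λ _ → 1#)
        ≈⟨ +-cong (+-congˡ (trans (∑-*ˡ (Par S) (a + a) (λ C → classSum C u)) (*-congˡ (∑-Par-total S u)))) (*-congˡ (∑-length (Par S))) ⟩
      Q + (a + a) * A + (a * a) * ℓ S ∎

  0≤P-ℓ : ∀ {S} → IndepOfSize k S → 0# ≤ P - ℓ S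
  0≤P-ℓ S-indep = x≤y⇒0≤y-x (fromℕ-mono-≤ (∣Par∣≤p S-indep))

  base-hyperbolic : ∀ S → IndepOfSize k S → Hyperbolic (base S) ω̂
  base-hyperbolic S S-size@(S-indep , ∣S∣≡k) =
    hyperbolic-from-hyperplane (level-sym 0 S) l ω̂ (pos⇒≉0 0<lω̂) (<⇒≤ (form-ω̂ω̂-pos 0 S S-indep ∣S∣≡k)) negative
    where
    -- The functional whose square is the only positive term of `base-form`.
    l : Vector (suc n)
    l = P ◂ 𝟙 S
    0<lω̂ : 0# < l ∙ ω̂
    0<lω̂ with two-steps 0 S S-indep ∣S∣≡k
    ... | x , _ , cx , _ = begin-strict
      0#        <⟨ ∑-pos (λ y → 𝟙 S y * ω y) (λ y → *-nonneg ([ cont? S y ]-nonneg) (0≤ω y)) (∈-allFin x)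
                     (*-pos (0<[ cont? S x ] cx) (0<ω x)) ⟩
      𝟙 S ∙ ω   ≈⟨ ∙-0◂ l ω ⟨
      l ∙ ω̂     ∎
    negative : ∀ v → l ∙ v ≈ 0# → form (base S) v v ≤ 0#
    negative v lv≈0 = ≤-by (+-nonneg
        (∑-nonneg (Par S) (λ C → square-nonneg (classSum C u + a)))
        (*-nonneg (0≤P-ℓ S-size) (square-nonneg a))) (begin-equality
      0#
        ≈⟨ solve 2 (λ q r → con (0 , 0) := con (0 , 0) :* con (0 , 0) :- q :- r :+ (q :+ r)) refl Q R ⟩
      0# * 0# - Q - R + (Q + R)
        ≈⟨ +-congʳ (+-congʳ (+-congʳ (*-cong t≈0 t≈0))) ⟨
      (total S u + P * a) * (total S u + P * a) - Q - R + (Q + R)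
        ≈⟨ +-congʳ (base-form S v) ⟨
      form (base S) v v + (Q + R) ∎)
      where
      a = v zero
      u : Vector n
      u x = v (suc x)
      Q = ∑ (Par S) (λ C → (classSum C u + a) * (classSum C u + a))
      R = (P - ℓ S) * (a * a)
      t≈0 : total S u + P * a ≈ 0#
      t≈0 = begin-equality
        total S u + P * a  ≈⟨ +-comm _ _ ⟩
        P * a + total S u  ≈⟨ +-congˡ (∙-comm u (𝟙 S)) ⟩
        P * a + 𝟙 S ∙ u    ≈⟨ ◂-∙ P (𝟙 S) v ⟨
        l ∙ v              ≈⟨ lv≈0 ⟩
        0#                 ∎

  -- Hyperbolicity at every level and descent of the kernel

  ⊕-size : ∀ m {S x} → Cont S x → suc m ℕ.+ ∣ S ∣ ≡ k → m ℕ.+ ∣ S ⊕ x ∣ ≡ k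
  ⊕-size m {S} cx eq = ≡.trans (≡.cong (m ℕ.+_) (∣cont∣ cx)) (≡.trans (ℕ.+-suc m ∣ S ∣) eq)

  level-hyperbolic : ∀ m S → Indep S → m ℕ.+ ∣ S ∣ ≡ k → Hyperbolic (level m S) ω̂
  derivative-hyperbolic : ∀ m S → suc m ℕ.+ ∣ S ∣ ≡ k → ∀ x → Hyperbolic (derivative m S x) ω̂

  level-hyperbolic zero    S S-indep eq = base-hyperbolic S (S-indep , eq)
  level-hyperbolic (suc m) S S-indep eq =
    Derivatives.TrickleDown.M-hyperbolic 0<ω (level-sym (suc m) S) (derivative-sym m S) (λ i j → refl) (level-row m S)
      (derivative-hyperbolic m S eq) (level-nonneg (suc m) S) (level-connected (suc m) S S-indep eq)

  derivative-hyperbolic m S eq x = hyperbolic-indicator (cont? S x) (level m (S ⊕ x)) ω̂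
    (λ cx → level-hyperbolic m (S ⊕ x) (proj₂ cx) (⊕-size m cx eq))

  Kernel : Matrix (suc n) → Vector (suc n) → Set
  Kernel N z = ∀ v → form N z v ≈ 0#

  -- `kernel-descends` shows only that `z` is null and orthogonal to `ω̂` for the form of `S ⊕ x`.
  -- Since that form is hyperbolic and positive at `ω̂`, this already puts `z` in its kernel, ready
  -- for the next step.
  kernel-⊕ : ∀ m S z x → Cont S x → suc m ℕ.+ ∣ S ∣ ≡ k → Kernel (level (suc m) S) z → Kernel (level m (S ⊕ x)) z
  kernel-⊕ m S z x cx eq z-ker = hyperbolic-kernel (level-sym m (S ⊕ x))
      (level-hyperbolic m (S ⊕ x) (proj₂ cx) (⊕-size m cx eq))
      (form-ω̂ω̂-pos m (S ⊕ x) (proj₂ cx) (⊕-size m cx eq)) z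
      (trans (sym (unit z ω̂)) (proj₁ descended))
      (trans (sym (unit z z)) (proj₂ descended))
    where
    descended : form (derivative m S x) z ω̂ ≈ 0# × form (derivative m S x) z z ≈ 0#
    descended = Derivatives.kernel-descends 0<ω (level-sym (suc m) S) (derivative-sym m S) (λ i j → refl) (level-row m S)
      (derivative-hyperbolic m S eq) z z-ker x
    unit = form-indicator (cont? S x) (level m (S ⊕ x)) cx

  -- Exchange inside `T` supplies the elements of a chain from `S` up to `T`, along which the kernel
  -- descends one level at a time.
  kernel-⊆ : ∀ m S T z → S ⊆ T → IndepOfSize k T → m ℕ.+ ∣ S ∣ ≡ k → Kernel (level m S) z → Kernel (base T) z
  kernel-⊆ zero S T z S⊆T (_ , ∣T∣≡k) ∣S∣≡k z-ker =
    ≡.subst (λ S → Kernel (base S) z) (⊆∧∣∣≡⇒≡ S⊆T (≡.trans ∣S∣≡k (≡.sym ∣T∣≡k))) z-ker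
  kernel-⊆ (suc m) S T z S⊆T T-size@(T-indep , ∣T∣≡k) eq z-ker
    with exchange (hereditary S⊆T T-indep) T-indep (ℕ.≤-trans (ℕ.s≤s (ℕ.m≤n+m ∣ S ∣ m)) (ℕ.≤-reflexive (≡.trans eq (≡.sym ∣T∣≡k))))
  ... | x , x∈T , cx = kernel-⊆ m (S ⊕ x) T z (⊕⊆ S⊆T x∈T) T-size (⊕-size m cx eq) (kernel-⊕ m S z x cx eq z-ker)

  -- Positivity of the denominators, and the meaning of a kernel vector

  2≤∣Par∣ : ∀ {S} → IndepOfSize k S → 2 ℕ.≤ length (Par S)
  2≤∣Par∣ {S} (S-indep , ∣S∣≡k) with two-steps 0 S S-indep ∣S∣≡k
  ... | x , y , cx , cy = 2≤length (∈-Par (parallelClass-isParallelClass cx)) (∈-Par (parallelClass-isParallelClass (cont-weaken cy)))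
    (λ eq → cont⇒≁ cy (proj₂ (∈-parallelClass⁻ (≡.subst (y ∈ₛ_) (≡.sym eq) (∈parallelClass (cont-weaken cy))))))

  -- The rank bound provides a nonparallel pair over any independent set of size `k`, hence two
  -- classes. This makes the second inverse in the theorem a genuine one.
  0<P-1 : 0# < P - 1#
  0<P-1 with indepOfSize k (ℕ.<⇒≤ (ℕ.<-trans (ℕ.n<1+n k) 1+k<rk))
  ... | S , S-size = x<y⇒0<y-x (begin-strict
    1#       ≈⟨ +-identityʳ 1# ⟨
    fromℕ 1  <⟨ fromℕ-mono-< (ℕ.≤-trans (2≤∣Par∣ S-size) (∣Par∣≤p S-size)) ⟩
    P        ∎)

  weight-pos : ∀ S → 0# < weight S
  weight-pos S = ∏-pos (elements S) 0<ω

  I-pos : ∀ j → j ℕ.≤ rk → 0# < I j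
  I-pos j j≤rk with indepOfSize j j≤rk
  ... | S , S-size = ∑-pos weight (λ S → <⇒≤ (weight-pos S)) (∈-ℐ S-size) (weight-pos S)

  classSum≈ : ∀ C → ∑ (elements C) ω ≈ classSum C ω
  classSum≈ C = trans (∑-filter (_∈? C) (allFin n) ω) (∙-comm (λ x → [ x ∈? C ]) ω)

  -- The row of index zero kills the positive square of `base-form`, so the value zero at `z` says
  -- that two nonnegative terms add up to zero. The class squares then give the weights, and since
  -- `β` is nonzero the padding term gives the number of classes.
  kernel-classes : ∀ {α β z T} → 0# < β → z zero ≈ - β → (∀ x → z (suc x) ≈ α * ω x) → IndepOfSize k T →
    Kernel (base T) z → length (Par T) ≡ p k × (∀ C → IsParallelClass T C → α * ∑ (elements C) ω ≈ β)
  kernel-classes {α} {β} {z} {T} 0<β z₀≈ zₓ≈ T-size z-ker = ≡.sym (fromℕ-injective P≈ℓ) , classes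
    where
    a = z zero
    u : Vector n
    u x = z (suc x)
    square : Subset n → Carrier
    square C = (classSum C u + a) * (classSum C u + a)
    Q = ∑ (Par T) square
    R = (P - ℓ T) * (a * a)

    t≈0 : total T u + P * a ≈ 0#
    t≈0 = x*y≈0⇒y≈0 (total T u + P * a) (pos⇒≉0 0<P-1) (begin-equality
      (P - 1#) * (total T u + P * a)                ≈⟨ base-top T z ⟨
      base T zero ∙ z                               ≈⟨ δ-form (base T) zero z ⟨
      form (base T) (λ j → [ zero Fin.≟ j ]) z      ≈⟨ form-sym (level-sym 0 T) (λ j → [ zero Fin.≟ j ]) z ⟩
      form (base T) z (λ j → [ zero Fin.≟ j ])      ≈⟨ z-ker _ ⟩
      0#                                            ∎)

    0≤square : ∀ C → 0# ≤ square C
    0≤square C = square-nonneg (classSum C u + a)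
    0≤Q : 0# ≤ Q
    0≤Q = ∑-nonneg (Par T) 0≤square
    0≤R : 0# ≤ R
    0≤R = *-nonneg (0≤P-ℓ T-size) (square-nonneg a)

    Q+R≈0 : Q + R ≈ 0#
    Q+R≈0 = begin-equality
      Q + R
        ≈⟨ solve 3 (λ t q r → q :+ r := t :* t :- (t :* t :- q :- r)) refl (total T u + P * a) Q R ⟩
      (total T u + P * a) * (total T u + P * a) - ((total T u + P * a) * (total T u + P * a) - Q - R)
        ≈⟨ +-cong (*-cong t≈0 t≈0) (-‿cong (trans (sym (base-form T z)) (z-ker z))) ⟩
      0# * 0# - 0#
        ≈⟨ solve 0 (con (0 , 0) :* con (0 , 0) :- con (0 , 0) := con (0 , 0)) refl ⟩
      0# ∎

    P≈ℓ : P ≈ ℓ T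
    P≈ℓ = begin-equality
      P                ≈⟨ solve 2 (λ p l → p := l :+ (p :- l)) refl P (ℓ T) ⟩
      ℓ T + (P - ℓ T)  ≈⟨ +-congˡ (x*y≈0⇒y≈0 (P - ℓ T) a²≉0 (trans (*-comm (a * a) (P - ℓ T)) (+≈0⇒≈0 0≤R 0≤Q (trans (+-comm R Q) Q+R≈0)))) ⟩
      ℓ T + 0#         ≈⟨ +-identityʳ (ℓ T) ⟩
      ℓ T              ∎
      where
      a²≉0 : ¬ (a * a ≈ 0#)
      a²≉0 a²≈0 = pos⇒≉0 0<β (begin-equality
        β       ≈⟨ solve 1 (λ b → b := :- (:- b)) refl β ⟩
        - (- β) ≈⟨ -‿cong (trans (sym z₀≈) (square≈0⇒≈0 a²≈0)) ⟩
        - 0#    ≈⟨ solve 0 (:- con (0 , 0) := con (0 , 0)) refl ⟩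
        0#      ∎)

    classes : ∀ C → IsParallelClass T C → α * ∑ (elements C) ω ≈ β
    classes C isClass = begin-equality
      α * ∑ (elements C) ω       ≈⟨ *-congˡ (classSum≈ C) ⟩
      α * classSum C ω           ≈⟨ ∑-*ˡ (allFin n) α (λ x → ω x * [ x ∈? C ]) ⟨
      ∑ (allFin n) (λ x → α * (ω x * [ x ∈? C ]))
        ≈⟨ ∑-cong (allFin n) (λ x → trans (sym (*-assoc α (ω x) [ x ∈? C ])) (*-congʳ (sym (zₓ≈ x)))) ⟩
      classSum C u               ≈⟨ solve 2 (λ c a → c := c :+ a :- a) refl (classSum C u) a ⟩
      classSum C u + a - a       ≈⟨ +-cong (square≈0⇒≈0 (∑≈0⇒term≈0 square 0≤square (+≈0⇒≈0 0≤Q 0≤R Q+R≈0) (∈-Par isClass))) (-‿cong z₀≈) ⟩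
      0# - (- β)                 ≈⟨ solve 1 (λ b → con (0 , 0) :- (:- b) := b) refl β ⟩
      β                          ∎

  -- Double counting of the pairs (S , x) by T = S ⊕ x.
  ∑ℐ-suc : ∀ j (F : Subset n → Carrier) →
    ∑ (ℐ j) (λ S → weight S * (ω ∙ (λ x → 𝟙 S x * F (S ⊕ x)))) ≈ fromℕ (suc j) * ∑ (ℐ (suc j)) (λ T → weight T * F T)
  ∑ℐ-suc j F = begin-equality
    ∑ (ℐ j) (λ S → weight S * (ω ∙ (λ x → 𝟙 S x * F (S ⊕ x))))
      ≈⟨ ∑-filter (indepOfSize? j) (subsets n) (λ S → weight S * (ω ∙ (λ x → 𝟙 S x * F (S ⊕ x)))) ⟩
    ∑ (subsets n) (λ S → [ indepOfSize? j S ] * (weight S * (ω ∙ (λ x → 𝟙 S x * F (S ⊕ x)))))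
      ≈⟨ ∑-cong (subsets n) (λ S → trans (sym (*-assoc [ indepOfSize? j S ] (weight S) (ω ∙ (λ x → 𝟙 S x * F (S ⊕ x)))))
           (sym (∑-*ˡ (allFin n) ([ indepOfSize? j S ] * weight S) (λ x → ω x * (𝟙 S x * F (S ⊕ x)))))) ⟩
    ∑ (subsets n) (λ S → ∑ (allFin n) (λ x → [ indepOfSize? j S ] * weight S * (ω x * (𝟙 S x * F (S ⊕ x)))))
      ≈⟨ ∑-cong (subsets n) (λ S → ∑-cong (allFin n) (λ x → term S x)) ⟩
    ∑ (subsets n) (λ S → ∑ (allFin n) (λ x → [ ¬? (x ∈? S) ] * G (S ⊕ x)))
      ≈⟨ ∑-swap (subsets n) (allFin n) (λ S x → [ ¬? (x ∈? S) ] * G (S ⊕ x)) ⟩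
    ∑ (allFin n) (λ x → ∑ (subsets n) (λ S → [ ¬? (x ∈? S) ] * G (S ⊕ x)))
      ≈⟨ ∑-cong (allFin n) (λ x → ∑-⊕ x G) ⟩
    ∑ (allFin n) (λ x → ∑ (subsets n) (λ T → [ x ∈? T ] * G T))
      ≈⟨ ∑-swap (allFin n) (subsets n) (λ x T → [ x ∈? T ] * G T) ⟩
    ∑ (subsets n) (λ T → ∑ (allFin n) (λ x → [ x ∈? T ] * G T))
      ≈⟨ ∑-cong (subsets n) (λ T → trans (∑-*ʳ (allFin n) (G T) (λ x → [ x ∈? T ])) (*-congʳ (∑-∈ T))) ⟩
    ∑ (subsets n) (λ T → fromℕ ∣ T ∣ * G T)
      ≈⟨ ∑-cong (subsets n) (λ T → size T) ⟩
    ∑ (subsets n) (λ T → fromℕ (suc j) * G T)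
      ≈⟨ ∑-*ˡ (subsets n) (fromℕ (suc j)) G ⟩
    fromℕ (suc j) * ∑ (subsets n) G
      ≈⟨ *-congˡ (∑-filter (indepOfSize? (suc j)) (subsets n) (λ T → weight T * F T)) ⟨
    fromℕ (suc j) * ∑ (ℐ (suc j)) (λ T → weight T * F T) ∎
    where
    G : Subset n → Carrier
    G T = [ indepOfSize? (suc j) T ] * (weight T * F T)

    term : ∀ S x → [ indepOfSize? j S ] * weight S * (ω x * (𝟙 S x * F (S ⊕ x))) ≈ [ ¬? (x ∈? S) ] * G (S ⊕ x)
    term S x = begin-equality
      [ indepOfSize? j S ] * weight S * (ω x * (𝟙 S x * F (S ⊕ x)))
        ≈⟨ solve 5 (λ i w o c f → i :* w :* (o :* (c :* f)) := (i :* c) :* ((o :* w) :* f)) refl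
             [ indepOfSize? j S ] (weight S) (ω x) (𝟙 S x) (F (S ⊕ x)) ⟩
      [ indepOfSize? j S ] * 𝟙 S x * ((ω x * weight S) * F (S ⊕ x))
        ≈⟨ *-congʳ ([]-* (indepOfSize? j S) (cont? S x)) ⟩
      [ indepOfSize? j S ×-dec cont? S x ] * ((ω x * weight S) * F (S ⊕ x))
        ≈⟨ *-congʳ ([]-cong (indepOfSize? j S ×-dec cont? S x) (¬? (x ∈? S) ×-dec indepOfSize? (suc j) (S ⊕ x)) to from) ⟩
      [ ¬? (x ∈? S) ×-dec indepOfSize? (suc j) (S ⊕ x) ] * ((ω x * weight S) * F (S ⊕ x))
        ≈⟨ *-congʳ (sym ([]-* (¬? (x ∈? S)) (indepOfSize? (suc j) (S ⊕ x)))) ⟩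
      [ ¬? (x ∈? S) ] * [ indepOfSize? (suc j) (S ⊕ x) ] * ((ω x * weight S) * F (S ⊕ x))
        ≈⟨ *-assoc _ _ _ ⟩
      [ ¬? (x ∈? S) ] * ([ indepOfSize? (suc j) (S ⊕ x) ] * ((ω x * weight S) * F (S ⊕ x)))
        ≈⟨ []-when (¬? (x ∈? S)) (λ x∉S → *-congˡ (*-congʳ (sym (∏-elements-⊕ S ω x x∉S)))) ⟩
      [ ¬? (x ∈? S) ] * G (S ⊕ x) ∎
      where
      to : IndepOfSize j S × Cont S x → _
      to ((_ , ∣S∣≡j) , cx) = proj₁ cx , proj₂ cx , ≡.trans (∣cont∣ cx) (≡.cong suc ∣S∣≡j)
      from : _ → IndepOfSize j S × Cont S x
      from (x∉S , indep , size) = (cont-indep (x∉S , indep) , ℕ.suc-injective (≡.trans (≡.sym (∣cont∣ (x∉S , indep))) size)) , x∉S , indep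

    size : ∀ T → fromℕ ∣ T ∣ * G T ≈ fromℕ (suc j) * G T
    size T = begin-equality
      fromℕ ∣ T ∣ * G T
        ≈⟨ solve 3 (λ s i f → s :* (i :* f) := i :* (s :* f)) refl (fromℕ ∣ T ∣) [ indepOfSize? (suc j) T ] (weight T * F T) ⟩
      [ indepOfSize? (suc j) T ] * (fromℕ ∣ T ∣ * (weight T * F T))
        ≈⟨ []-when (indepOfSize? (suc j) T) (λ (_ , ∣T∣≡) → *-congʳ (reflexive (≡.cong fromℕ ∣T∣≡))) ⟩
      [ indepOfSize? (suc j) T ] * (fromℕ (suc j) * (weight T * F T))
        ≈⟨ solve 3 (λ s i f → i :* (s :* f) := s :* (i :* f)) refl (fromℕ (suc j)) [ indepOfSize? (suc j) T ] (weight T * F T) ⟩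
      fromℕ (suc j) * G T ∎

  ∑ℐ-zero : ∀ (F : Subset n → Carrier) → ∑ (ℐ 0) (λ S → weight S * F S) ≈ F ⊥
  ∑ℐ-zero F = begin-equality
    ∑ (ℐ 0) (λ S → weight S * F S)
      ≈⟨ ∑-filter (indepOfSize? 0) (subsets n) (λ S → weight S * F S) ⟩
    ∑ (subsets n) (λ S → [ indepOfSize? 0 S ] * (weight S * F S))
      ≈⟨ ∑-cong (subsets n) (λ S → *-congʳ ([]-cong (indepOfSize? 0 S) (⊥ ≟ₛ S)
           (λ (_ , ∣S∣≡0) → ≡.sym (∣S∣≡0⇒S≡⊥ S ∣S∣≡0)) (λ { ≡.refl → ⊥-indep , ∣⊥∣≡0 n }))) ⟩
    ∑ (subsets n) (λ S → [ ⊥ ≟ₛ S ] * (weight S * F S))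
      ≈⟨ ∑-subsets-δ ⊥ (λ S → weight S * F S) ⟩
    weight ⊥ * F ⊥
      ≈⟨ trans (*-congʳ (∏-elements-⊥ ω)) (*-identityˡ (F ⊥)) ⟩
    F ⊥ ∎

  -- Summed forms and their values at `ω̂` and `e₀`

  levelSum : ℕ → ℕ → Matrix (suc n)
  levelSum j m a b = ∑ (ℐ j) (λ S → weight S * level m S a b)

  -- Each double counting trades one level for one more element, at the cost of a factor `suc j`;
  -- altogether the constant is `k! / j!`.
  levelSum-base : ∀ m j → m ℕ.+ j ≡ k → ∃ λ c → 0# < c × (∀ a b → levelSum j m a b ≈ c * levelSum k 0 a b)
  levelSum-base zero    .k ≡.refl = 1# , 0<1 , λ a b → sym (*-identityˡ (levelSum k 0 a b))
  levelSum-base (suc m) j eq with levelSum-base m (suc j) (≡.trans (ℕ.+-suc m j) eq)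
  ... | c , 0<c , step = fromℕ (suc j) * c , *-pos (fromℕ-pos j) 0<c , λ a b → begin-equality
    levelSum j (suc m) a b                 ≈⟨ ∑ℐ-suc j (λ T → level m T a b) ⟩
    fromℕ (suc j) * levelSum (suc j) m a b ≈⟨ *-congˡ (step a b) ⟩
    fromℕ (suc j) * (c * levelSum k 0 a b) ≈⟨ *-assoc (fromℕ (suc j)) c (levelSum k 0 a b) ⟨
    fromℕ (suc j) * c * levelSum k 0 a b   ∎

  baseSum : Vector (suc n) → Vector (suc n) → Carrier
  baseSum u v = ∑ (ℐ k) (λ S → weight S * form (base S) u v)

  -- The bridge between the recursive form at the empty set, to which hyperbolicity applies, and the
  -- sum over sets of size `k`, whose values are the numbers `I`.
  level-⊥ : ∃ λ c → 0# < c × (∀ u v → form (level k ⊥) u v ≈ c * baseSum u v)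
  level-⊥ with levelSum-base k 0 (ℕ.+-identityʳ k)
  ... | c , 0<c , step = c , 0<c , λ u v → begin-equality
    form (level k ⊥) u v                          ≈⟨ form-cong (λ a b → trans (sym (∑ℐ-zero (λ S → level k S a b))) (step a b)) u v ⟩
    form (λ a b → c * levelSum k 0 a b) u v       ≈⟨ form-scale c (levelSum k 0) u v ⟩
    c * form (levelSum k 0) u v                   ≈⟨ *-congˡ (form-∑ (ℐ k) weight base u v) ⟩
    c * baseSum u v                               ∎

  e₀ : Vector (suc n)
  e₀ = 1# ◂ (λ _ → 0#)

  ∙-e₀ : ∀ (v : Vector (suc n)) → v ∙ e₀ ≈ v zero
  ∙-e₀ v = begin-equality
    v ∙ e₀                        ≈⟨ ∙-comm v e₀ ⟩
    e₀ ∙ v                        ≈⟨ ◂-∙ 1# (λ _ → 0#) v ⟩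
    1# * v zero + (λ _ → 0#) ∙ (λ x → v (suc x))
      ≈⟨ +-cong (*-identityˡ (v zero)) (∑-0 (allFin n) (λ x → zeroˡ (v (suc x)))) ⟩
    v zero + 0#                   ≈⟨ +-identityʳ (v zero) ⟩
    v zero                        ∎

  ∑ℐ-const : ∀ j c → ∑ (ℐ j) (λ S → weight S * c) ≈ I j * c
  ∑ℐ-const j c = ∑-*ʳ (ℐ j) c weight

  baseSum-ω̂ω̂ : baseSum ω̂ ω̂ ≈ fromℕ (suc k) * (fromℕ (suc (suc k)) * I (suc (suc k)))
  baseSum-ω̂ω̂ = begin-equality
    baseSum ω̂ ω̂
      ≈⟨ ∑-cong (ℐ k) (λ S → *-congˡ (trans (0◂-∙ ω (λ i → base S i ∙ ω̂)) (∙-congˡ ω (λ x → row S x)))) ⟩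
    ∑ (ℐ k) (λ S → weight S * (ω ∙ (λ x → 𝟙 S x * F (S ⊕ x))))
      ≈⟨ ∑ℐ-suc k F ⟩
    fromℕ (suc k) * ∑ (ℐ (suc k)) (λ T → weight T * F T)
      ≈⟨ *-congˡ (∑ℐ-suc (suc k) (λ _ → 1#)) ⟩
    fromℕ (suc k) * (fromℕ (suc (suc k)) * ∑ (ℐ (suc (suc k))) (λ T → weight T * 1#))
      ≈⟨ *-congˡ (*-congˡ (trans (∑ℐ-const (suc (suc k)) 1#) (*-identityʳ _))) ⟩
    fromℕ (suc k) * (fromℕ (suc (suc k)) * I (suc (suc k))) ∎
    where
    F : Subset n → Carrier
    F T = ω ∙ (λ y → 𝟙 T y * 1#)
    row : ∀ S x → base S (suc x) ∙ ω̂ ≈ 𝟙 S x * F (S ⊕ x)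
    row S x = begin-equality
      base S (suc x) ∙ ω̂
        ≈⟨ ∙-0◂ (base S (suc x)) ω ⟩
      ∑ (allFin n) (λ y → 𝟙 S x * 𝟙 (S ⊕ x) y * ω y)
        ≈⟨ ∑-cong (allFin n) (λ y → solve 3 (λ a b w → a :* b :* w := a :* (w :* (b :* con (1 , 0)))) refl (𝟙 S x) (𝟙 (S ⊕ x) y) (ω y)) ⟩
      ∑ (allFin n) (λ y → 𝟙 S x * (ω y * (𝟙 (S ⊕ x) y * 1#)))
        ≈⟨ ∑-*ˡ (allFin n) (𝟙 S x) (λ y → ω y * (𝟙 (S ⊕ x) y * 1#)) ⟩
      𝟙 S x * F (S ⊕ x) ∎

  baseSum-ω̂e₀ : baseSum ω̂ e₀ ≈ fromℕ (suc k) * (I (suc k) * (P - 1#))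
  baseSum-ω̂e₀ = begin-equality
    baseSum ω̂ e₀
      ≈⟨ ∑-cong (ℐ k) (λ S → *-congˡ (trans (0◂-∙ ω (λ i → base S i ∙ e₀)) (∙-congˡ ω (λ x → ∙-e₀ (base S (suc x)))))) ⟩
    ∑ (ℐ k) (λ S → weight S * (ω ∙ (λ x → 𝟙 S x * (P - 1#))))
      ≈⟨ ∑ℐ-suc k (λ _ → P - 1#) ⟩
    fromℕ (suc k) * ∑ (ℐ (suc k)) (λ T → weight T * (P - 1#))
      ≈⟨ *-congˡ (∑ℐ-const (suc k) (P - 1#)) ⟩
    fromℕ (suc k) * (I (suc k) * (P - 1#)) ∎

  form-e₀e₀ : ∀ S → form (base S) e₀ e₀ ≈ P * (P - 1#)
  form-e₀e₀ S = trans (∙-comm e₀ (λ i → base S i ∙ e₀)) (trans (∙-e₀ (λ i → base S i ∙ e₀)) (∙-e₀ (base S zero)))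

  baseSum-e₀e₀ : baseSum e₀ e₀ ≈ I k * (P * (P - 1#))
  baseSum-e₀e₀ = trans (∑-cong (ℐ k) (λ S → *-congˡ (form-e₀e₀ S))) (∑ℐ-const k (P * (P - 1#)))

  combine-ω̂e₀-zero : ∀ a b → combine a ω̂ (- b) e₀ zero ≈ - b
  combine-ω̂e₀-zero a b = solve 2 (λ a b → a :* con (0 , 0) :+ (:- b) :* con (1 , 0) := :- b) refl a b

  combine-ω̂e₀-suc : ∀ a b x → combine a ω̂ (- b) e₀ (suc x) ≈ a * ω x
  combine-ω̂e₀-suc a b x = solve 3 (λ a b w → a :* w :+ (:- b) :* con (0 , 0) := a :* w) refl a b (ω x)

  -- Degeneracy on the plane of `ω̂` and `e₀` against equal class weights

  IsDegenerate : Set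
  IsDegenerate = baseSum ω̂ ω̂ * baseSum e₀ e₀ ≈ baseSum ω̂ e₀ * baseSum ω̂ e₀

  IsBalanced : Carrier → Set
  IsBalanced s = ∀ S → IndepOfSize k S → length (Par S) ≡ p k × (∀ C → IsParallelClass S C → ∑ (elements C) ω ≈ s)

  degenerate⇒balanced : IsDegenerate → ∃ λ s → 0# < s × IsBalanced s
  degenerate⇒balanced degenerate = s , *-cancelˡ-pos 0<α 0<αs , λ S S-size →
      proj₁ (classes S S-size) , λ C isClass →
      *-cancelˡ (∑ (elements C) ω) s (pos⇒≉0 0<α) (trans (proj₂ (classes S S-size) C isClass) (sym αs≈β))
    where
    c : Carrier
    c = proj₁ level-⊥
    0<c : 0# < c
    0<c = proj₁ (proj₂ level-⊥)
    level≈ : ∀ u v → form (level k ⊥) u v ≈ c * baseSum u v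
    level≈ = proj₂ (proj₂ level-⊥)
    N : Matrix (suc n)
    N = level k ⊥
    N-sym : Symmetric N
    N-sym = level-sym k ⊥
    α β γ s : Carrier
    α = form N ω̂ e₀
    β = form N ω̂ ω̂
    γ = form N e₀ e₀
    s = β * α ⁻¹
    -- The coefficients make `z` orthogonal to `ω̂`. Its value is `β * (β * γ - α * α)`, so the
    -- vanishing Gram determinant makes it null.
    z : Vector (suc n)
    z = combine α ω̂ (- β) e₀

    k+∣⊥∣≡k : k ℕ.+ ∣ ⊥ {n} ∣ ≡ k
    k+∣⊥∣≡k = ≡.trans (≡.cong (k ℕ.+_) (∣⊥∣≡0 n)) (ℕ.+-identityʳ k)

    0<β : 0# < β
    0<β = form-ω̂ω̂-pos k ⊥ ⊥-indep k+∣⊥∣≡k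

    0<α : 0# < α
    0<α = begin-strict
      0#                                               <⟨ *-pos 0<c (*-pos (fromℕ-pos k) (*-pos (I-pos (suc k) (ℕ.<⇒≤ 1+k<rk)) 0<P-1)) ⟩
      c * (fromℕ (suc k) * (I (suc k) * (P - 1#)))     ≈⟨ *-congˡ baseSum-ω̂e₀ ⟨
      c * baseSum ω̂ e₀                                 ≈⟨ level≈ ω̂ e₀ ⟨
      α                                                ∎

    αs≈β : α * s ≈ β
    αs≈β = begin-equality
      α * (β * α ⁻¹) ≈⟨ solve 3 (λ a b i → a :* (b :* i) := b :* (a :* i)) refl α β (α ⁻¹) ⟩
      β * (α * α ⁻¹) ≈⟨ *-congˡ (*-inverseʳ α (pos⇒≉0 0<α)) ⟩
      β * 1#         ≈⟨ *-identityʳ β ⟩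
      β              ∎

    0<αs : 0# < α * s
    0<αs = begin-strict
      0#     <⟨ 0<β ⟩
      β      ≈⟨ αs≈β ⟨
      α * s  ∎

    z₀≈ : z zero ≈ - β
    z₀≈ = combine-ω̂e₀-zero α β

    zₓ≈ : ∀ x → z (suc x) ≈ α * ω x
    zₓ≈ = combine-ω̂e₀-suc α β

    αα≈βγ : α * α ≈ β * γ
    αα≈βγ = begin-equality
      α * α                                            ≈⟨ *-cong (level≈ ω̂ e₀) (level≈ ω̂ e₀) ⟩
      c * baseSum ω̂ e₀ * (c * baseSum ω̂ e₀)
        ≈⟨ solve 2 (λ c a → c :* a :* (c :* a) := c :* c :* (a :* a)) refl c (baseSum ω̂ e₀) ⟩
      c * c * (baseSum ω̂ e₀ * baseSum ω̂ e₀)            ≈⟨ *-congˡ degenerate ⟨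
      c * c * (baseSum ω̂ ω̂ * baseSum e₀ e₀)
        ≈⟨ solve 3 (λ c a b → c :* c :* (a :* b) := c :* a :* (c :* b)) refl c (baseSum ω̂ ω̂) (baseSum e₀ e₀) ⟩
      c * baseSum ω̂ ω̂ * (c * baseSum e₀ e₀)            ≈⟨ *-cong (level≈ ω̂ ω̂) (level≈ e₀ e₀) ⟨
      β * γ                                            ∎

    zω̂≈0 : form N z ω̂ ≈ 0#
    zω̂≈0 = begin-equality
      form N z ω̂                          ≈⟨ form-combineˡ N α ω̂ (- β) e₀ ω̂ ⟩
      α * β + (- β) * form N e₀ ω̂         ≈⟨ +-congˡ (*-congˡ (form-sym N-sym e₀ ω̂)) ⟩
      α * β + (- β) * α                   ≈⟨ solve 2 (λ a b → a :* b :+ (:- b) :* a := con (0 , 0)) refl α β ⟩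
      0#                                  ∎

    zz≈0 : form N z z ≈ 0#
    zz≈0 = begin-equality
      form N z z
        ≈⟨ form-square N-sym α ω̂ (- β) e₀ ⟩
      α * α * β + (α * (- β) + α * (- β)) * α + (- β) * (- β) * γ
        ≈⟨ solve 3 (λ a b g → a :* a :* b :+ (a :* (:- b) :+ a :* (:- b)) :* a :+ (:- b) :* (:- b) :* g := b :* (b :* g :- a :* a)) refl α β γ ⟩
      β * (β * γ - α * α)
        ≈⟨ *-congˡ (trans (+-congˡ (-‿cong αα≈βγ)) (-‿inverseʳ (β * γ))) ⟩
      β * 0#
        ≈⟨ zeroʳ β ⟩
      0# ∎

    z-kernel : Kernel N z
    z-kernel = hyperbolic-kernel N-sym (level-hyperbolic k ⊥ ⊥-indep k+∣⊥∣≡k) 0<β z zω̂≈0 zz≈0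

    classes : ∀ S → IndepOfSize k S → length (Par S) ≡ p k × (∀ C → IsParallelClass S C → α * ∑ (elements C) ω ≈ β)
    classes S S-size = kernel-classes {α} {β} {z} {S} 0<β z₀≈ zₓ≈ S-size (kernel-⊆ k ⊥ S z ⊥⊆ S-size k+∣⊥∣≡k z-kernel)

  -- With `P` classes of weight `s`, the values of each base form at `(ω̂, ω̂)`, `(ω̂, e₀)` and
  -- `(e₀, e₀)` are in the ratio `s² : s : 1`. As `s` is the same for every set, the ratio survives
  -- summation.
  balanced⇒degenerate : ∀ s → IsBalanced s → IsDegenerate
  balanced⇒degenerate s balanced = begin-equality
    baseSum ω̂ ω̂ * baseSum e₀ e₀                  ≈⟨ *-congʳ ω̂ω̂≈ ⟩
    s * s * baseSum e₀ e₀ * baseSum e₀ e₀        ≈⟨ solve 2 (λ s b → s :* s :* b :* b := s :* b :* (s :* b)) refl s (baseSum e₀ e₀) ⟩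
    s * baseSum e₀ e₀ * (s * baseSum e₀ e₀)      ≈⟨ *-cong ω̂e₀≈ ω̂e₀≈ ⟨
    baseSum ω̂ e₀ * baseSum ω̂ e₀                  ∎
    where
    size : ∀ {S} → S ∈ ℐ k → IndepOfSize k S
    size S∈ = proj₂ (∈-filter⁻ (indepOfSize? k) {xs = subsets n} S∈)

    classSum≈s : ∀ {S} → S ∈ ℐ k → ∀ {C} → C ∈ Par S → classSum C ω ≈ s
    classSum≈s {S} S∈ {C} C∈ = trans (sym (classSum≈ C)) (proj₂ (balanced S (size S∈)) C (Par-∈ C∈))

    ℓ≈P : ∀ {S} → S ∈ ℐ k → ℓ S ≈ P
    ℓ≈P {S} S∈ = reflexive (≡.cong fromℕ (proj₁ (balanced S (size S∈))))

    ∑-Par-const : ∀ {S} → S ∈ ℐ k → ∀ c → ∑ (Par S) (λ _ → c) ≈ P * c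
    ∑-Par-const {S} S∈ c = begin-equality
      ∑ (Par S) (λ _ → c)       ≈⟨ ∑-cong (Par S) (λ _ → *-identityˡ c) ⟨
      ∑ (Par S) (λ _ → 1# * c)  ≈⟨ ∑-*ʳ (Par S) c (λ _ → 1#) ⟩
      ∑ (Par S) (λ _ → 1#) * c  ≈⟨ *-congʳ (trans (∑-length (Par S)) (ℓ≈P S∈)) ⟩
      P * c                     ∎

    total≈ : ∀ {S} → S ∈ ℐ k → total S ω ≈ P * s
    total≈ {S} S∈ = begin-equality
      total S ω                        ≈⟨ ∑-Par-total S ω ⟨
      ∑ (Par S) (λ C → classSum C ω)   ≈⟨ ∑-cong-∈ (Par S) (classSum≈s S∈) ⟩
      ∑ (Par S) (λ _ → s)              ≈⟨ ∑-Par-const S∈ s ⟩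
      P * s                            ∎

    form-ω̂ω̂ : ∀ {S} → S ∈ ℐ k → form (base S) ω̂ ω̂ ≈ s * s * form (base S) e₀ e₀
    form-ω̂ω̂ {S} S∈ = begin-equality
      form (base S) ω̂ ω̂
        ≈⟨ base-form S ω̂ ⟩
      (total S ω + P * 0#) * (total S ω + P * 0#)
        - ∑ (Par S) (λ C → (classSum C ω + 0#) * (classSum C ω + 0#)) - (P - ℓ S) * (0# * 0#)
        ≈⟨ +-congʳ (+-cong (*-cong (+-congʳ (total≈ S∈)) (+-congʳ (total≈ S∈))) (-‿cong (trans
             (∑-cong-∈ (Par S) (λ C∈ → *-cong (+-congʳ (classSum≈s S∈ C∈)) (+-congʳ (classSum≈s S∈ C∈))))
             (∑-Par-const S∈ ((s + 0#) * (s + 0#)))))) ⟩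
      (P * s + P * 0#) * (P * s + P * 0#) - P * ((s + 0#) * (s + 0#)) - (P - ℓ S) * (0# * 0#)
        ≈⟨ solve 3 (λ P s l → let o = con (0 , 0) in
             (P :* s :+ P :* o) :* (P :* s :+ P :* o) :- P :* ((s :+ o) :* (s :+ o)) :- (P :- l) :* (o :* o)
             := s :* s :* (P :* (P :- con (1 , 0)))) refl P s (ℓ S) ⟩
      s * s * (P * (P - 1#))
        ≈⟨ *-congˡ (form-e₀e₀ S) ⟨
      s * s * form (base S) e₀ e₀ ∎

    form-ω̂e₀ : ∀ {S} → S ∈ ℐ k → form (base S) ω̂ e₀ ≈ s * form (base S) e₀ e₀
    form-ω̂e₀ {S} S∈ = begin-equality
      form (base S) ω̂ e₀                    ≈⟨ form-sym (level-sym 0 S) ω̂ e₀ ⟩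
      form (base S) e₀ ω̂                    ≈⟨ ∙-comm e₀ (λ i → base S i ∙ ω̂) ⟩
      (λ i → base S i ∙ ω̂) ∙ e₀             ≈⟨ ∙-e₀ (λ i → base S i ∙ ω̂) ⟩
      base S zero ∙ ω̂                       ≈⟨ base-top S ω̂ ⟩
      (P - 1#) * (total S ω + P * 0#)       ≈⟨ *-congˡ (+-congʳ (total≈ S∈)) ⟩
      (P - 1#) * (P * s + P * 0#)
        ≈⟨ solve 2 (λ P s → (P :- con (1 , 0)) :* (P :* s :+ P :* con (0 , 0)) := s :* (P :* (P :- con (1 , 0)))) refl P s ⟩
      s * (P * (P - 1#))                    ≈⟨ *-congˡ (form-e₀e₀ S) ⟨
      s * form (base S) e₀ e₀               ∎

    scaled : ∀ c u → (∀ {S} → S ∈ ℐ k → form (base S) ω̂ u ≈ c * form (base S) e₀ e₀) → baseSum ω̂ u ≈ c * baseSum e₀ e₀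
    scaled c u eq = begin-equality
      baseSum ω̂ u
        ≈⟨ ∑-cong-∈ (ℐ k) (λ {S} S∈ → trans (*-congˡ (eq S∈))
             (solve 3 (λ w c f → w :* (c :* f) := c :* (w :* f)) refl (weight S) c (form (base S) e₀ e₀))) ⟩
      ∑ (ℐ k) (λ S → c * (weight S * form (base S) e₀ e₀))
        ≈⟨ ∑-*ˡ (ℐ k) c (λ S → weight S * form (base S) e₀ e₀) ⟩
      c * baseSum e₀ e₀ ∎

    ω̂ω̂≈ : baseSum ω̂ ω̂ ≈ s * s * baseSum e₀ e₀
    ω̂ω̂≈ = scaled (s * s) ω̂ form-ω̂ω̂

    ω̂e₀≈ : baseSum ω̂ e₀ ≈ s * baseSum e₀ e₀
    ω̂e₀≈ = scaled s e₀ form-ω̂e₀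

  -- The equality of the theorem as a vanishing Gram determinant

  module _ where
    private
      κ = fromℕ (suc k)
      π = P - 1#
      a = I k
      b = I (suc k)
      -- Written as in the theorem, so that `IsExtremal` agrees with its left-hand side by
      -- computation; `ω̂ω̂*e₀e₀` converts it to `I (suc (suc k))`.
      c = I (suc k ℕ.+ 1)
      X = (1# + κ ⁻¹) * (1# + π ⁻¹) * a * c
      κ≉0 : ¬ (κ ≈ 0#)
      κ≉0 = pos⇒≉0 (fromℕ-pos k)
      π≉0 : ¬ (π ≈ 0#)
      π≉0 = pos⇒≉0 0<P-1
      κπ≉0 : ¬ (κ * π ≈ 0#)
      κπ≉0 = *-≉0 κ≉0 π≉0

    IsExtremal : Set
    IsExtremal = b ^ 2 ≈ X

    -- As `κ` and `π` are nonzero, the two factors become `κ + 1` and `π + 1`, and the latter is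
    -- `P`.
    clear-denominators : κ * π * X ≈ (1# + κ) * (P * (a * c))
    clear-denominators = begin-equality
      κ * π * X
        ≈⟨ solve 6 (λ k p i j a c → let one = con (1 , 0) in
             k :* p :* ((one :+ i) :* (one :+ j) :* a :* c) := (k :+ k :* i) :* ((p :+ p :* j) :* (a :* c))) refl κ π (κ ⁻¹) (π ⁻¹) a c ⟩
      (κ + κ * κ ⁻¹) * ((π + π * π ⁻¹) * (a * c))
        ≈⟨ *-cong (+-congˡ (*-inverseʳ κ κ≉0)) (*-congʳ (+-congˡ (*-inverseʳ π π≉0))) ⟩
      (κ + 1#) * ((P - 1# + 1#) * (a * c))
        ≈⟨ solve 3 (λ k P x → let one = con (1 , 0) in (k :+ one) :* ((P :- one :+ one) :* x) := (one :+ k) :* (P :* x)) refl κ P (a * c) ⟩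
      (1# + κ) * (P * (a * c)) ∎

    ω̂ω̂*e₀e₀ : baseSum ω̂ ω̂ * baseSum e₀ e₀ ≈ κ * π * (κ * π * X)
    ω̂ω̂*e₀e₀ = begin-equality
      baseSum ω̂ ω̂ * baseSum e₀ e₀
        ≈⟨ *-cong (trans baseSum-ω̂ω̂ (*-congˡ (*-congˡ (reflexive (≡.cong I (ℕ.+-comm 1 (suc k))))))) baseSum-e₀e₀ ⟩
      κ * ((1# + κ) * c) * (a * (P * π))
        ≈⟨ solve 5 (λ k p P a c → let one = con (1 , 0) in
             k :* ((one :+ k) :* c) :* (a :* (P :* p)) := k :* p :* ((one :+ k) :* (P :* (a :* c)))) refl κ π P a c ⟩
      κ * π * ((1# + κ) * (P * (a * c)))
        ≈⟨ *-congˡ clear-denominators ⟨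
      κ * π * (κ * π * X) ∎

    ω̂e₀*ω̂e₀ : baseSum ω̂ e₀ * baseSum ω̂ e₀ ≈ κ * π * (κ * π * b ^ 2)
    ω̂e₀*ω̂e₀ = begin-equality
      baseSum ω̂ e₀ * baseSum ω̂ e₀
        ≈⟨ *-cong baseSum-ω̂e₀ baseSum-ω̂e₀ ⟩
      κ * (b * π) * (κ * (b * π))
        ≈⟨ solve 3 (λ k p b → k :* (b :* p) :* (k :* (b :* p)) := k :* p :* (k :* p :* (b :* (b :* con (1 , 0))))) refl κ π b ⟩
      κ * π * (κ * π * b ^ 2) ∎

    extremal⇒degenerate : IsExtremal → IsDegenerate
    extremal⇒degenerate eq = trans ω̂ω̂*e₀e₀ (trans (*-congˡ (*-congˡ (sym eq))) (sym ω̂e₀*ω̂e₀))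

    degenerate⇒extremal : IsDegenerate → IsExtremal
    degenerate⇒extremal eq = *-cancelˡ (b ^ 2) X κπ≉0 (*-cancelˡ (κ * π * b ^ 2) (κ * π * X) κπ≉0 (trans (sym ω̂e₀*ω̂e₀) (trans (sym eq) ω̂ω̂*e₀e₀)))

theorem1p10 : (ℝ : CompleteOrderedField) →
    let open CompleteOrderedField ℝ in
    (n : ℕ) (M : Matroid n) →
    let open Matroid M in
    (k : ℕ) → 1 ≤ℕ k → k <ℕ rk →
    (ω : Fin n → Carrier) → (∀ x → 0# < ω x) →
    let open Weighted ℝ M ω in
    (I k ^ 2 ≈ (1# + fromℕ k ⁻¹) * (1# + (fromℕ (p (k ∸ 1)) - 1#) ⁻¹) * I (k ∸ 1) * I (k +ℕ 1))
    ⇔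
    (∃ λ s → 0# < s ×
    (∀ S → IndepOfSize (k ∸ 1) S →
    length (Par S) ≡ p (k ∸ 1) ×
    (∀ C → IsParallelClass S C → ∑ (elements C) ω ≈ s)))
-- Matching on `suc k` makes `k ∸ 1` compute to the parameter of `IndependenceForms`.
theorem1p10 ℝ n M (suc k) _ 1+k<rk ω 0<ω = mk⇔
  (λ extremal → N.degenerate⇒balanced (N.extremal⇒degenerate extremal))
  (λ (s , _ , balanced) → N.degenerate⇒extremal (N.balanced⇒degenerate s balanced))
  where
  module N = IndependenceForms ℝ M ω 0<ω k 1+k<rk
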